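{- Let $n$ be a positive integer. If $G$ is a connected $n$-vertex graph that is not isomorphic to $K_1$, $K_2$, or $P_3$, then $\mathcal{E}_3^{+}(G)\geq \frac{\sqrt{5}}{2}\,n$.
   Context: All graphs are finite and simple. $K_m$ is the complete graph on $m$ vertices and $P_3$ is the path on $3$ vertices. For an $n$-vertex graph $G$, let $\lambda_1(G)\geq\cdots\geq\lambda_n(G)$ be the eigenvalues (with multiplicity) of its adjacency matrix. The positive $3$-energy of $G$ is $\mathcal{E}^+_3(G)=\sum_{i:\lambda_i(G)>0}|\lambda_i(G)|^3$. -}

module Defs where

open import Algebra.Bundles.Raw using (RawRing)
import Algebra.Definitions.RawSemiring as RawSemiringDefinitions
open import Data.Bool.Base using (if_then_else_)
open import Data.Fin.Base as Fin using (Fin; zero; suc; toℕ)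
import Data.Fin.Properties as Fin
open import Data.Integer.Base as ℤ using (+_)
import Data.Integer.Properties as ℤ
open import Data.Nat.Base as ℕ using (ℕ; zero; suc)
import Data.Nat.Properties as ℕ
import Data.Nat.Solver as ℕ
open import Data.Product.Base using (Σ; _×_; _,_; ∃; proj₁; proj₂)
open import Data.Rational.Base as ℚ using (ℚ; 0ℚ; 1ℚ; ½; mkℚ)
import Data.Rational.Properties as ℚ
import Data.Rational.Solver as ℚ
import Data.Rational.Unnormalised.Base as ℚᵘ
import Data.Rational.Unnormalised.Properties as ℚᵘ
open import Data.Sum.Base using (_⊎_; inj₁; inj₂; swap; [_,_]′)
open import Data.Vec.Functional using (Vector; removeAt)
open import Function.Base using (_∘_; _$_)
open import Function.Bundles using (_↔_; _⇔_; Inverse)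
open import Level using (0ℓ)
open import Relation.Binary.Core using (Rel)
open import Relation.Binary.Construct.Closure.ReflexiveTransitive using (Star)
open import Relation.Binary.Definitions using (Decidable; Symmetric; Irreflexive)
open import Relation.Binary.PropositionalEquality
  using (_≡_; _≢_; refl; sym; trans; cong; cong₂; subst; subst₂)
open import Relation.Nullary using (¬_; yes; no; does)
open import Relation.Nullary.Decidable using (_⊎-dec_; ¬?)

-- The integer square root ⌊ √ m ⌋.
isqrt : ℕ → ℕ
isqrt zero    = zero
isqrt (suc m) with suc (isqrt m) ℕ.* suc (isqrt m) ℕ.≤? suc m
... | yes _ = suc (isqrt m)
... | no  _ = isqrt m

isqrt-spec : ∀ m → isqrt m ℕ.* isqrt m ℕ.≤ m × m ℕ.< suc (isqrt m) ℕ.* suc (isqrt m)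
isqrt-spec zero = ℕ.z≤n , ℕ.s≤s ℕ.z≤n
isqrt-spec (suc m) with suc (isqrt m) ℕ.* suc (isqrt m) ℕ.≤? suc m | isqrt-spec m
... | yes p | _  , hi = p , ℕ.≤-<-trans hi
  (ℕ.*-mono-< (ℕ.n<1+n (suc (isqrt m))) (ℕ.n<1+n (suc (isqrt m))))
... | no ¬p | lo , _  = ℕ.m≤n⇒m≤1+n lo , ℕ.≰⇒> ¬p

private
  abstract
    -- If a / k ≤ √m < (1 + b) / l then a / k ≤ (1 + b) / l.
    isqrt-cross : ∀ m a b k l .{{_ : ℕ.NonZero k}} →
                  a ℕ.* a ℕ.≤ m ℕ.* (k ℕ.* k) → m ℕ.* (l ℕ.* l) ℕ.< suc b ℕ.* suc b →
                  a ℕ.* l ℕ.≤ suc b ℕ.* k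
    isqrt-cross m a b k l lo hi = ℕ.≮⇒≥ λ lt → ℕ.<-irrefl refl $ begin-strict
      suc b ℕ.* k ℕ.* (suc b ℕ.* k)        ≤⟨ ℕ.*-mono-≤ (ℕ.<⇒≤ lt) (ℕ.<⇒≤ lt) ⟩
      a ℕ.* l ℕ.* (a ℕ.* l)                ≡⟨ sq a l ⟩
      a ℕ.* a ℕ.* (l ℕ.* l)                ≤⟨ ℕ.*-monoˡ-≤ (l ℕ.* l) lo ⟩
      m ℕ.* (k ℕ.* k) ℕ.* (l ℕ.* l)        ≡⟨ comm m (k ℕ.* k) (l ℕ.* l) ⟩
      m ℕ.* (l ℕ.* l) ℕ.* (k ℕ.* k)        <⟨ ℕ.*-monoˡ-< (k ℕ.* k) {{ℕ.m*n≢0 k k}} hi ⟩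
      suc b ℕ.* suc b ℕ.* (k ℕ.* k)        ≡⟨ sym (sq (suc b) k) ⟩
      suc b ℕ.* k ℕ.* (suc b ℕ.* k)        ∎
      where
      open ℕ.≤-Reasoning
      open ℕ.+-*-Solver
      sq : ∀ x y → x ℕ.* y ℕ.* (x ℕ.* y) ≡ x ℕ.* x ℕ.* (y ℕ.* y)
      sq = solve 2 (λ x y → x :* y :* (x :* y) := x :* x :* (y :* y)) refl
      comm : ∀ x y z → x ℕ.* y ℕ.* z ≡ x ℕ.* z ℕ.* y
      comm = solve 3 (λ x y z → x :* y :* z := x :* z :* y) refl

    frac-mono : ∀ a b k l .{{_ : ℕ.NonZero k}} .{{_ : ℕ.NonZero l}} →
                a ℕ.* l ℕ.≤ b ℕ.* k → + a ℚ./ k ℚ.≤ + b ℚ./ l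
    frac-mono a b (suc k) (suc l) h = ℚ.toℚᵘ-cancel-≤ (begin
      ℚ.toℚᵘ (+ a ℚ./ suc k)  ≃⟨ ℚ.toℚᵘ-fromℚᵘ (ℚᵘ.mkℚᵘ (+ a) k) ⟩
      ℚᵘ.mkℚᵘ (+ a) k         ≤⟨ ℚᵘ.*≤* (subst₂ ℤ._≤_ (ℤ.pos-* a (suc l)) (ℤ.pos-* b (suc k)) (ℤ.+≤+ h)) ⟩
      ℚᵘ.mkℚᵘ (+ b) l         ≃⟨ ℚᵘ.≃-sym (ℚ.toℚᵘ-fromℚᵘ (ℚᵘ.mkℚᵘ (+ b) l)) ⟩
      ℚ.toℚᵘ (+ b ℚ./ suc l)  ∎)
      where open ℚᵘ.≤-Reasoning

    frac-+ : ∀ a b k .{{_ : ℕ.NonZero k}} → + (a ℕ.+ b) ℚ./ k ≡ + a ℚ./ k ℚ.+ + b ℚ./ k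
    frac-+ a b k@(suc k-1) = ℚ.toℚᵘ-injective (begin
      ℚ.toℚᵘ (+ (a ℕ.+ b) ℚ./ k)                      ≈⟨ ℚ.toℚᵘ-fromℚᵘ (ℚᵘ.mkℚᵘ (+ (a ℕ.+ b)) k-1) ⟩
      ℚᵘ.mkℚᵘ (+ (a ℕ.+ b)) k-1                       ≈⟨ ℚᵘ.*≡* eq ⟩
      ℚᵘ.mkℚᵘ (+ a) k-1 ℚᵘ.+ ℚᵘ.mkℚᵘ (+ b) k-1        ≈⟨ ℚᵘ.≃-sym (ℚᵘ.+-cong (ℚ.toℚᵘ-fromℚᵘ (ℚᵘ.mkℚᵘ (+ a) k-1)) (ℚ.toℚᵘ-fromℚᵘ (ℚᵘ.mkℚᵘ (+ b) k-1))) ⟩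
      ℚ.toℚᵘ (+ a ℚ./ k) ℚᵘ.+ ℚ.toℚᵘ (+ b ℚ./ k)      ≈⟨ ℚᵘ.≃-sym (ℚ.toℚᵘ-homo-+ (+ a ℚ./ k) (+ b ℚ./ k)) ⟩
      ℚ.toℚᵘ (+ a ℚ./ k ℚ.+ + b ℚ./ k)                ∎)
      where
      open import Relation.Binary.Reasoning.Setoid ℚᵘ.≃-setoid
      eq : + (a ℕ.+ b) ℤ.* + (k ℕ.* k) ≡ (+ a ℤ.* + k ℤ.+ + b ℤ.* + k) ℤ.* + k
      eq = trans (cong (λ z → + (a ℕ.+ b) ℤ.* z) (ℤ.pos-* k k))
          (trans (sym (ℤ.*-assoc (+ (a ℕ.+ b)) (+ k) (+ k)))
                 (cong (ℤ._* + k) (ℤ.*-distribʳ-+ (+ k) (+ a) (+ b))))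

    frac-* : ∀ a b k l .{{_ : ℕ.NonZero k}} .{{_ : ℕ.NonZero l}} .{{_ : ℕ.NonZero (k ℕ.* l)}} →
             + (a ℕ.* b) ℚ./ (k ℕ.* l) ≡ (+ a ℚ./ k) ℚ.* (+ b ℚ./ l)
    frac-* a b k@(suc k-1) l@(suc l-1) = ℚ.toℚᵘ-injective (begin
      ℚ.toℚᵘ (+ (a ℕ.* b) ℚ./ (k ℕ.* l))              ≈⟨ ℚ.toℚᵘ-fromℚᵘ (ℚᵘ.mkℚᵘ (+ (a ℕ.* b)) (l-1 ℕ.+ k-1 ℕ.* l)) ⟩
      ℚᵘ.mkℚᵘ (+ (a ℕ.* b)) (l-1 ℕ.+ k-1 ℕ.* l)       ≈⟨ ℚᵘ.*≡* (cong (ℤ._* + (k ℕ.* l)) (ℤ.pos-* a b)) ⟩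
      ℚᵘ.mkℚᵘ (+ a) k-1 ℚᵘ.* ℚᵘ.mkℚᵘ (+ b) l-1        ≈⟨ ℚᵘ.≃-sym (ℚᵘ.*-cong (ℚ.toℚᵘ-fromℚᵘ (ℚᵘ.mkℚᵘ (+ a) k-1)) (ℚ.toℚᵘ-fromℚᵘ (ℚᵘ.mkℚᵘ (+ b) l-1))) ⟩
      ℚ.toℚᵘ (+ a ℚ./ k) ℚᵘ.* ℚ.toℚᵘ (+ b ℚ./ l)      ≈⟨ ℚᵘ.≃-sym (ℚ.toℚᵘ-homo-* (+ a ℚ./ k) (+ b ℚ./ l)) ⟩
      ℚ.toℚᵘ ((+ a ℚ./ k) ℚ.* (+ b ℚ./ l))                ∎)
      where open import Relation.Binary.Reasoning.Setoid ℚᵘ.≃-setoid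

    archimedean : ∀ c {ε} → 0ℚ ℚ.< ε → ∃ λ N → ∀ k → N ℕ.≤ k → + c ℚ./ suc k ℚ.≤ ε
    archimedean c {ε@(mkℚ (+ suc p) d _)} _ = c ℕ.* suc d , λ k N≤k →
      subst (_ ℚ.≤_) (ℚ.fromℚᵘ-toℚᵘ ε) (frac-mono c (suc p) (suc k) (suc d)
        (ℕ.≤-trans N≤k (ℕ.≤-trans (ℕ.n≤1+n k) (ℕ.m≤m+n (suc k) (p ℕ.* suc k)))))
    archimedean c {mkℚ (+ zero)   d _} (ℚ.*<* (ℤ.+<+ ()))
    archimedean c {mkℚ ℤ.-[1+ n ] d _} (ℚ.*<* ())

    ∣p∣≤r : ∀ {p r} → p ℚ.≤ r → ℚ.- p ℚ.≤ r → ℚ.∣ p ∣ ℚ.≤ r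
    ∣p∣≤r {p} h₁ h₂ with ℚ.∣p∣≡p∨∣p∣≡-p p
    ... | inj₁ e = ℚ.≤-trans (ℚ.≤-reflexive e) h₁
    ... | inj₂ e = ℚ.≤-trans (ℚ.≤-reflexive e) h₂

    p≤∣p∣ : ∀ p → p ℚ.≤ ℚ.∣ p ∣
    p≤∣p∣ p with ℚ.≤-total 0ℚ p
    ... | inj₁ h = ℚ.≤-reflexive (sym (ℚ.0≤p⇒∣p∣≡p h))
    ... | inj₂ h = ℚ.≤-trans h (ℚ.0≤∣p∣ p)

    p+q-q≡p : ∀ p q → p ℚ.+ q ℚ.- q ≡ p
    p+q-q≡p p q = trans (ℚ.+-assoc p q (ℚ.- q))
      (trans (cong (p ℚ.+_) (ℚ.+-inverseʳ q)) (ℚ.+-identityʳ p))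

    p-q+q≡p : ∀ p q → p ℚ.- q ℚ.+ q ≡ p
    p-q+q≡p p q = trans (ℚ.+-assoc p (ℚ.- q) q)
      (trans (cong (p ℚ.+_) (ℚ.+-inverseˡ q)) (ℚ.+-identityʳ p))

    -[p-q]≡q-p : ∀ p q → ℚ.- (p ℚ.- q) ≡ q ℚ.- p
    -[p-q]≡q-p = solve 2 (λ p q → :- (p :- q) := q :- p) refl
      where open ℚ.+-*-Solver

    ∣p-q∣≡∣q-p∣ : ∀ p q → ℚ.∣ p ℚ.- q ∣ ≡ ℚ.∣ q ℚ.- p ∣
    ∣p-q∣≡∣q-p∣ p q = trans (sym (ℚ.∣-p∣≡∣p∣ (p ℚ.- q))) (cong ℚ.∣_∣ (-[p-q]≡q-p p q))

    p-q≤r : ∀ {p q r} → p ℚ.≤ r ℚ.+ q → p ℚ.- q ℚ.≤ r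
    p-q≤r {p} {q} {r} h = subst (_ ℚ.≤_) (p+q-q≡p r q) (ℚ.+-monoˡ-≤ (ℚ.- q) h)

    p≤r+q : ∀ {p q r} → p ℚ.- q ℚ.≤ r → p ℚ.≤ r ℚ.+ q
    p≤r+q {p} {q} h = subst (ℚ._≤ _) (p-q+q≡p p q) (ℚ.+-monoˡ-≤ q h)

    ∣p-q∣≤r : ∀ {p q r} → p ℚ.≤ r ℚ.+ q → q ℚ.≤ r ℚ.+ p → ℚ.∣ p ℚ.- q ∣ ℚ.≤ r
    ∣p-q∣≤r {p} {q} h₁ h₂ =
      ∣p∣≤r (p-q≤r h₁) (subst (ℚ._≤ _) (sym (-[p-q]≡q-p p q)) (p-q≤r h₂))

    ∣p-q∣≤r⇒p≤r+q : ∀ {p q r} → ℚ.∣ p ℚ.- q ∣ ℚ.≤ r → p ℚ.≤ r ℚ.+ q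
    ∣p-q∣≤r⇒p≤r+q {p} {q} h = p≤r+q (ℚ.≤-trans (p≤∣p∣ (p ℚ.- q)) h)

    0<½* : ∀ {ε} → 0ℚ ℚ.< ε → 0ℚ ℚ.< ½ ℚ.* ε
    0<½* {ε} h = ℚ.positive⁻¹ (½ ℚ.* ε) {{ℚ.pos*pos⇒pos ½ ε {{ℚ.positive h}}}}

    ½+½ : ∀ ε → ½ ℚ.* ε ℚ.+ ½ ℚ.* ε ≡ ε
    ½+½ ε = trans (sym (ℚ.*-distribʳ-+ ε ½ ½)) (ℚ.*-identityˡ ε)

-- Real numbers are Cauchy sequences of rationals; equality of reals is _≃_.
record ℝ : Set where
  field
    seq    : ℕ → ℚ
    cauchy : ∀ ε → 0ℚ ℚ.< ε →
             ∃ λ N → ∀ m n → N ℕ.≤ m → N ℕ.≤ n → ℚ.∣ seq m ℚ.- seq n ∣ ℚ.≤ ε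

open ℝ public

infix 4 _≃_ _≤_ _<_

_≃_ : Rel ℝ 0ℓ
x ≃ y = ∀ ε → 0ℚ ℚ.< ε → ∃ λ N → ∀ n → N ℕ.≤ n → ℚ.∣ seq x n ℚ.- seq y n ∣ ℚ.≤ ε

_≤_ : Rel ℝ 0ℓ
x ≤ y = ∀ ε → 0ℚ ℚ.< ε → ∃ λ N → ∀ n → N ℕ.≤ n → seq x n ℚ.≤ ε ℚ.+ seq y n

_<_ : Rel ℝ 0ℓ
x < y = ∃ λ ε → 0ℚ ℚ.< ε × ∃ λ N → ∀ n → N ℕ.≤ n → ε ℚ.+ seq x n ℚ.≤ seq y n

fromℚ : ℚ → ℝ
fromℚ p .seq _ = p
fromℚ p .cauchy ε 0<ε =
  0 , λ _ _ _ _ → subst (λ z → ℚ.∣ z ∣ ℚ.≤ ε) (sym (ℚ.+-inverseʳ p)) (ℚ.<⇒≤ 0<ε)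

fromℕ : ℕ → ℝ
fromℕ n = fromℚ (+ n ℚ./ 1)

infixl 6 _+_ _-_
infixl 7 _*_
infix  8 -_ _⁺

_+_ : ℝ → ℝ → ℝ
(x + y) .seq n = seq x n ℚ.+ seq y n
(x + y) .cauchy ε 0<ε with cauchy x (½ ℚ.* ε) (0<½* 0<ε) | cauchy y (½ ℚ.* ε) (0<½* 0<ε)
... | M , hx | N , hy = M ℕ.⊔ N , λ m n M⊔N≤m M⊔N≤n → begin
  ℚ.∣ seq x m ℚ.+ seq y m ℚ.- (seq x n ℚ.+ seq y n) ∣
    ≡⟨ cong ℚ.∣_∣ (interchange (seq x m) (seq y m) (seq x n) (seq y n)) ⟩
  ℚ.∣ (seq x m ℚ.- seq x n) ℚ.+ (seq y m ℚ.- seq y n) ∣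
    ≤⟨ ℚ.∣p+q∣≤∣p∣+∣q∣ (seq x m ℚ.- seq x n) (seq y m ℚ.- seq y n) ⟩
  ℚ.∣ seq x m ℚ.- seq x n ∣ ℚ.+ ℚ.∣ seq y m ℚ.- seq y n ∣
    ≤⟨ ℚ.+-mono-≤ (hx m n (ℕ.m⊔n≤o⇒m≤o M N M⊔N≤m) (ℕ.m⊔n≤o⇒m≤o M N M⊔N≤n))
                  (hy m n (ℕ.m⊔n≤o⇒n≤o M N M⊔N≤m) (ℕ.m⊔n≤o⇒n≤o M N M⊔N≤n)) ⟩
  ½ ℚ.* ε ℚ.+ ½ ℚ.* ε
    ≡⟨ ½+½ ε ⟩
  ε ∎
  where
  open ℚ.≤-Reasoning
  interchange : ∀ a b c d → a ℚ.+ b ℚ.- (c ℚ.+ d) ≡ (a ℚ.- c) ℚ.+ (b ℚ.- d)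
  interchange = solve 4 (λ a b c d → a :+ b :- (c :+ d) := (a :- c) :+ (b :- d)) refl
    where open ℚ.+-*-Solver

private
  module _ (f : ℚ → ℚ) (f-lipschitz : ∀ p q → ℚ.∣ f p ℚ.- f q ∣ ℚ.≤ ℚ.∣ p ℚ.- q ∣) where

    map : ℝ → ℝ
    map x .seq = f ∘ seq x
    map x .cauchy ε 0<ε with cauchy x ε 0<ε
    ... | N , h = N , λ m n N≤m N≤n →
      ℚ.≤-trans (f-lipschitz (seq x m) (seq x n)) (h m n N≤m N≤n)

  abstract
    lipschitz : ∀ (f : ℚ → ℚ) → (∀ p q → f p ℚ.≤ ℚ.∣ p ℚ.- q ∣ ℚ.+ f q) →
                ∀ p q → ℚ.∣ f p ℚ.- f q ∣ ℚ.≤ ℚ.∣ p ℚ.- q ∣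
    lipschitz f h p q =
      ∣p-q∣≤r (h p q) (subst (λ z → f q ℚ.≤ z ℚ.+ f p) (∣p-q∣≡∣q-p∣ q p) (h q p))

    neg-lipschitz : ∀ p q → ℚ.∣ ℚ.- p ℚ.- ℚ.- q ∣ ℚ.≤ ℚ.∣ p ℚ.- q ∣
    neg-lipschitz p q = ℚ.≤-reflexive
      (trans (cong ℚ.∣_∣ (sym (ℚ.neg-distrib-+ p (ℚ.- q)))) (ℚ.∣-p∣≡∣p∣ (p ℚ.- q)))

    abs-lipschitz : ∀ p q → ℚ.∣ ℚ.∣ p ∣ ℚ.- ℚ.∣ q ∣ ∣ ℚ.≤ ℚ.∣ p ℚ.- q ∣
    abs-lipschitz = lipschitz ℚ.∣_∣ λ p q →
      subst (λ z → ℚ.∣ z ∣ ℚ.≤ ℚ.∣ p ℚ.- q ∣ ℚ.+ ℚ.∣ q ∣) (p-q+q≡p p q)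
        (ℚ.∣p+q∣≤∣p∣+∣q∣ (p ℚ.- q) q)

    pos-lipschitz : ∀ p q → ℚ.∣ (p ℚ.⊔ 0ℚ) ℚ.- (q ℚ.⊔ 0ℚ) ∣ ℚ.≤ ℚ.∣ p ℚ.- q ∣
    pos-lipschitz = lipschitz (ℚ._⊔ 0ℚ) λ p q → ℚ.⊔-lub
      (ℚ.≤-trans (∣p-q∣≤r⇒p≤r+q {p} {q} ℚ.≤-refl)
                 (ℚ.+-monoʳ-≤ ℚ.∣ p ℚ.- q ∣ (ℚ.p≤p⊔q q 0ℚ)))
      (ℚ.+-mono-≤ (ℚ.0≤∣p∣ (p ℚ.- q)) (ℚ.p≤q⊔p q 0ℚ))

-_ : ℝ → ℝ
-_ = map ℚ.-_ neg-lipschitz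

_-_ : ℝ → ℝ → ℝ
x - y = x + - y

∣_∣ : ℝ → ℝ
∣_∣ = map ℚ.∣_∣ abs-lipschitz

_⁺ : ℝ → ℝ
_⁺ = map (ℚ._⊔ 0ℚ) pos-lipschitz

private
  abstract
    bounded : ∀ x → ∃ λ K → 0ℚ ℚ.< K × ∃ λ N → ∀ n → N ℕ.≤ n → ℚ.∣ seq x n ∣ ℚ.≤ K
    bounded x with cauchy x 1ℚ (ℚ.positive⁻¹ 1ℚ)
    ... | N , h = 1ℚ ℚ.+ ℚ.∣ seq x N ∣
                , ℚ.+-mono-<-≤ (ℚ.positive⁻¹ 1ℚ) (ℚ.0≤∣p∣ (seq x N))
                , N , λ n N≤n → ∣p-q∣≤r⇒p≤r+q
                    (ℚ.≤-trans (abs-lipschitz (seq x n) (seq x N)) (h n N N≤n ℕ.≤-refl))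

    *-estimate : ∀ {a b c d K δ} → 0ℚ ℚ.< K → 0ℚ ℚ.< δ →
                 ℚ.∣ a ∣ ℚ.≤ K → ℚ.∣ d ∣ ℚ.≤ K → ℚ.∣ a ℚ.- c ∣ ℚ.≤ δ → ℚ.∣ b ℚ.- d ∣ ℚ.≤ δ →
                 ℚ.∣ a ℚ.* b ℚ.- c ℚ.* d ∣ ℚ.≤ K ℚ.* δ ℚ.+ K ℚ.* δ
    *-estimate {a} {b} {c} {d} {K} {δ} 0<K 0<δ ∣a∣≤K ∣d∣≤K a≈c b≈d = begin
      ℚ.∣ a ℚ.* b ℚ.- c ℚ.* d ∣
        ≡⟨ cong ℚ.∣_∣ (expand a b c d) ⟩
      ℚ.∣ a ℚ.* (b ℚ.- d) ℚ.+ d ℚ.* (a ℚ.- c) ∣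
        ≤⟨ ℚ.∣p+q∣≤∣p∣+∣q∣ (a ℚ.* (b ℚ.- d)) (d ℚ.* (a ℚ.- c)) ⟩
      ℚ.∣ a ℚ.* (b ℚ.- d) ∣ ℚ.+ ℚ.∣ d ℚ.* (a ℚ.- c) ∣
        ≤⟨ ℚ.+-mono-≤ (bound ∣a∣≤K b≈d) (bound ∣d∣≤K a≈c) ⟩
      K ℚ.* δ ℚ.+ K ℚ.* δ ∎
      where
      open ℚ.≤-Reasoning
      expand : ∀ a b c d → a ℚ.* b ℚ.- c ℚ.* d ≡ a ℚ.* (b ℚ.- d) ℚ.+ d ℚ.* (a ℚ.- c)
      expand = solve 4 (λ a b c d → a :* b :- c :* d := a :* (b :- d) :+ d :* (a :- c)) refl
        where open ℚ.+-*-Solver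
      bound : ∀ {p q} → ℚ.∣ p ∣ ℚ.≤ K → ℚ.∣ q ∣ ℚ.≤ δ → ℚ.∣ p ℚ.* q ∣ ℚ.≤ K ℚ.* δ
      bound {p} {q} h₁ h₂ = begin
        ℚ.∣ p ℚ.* q ∣         ≡⟨ ℚ.∣p*q∣≡∣p∣*∣q∣ p q ⟩
        ℚ.∣ p ∣ ℚ.* ℚ.∣ q ∣   ≤⟨ ℚ.*-monoʳ-≤-nonNeg ℚ.∣ q ∣ {{ℚ.∣-∣-nonNeg q}} h₁ ⟩
        K ℚ.* ℚ.∣ q ∣         ≤⟨ ℚ.*-monoˡ-≤-nonNeg K {{ℚ.nonNegative (ℚ.<⇒≤ 0<K)}} h₂ ⟩
        K ℚ.* δ               ∎

_*_ : ℝ → ℝ → ℝ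
(x * y) .seq n = seq x n ℚ.* seq y n
(x * y) .cauchy ε 0<ε = go (bounded x) (bounded y)
  where
  go : (∃ λ K → 0ℚ ℚ.< K × ∃ λ N → ∀ n → N ℕ.≤ n → ℚ.∣ seq x n ∣ ℚ.≤ K) →
       (∃ λ K → 0ℚ ℚ.< K × ∃ λ N → ∀ n → N ℕ.≤ n → ℚ.∣ seq y n ∣ ℚ.≤ K) → _
  go (Kx , 0<Kx , Nx , hx) (Ky , 0<Ky , Ny , hy) = N , λ m n N≤m N≤n →
    ℚ.≤-trans
      (*-estimate {seq x m} {seq y m} {seq x n} {seq y n} 0<K 0<δ
        (ℚ.≤-trans (hx m (ℕ.≤-trans Nx≤N N≤m)) (ℚ.≤-trans (ℚ.≤-reflexive (sym (ℚ.+-identityʳ Kx))) (ℚ.+-monoʳ-≤ Kx (ℚ.<⇒≤ 0<Ky))))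
        (ℚ.≤-trans (hy n (ℕ.≤-trans Ny≤N N≤n)) (ℚ.≤-trans (ℚ.≤-reflexive (sym (ℚ.+-identityˡ Ky))) (ℚ.+-monoˡ-≤ Ky (ℚ.<⇒≤ 0<Kx))))
        (proj₂ cx m n (ℕ.≤-trans Cx≤N N≤m) (ℕ.≤-trans Cx≤N N≤n))
        (proj₂ cy m n (ℕ.≤-trans Cy≤N N≤m) (ℕ.≤-trans Cy≤N N≤n)))
      (ℚ.≤-reflexive (trans (cong₂ ℚ._+_ Kδ Kδ) (½+½ ε)))
    where
    K : ℚ
    K = Kx ℚ.+ Ky
    0<K : 0ℚ ℚ.< K
    0<K = ℚ.+-mono-< 0<Kx 0<Ky
    instance
      K-positive : ℚ.Positive K
      K-positive = ℚ.positive 0<K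
      K-nonZero : ℚ.NonZero K
      K-nonZero = ℚ.pos⇒nonZero K
    δ : ℚ
    δ = ℚ.1/ K ℚ.* (½ ℚ.* ε)
    0<δ : 0ℚ ℚ.< δ
    0<δ = ℚ.positive⁻¹ δ {{ℚ.pos*pos⇒pos (ℚ.1/ K) {{ℚ.1/pos⇒pos K}} (½ ℚ.* ε) {{ℚ.positive (0<½* 0<ε)}}}}
    Kδ : K ℚ.* δ ≡ ½ ℚ.* ε
    Kδ = trans (sym (ℚ.*-assoc K (ℚ.1/ K) (½ ℚ.* ε)))
        (trans (cong (ℚ._* (½ ℚ.* ε)) (ℚ.*-inverseʳ K)) (ℚ.*-identityˡ (½ ℚ.* ε)))
    cx = cauchy x δ 0<δ
    cy = cauchy y δ 0<δ
    N : ℕ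
    N = (Nx ℕ.⊔ Ny) ℕ.⊔ (proj₁ cx ℕ.⊔ proj₁ cy)
    Nx≤N = ℕ.≤-trans (ℕ.m≤m⊔n Nx Ny) (ℕ.m≤m⊔n _ (proj₁ cx ℕ.⊔ proj₁ cy))
    Ny≤N = ℕ.≤-trans (ℕ.m≤n⊔m Nx Ny) (ℕ.m≤m⊔n _ (proj₁ cx ℕ.⊔ proj₁ cy))
    Cx≤N = ℕ.≤-trans (ℕ.m≤m⊔n (proj₁ cx) (proj₁ cy)) (ℕ.m≤n⊔m (Nx ℕ.⊔ Ny) _)
    Cy≤N = ℕ.≤-trans (ℕ.m≤n⊔m (proj₁ cx) (proj₁ cy)) (ℕ.m≤n⊔m (Nx ℕ.⊔ Ny) _)

ℝ-rawRing : RawRing 0ℓ 0ℓ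
ℝ-rawRing = record
  { Carrier = ℝ
  ; _≈_     = _≃_
  ; _+_     = _+_
  ; _*_     = _*_
  ; -_      = -_
  ; 0#      = fromℚ 0ℚ
  ; 1#      = fromℚ 1ℚ
  }

open RawRing ℝ-rawRing public using (0#; 1#)
open RawSemiringDefinitions (RawRing.rawSemiring ℝ-rawRing) public using (sum; product; _^_)

-- The k-th approximation to √ m is ⌊ (k + 1) √ m ⌋ / (k + 1).
√_ : ℕ → ℝ
(√ m) .seq k = + isqrt (m ℕ.* (suc k ℕ.* suc k)) ℚ./ suc k
(√ m) .cauchy ε 0<ε with archimedean 1 0<ε
... | N , h = N , λ k l N≤k N≤l → ∣p-q∣≤r (close k l N≤l) (close l k N≤k)
  where
  a : ℕ → ℕ
  a k = isqrt (m ℕ.* (suc k ℕ.* suc k))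
  close : ∀ k l → N ℕ.≤ l → + a k ℚ./ suc k ℚ.≤ ε ℚ.+ + a l ℚ./ suc l
  close k l N≤l = ℚ.≤-trans
    (frac-mono (a k) (suc (a l)) (suc k) (suc l)
      (isqrt-cross m (a k) (a l) (suc k) (suc l)
        (proj₁ (isqrt-spec (m ℕ.* (suc k ℕ.* suc k))))
        (proj₂ (isqrt-spec (m ℕ.* (suc l ℕ.* suc l))))))
    (ℚ.≤-trans (ℚ.≤-reflexive (frac-+ 1 (a l) (suc l)))
               (ℚ.+-monoˡ-≤ (+ a l ℚ./ suc l) (h l N≤l)))


√-nonneg : ∀ m → 0# ≤ √ m
√-nonneg m ε 0<ε = 0 , λ k _ → ℚ.≤-trans (ℚ.<⇒≤ 0<ε)
  (ℚ.≤-trans (ℚ.≤-reflexive (sym (ℚ.+-identityʳ ε)))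
    (ℚ.+-monoʳ-≤ ε (frac-mono 0 (isqrt (m ℕ.* (suc k ℕ.* suc k))) 1 (suc k) ℕ.z≤n)))

√-square : ∀ m → √ m * √ m ≃ fromℕ m
√-square m ε 0<ε with archimedean (suc (m ℕ.+ m)) 0<ε
... | N , h = N , λ k N≤k → approx k (h k N≤k)
  where
  approx : ∀ k → + suc (m ℕ.+ m) ℚ./ suc k ℚ.≤ ε →
           ℚ.∣ seq (√ m) k ℚ.* seq (√ m) k ℚ.- + m ℚ./ 1 ∣ ℚ.≤ ε
  approx k-1 c/k≤ε = ∣p-q∣≤r
    (ℚ.≤-trans s*s≤m (ℚ.≤-trans (ℚ.≤-reflexive (sym (ℚ.+-identityˡ _)))
                                (ℚ.+-monoˡ-≤ (+ m ℚ./ 1) (ℚ.<⇒≤ 0<ε))))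
    (ℚ.≤-trans m≤c/k+s*s (ℚ.+-monoˡ-≤ _ c/k≤ε))
    where
    k a c : ℕ
    k = suc k-1
    a = isqrt (m ℕ.* (k ℕ.* k))
    c = suc (m ℕ.+ m)
    spec = isqrt-spec (m ℕ.* (k ℕ.* k))
    s*s≤m : (+ a ℚ./ k) ℚ.* (+ a ℚ./ k) ℚ.≤ + m ℚ./ 1
    s*s≤m = subst (ℚ._≤ + m ℚ./ 1) (frac-* a a k k)
      (frac-mono (a ℕ.* a) m (k ℕ.* k) 1
        (ℕ.≤-trans (ℕ.≤-reflexive (ℕ.*-identityʳ (a ℕ.* a))) (proj₁ spec)))
    a≤m*k : a ℕ.≤ m ℕ.* k
    a≤m*k = ℕ.≮⇒≥ λ lt → ℕ.<-irrefl refl (begin-strict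
      m ℕ.* k ℕ.* (m ℕ.* k)    <⟨ ℕ.*-mono-< lt lt ⟩
      a ℕ.* a                  ≤⟨ proj₁ spec ⟩
      m ℕ.* (k ℕ.* k)          ≤⟨ ℕ.*-monoˡ-≤ (k ℕ.* k) (m≤m*m m) ⟩
      m ℕ.* m ℕ.* (k ℕ.* k)    ≡⟨ solve 2 (λ m k → m :* m :* (k :* k) := m :* k :* (m :* k)) refl m k ⟩
      m ℕ.* k ℕ.* (m ℕ.* k)    ∎)
      where
      open ℕ.≤-Reasoning
      open ℕ.+-*-Solver
      m≤m*m : ∀ n → n ℕ.≤ n ℕ.* n
      m≤m*m zero    = ℕ.z≤n
      m≤m*m (suc n) = ℕ.m≤m+n (suc n) (n ℕ.* suc n)
    mk²≤ck+a² : m ℕ.* (k ℕ.* k) ℕ.≤ c ℕ.* k ℕ.+ a ℕ.* a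
    mk²≤ck+a² = ℕ.≤-pred (begin-strict
      m ℕ.* (k ℕ.* k)                  <⟨ proj₂ spec ⟩
      suc a ℕ.* suc a                  ≡⟨ solve 1 (λ a → (con 1 :+ a) :* (con 1 :+ a) := con 1 :+ (a :+ a :+ a :* a)) refl a ⟩
      suc (a ℕ.+ a ℕ.+ a ℕ.* a)        ≤⟨ ℕ.s≤s (ℕ.+-monoˡ-≤ (a ℕ.* a) a+a≤ck) ⟩
      suc (c ℕ.* k ℕ.+ a ℕ.* a)        ∎)
      where
      open ℕ.≤-Reasoning
      open ℕ.+-*-Solver
      a+a≤ck : a ℕ.+ a ℕ.≤ c ℕ.* k
      a+a≤ck = begin
        a ℕ.+ a                   ≤⟨ ℕ.+-mono-≤ a≤m*k a≤m*k ⟩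
        m ℕ.* k ℕ.+ m ℕ.* k       ≤⟨ ℕ.m≤n+m _ k ⟩
        k ℕ.+ (m ℕ.* k ℕ.+ m ℕ.* k) ≡⟨ cong (k ℕ.+_) (sym (ℕ.*-distribʳ-+ k m m)) ⟩
        c ℕ.* k                   ∎
    m≤c/k+s*s : + m ℚ./ 1 ℚ.≤ + c ℚ./ k ℚ.+ (+ a ℚ./ k) ℚ.* (+ a ℚ./ k)
    m≤c/k+s*s = ℚ.≤-trans
      (frac-mono m (c ℕ.* k ℕ.+ a ℕ.* a) 1 (k ℕ.* k)
        (ℕ.≤-trans mk²≤ck+a² (ℕ.≤-reflexive (sym (ℕ.*-identityʳ _)))))
      (ℚ.≤-reflexive (trans (frac-+ (c ℕ.* k) (a ℕ.* a) (k ℕ.* k))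
        (cong₂ ℚ._+_ ck/kk (frac-* a a k k))))
      where
      ck/kk : + (c ℕ.* k) ℚ./ (k ℕ.* k) ≡ + c ℚ./ k
      ck/kk = ℚ.≤-antisym
        (frac-mono (c ℕ.* k) c (k ℕ.* k) k (ℕ.≤-reflexive (ℕ.*-assoc c k k)))
        (frac-mono c (c ℕ.* k) k (k ℕ.* k) (ℕ.≤-reflexive (sym (ℕ.*-assoc c k k))))

x>0⇒x⁺≃∣x∣ : ∀ x → 0# < x → x ⁺ ≃ ∣ x ∣
x>0⇒x⁺≃∣x∣ x (δ , 0<δ , N , h) ε 0<ε = N , λ n N≤n →
  let 0≤xₙ = ℚ.≤-trans (ℚ.<⇒≤ 0<δ) (ℚ.≤-trans (ℚ.≤-reflexive (sym (ℚ.+-identityʳ δ))) (h n N≤n))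
      eq   = trans (ℚ.p≥q⇒p⊔q≡p 0≤xₙ) (sym (ℚ.0≤p⇒∣p∣≡p 0≤xₙ))
  in subst (λ z → ℚ.∣ (seq x n ℚ.⊔ 0ℚ) ℚ.- z ∣ ℚ.≤ ε) eq
       (subst (λ z → ℚ.∣ z ∣ ℚ.≤ ε) (sym (ℚ.+-inverseʳ (seq x n ℚ.⊔ 0ℚ))) (ℚ.<⇒≤ 0<ε))

x≯0⇒x⁺≃0 : ∀ x → ¬ (0# < x) → x ⁺ ≃ 0#
x≯0⇒x⁺≃0 x x≯0 ε 0<ε with cauchy x (½ ℚ.* ε) (0<½* 0<ε)
... | N , h = N , λ n N≤n → ∣p-q∣≤r
  (subst (seq x n ℚ.⊔ 0ℚ ℚ.≤_) (sym (ℚ.+-identityʳ ε)) (ℚ.⊔-lub (small n N≤n) (ℚ.<⇒≤ 0<ε)))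
  (ℚ.+-mono-≤ (ℚ.<⇒≤ 0<ε) (ℚ.p≤q⊔p (seq x n) 0ℚ))
  where
  -- Otherwise x would be at least ε/2 from N on.
  small : ∀ n → N ℕ.≤ n → seq x n ℚ.≤ ε
  small n N≤n = ℚ.≮⇒≥ λ ε<xₙ → x≯0 (½ ℚ.* ε , 0<½* 0<ε , N , λ m N≤m →
    let open ℚ.≤-Reasoning in begin
    ½ ℚ.* ε ℚ.+ 0ℚ                                  ≡⟨ ℚ.+-identityʳ _ ⟩
    ½ ℚ.* ε                                         ≡⟨ sym (p+q-q≡p (½ ℚ.* ε) (½ ℚ.* ε)) ⟩
    ½ ℚ.* ε ℚ.+ ½ ℚ.* ε ℚ.- ½ ℚ.* ε                 ≤⟨ p-q≤r (begin
      ½ ℚ.* ε ℚ.+ ½ ℚ.* ε       ≡⟨ ½+½ ε ⟩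
      ε                         ≤⟨ ℚ.<⇒≤ ε<xₙ ⟩
      seq x n                   ≤⟨ ∣p-q∣≤r⇒p≤r+q (h n m N≤n N≤m) ⟩
      ½ ℚ.* ε ℚ.+ seq x m       ≡⟨ ℚ.+-comm _ (seq x m) ⟩
      seq x m ℚ.+ ½ ℚ.* ε       ∎) ⟩
    seq x m                                         ∎)

Matrix : ℕ → Set
Matrix n = Fin n → Fin n → ℝ

-- Laplace expansion along the first row.
det : ∀ {n} → Matrix n → ℝ
det {zero}  M = 1#
det {suc n} M =
  sum λ j → (- 1#) ^ toℕ j * M zero j * det λ i → removeAt (M (suc i)) j

scalarMatrix : ∀ {n} → ℝ → Matrix n
scalarMatrix x i j = if does (i Fin.≟ j) then x else 0#

charPoly : ∀ {n} → Matrix n → ℝ → ℝ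
charPoly M x = det λ i j → scalarMatrix x i j - M i j

-- λs lists the eigenvalues of M in decreasing order, each as often as its
-- multiplicity as a root of the characteristic polynomial. Polynomials over ℝ
-- are identified with the functions they define.
record IsSpectrum {n} (M : Matrix n) (λs : Vector ℝ n) : Set where
  field
    decreasing : ∀ {i j} → i Fin.≤ j → λs j ≤ λs i
    factors    : ∀ x → charPoly M x ≃ product (λ i → x - λs i)

record Graph (n : ℕ) : Set₁ where
  infix 4 _~_ _~?_
  field
    _~_    : Rel (Fin n) 0ℓ
    _~?_   : Decidable _~_
    ~-sym  : Symmetric _~_
    irrefl : Irreflexive _≡_ _~_

open Graph

Connected : ∀ {n} → Graph n → Set
Connected G = ∀ u v → Star (_~_ G) u v

Isomorphic : ∀ {m n} → Graph m → Graph n → Set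
Isomorphic {m} {n} G H =
  Σ (Fin m ↔ Fin n) λ f → ∀ u v → _~_ G u v ⇔ _~_ H (Inverse.to f u) (Inverse.to f v)

K : ∀ n → Graph n
K n = record
  { _~_    = _≢_
  ; _~?_   = λ u v → ¬? (u Fin.≟ v)
  ; ~-sym  = λ u≢v v≡u → u≢v (sym v≡u)
  ; irrefl = λ u≡v u≢v → u≢v u≡v
  }

-- P n has n vertices.
P : ∀ n → Graph n
P n = record
  { _~_    = λ u v → suc (toℕ u) ≡ toℕ v ⊎ suc (toℕ v) ≡ toℕ u
  ; _~?_   = λ u v → (suc (toℕ u) ℕ.≟ toℕ v) ⊎-dec (suc (toℕ v) ℕ.≟ toℕ u)
  ; ~-sym  = swap
  ; irrefl = λ { {u} refl → [ ℕ.1+n≢n , ℕ.1+n≢n ]′ }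
  }

adjacencyMatrix : ∀ {n} → Graph n → Matrix n
adjacencyMatrix G i j = if does (_~?_ G i j) then 1# else 0#

-- The sum of ∣ λᵢ ∣ ³ over the positive λᵢ. As 0# < x is undecidable, the sum
-- runs over all i, a non-positive λᵢ contributing (λᵢ ⁺) ³ ≃ 0#; see
-- x>0⇒x⁺≃∣x∣ and x≯0⇒x⁺≃0.
positive3Energy : ∀ {n} → Vector ℝ n → ℝ
positive3Energy λs = sum λ i → (λs i ⁺) ^ 3

{-# OPTIONS --safe #-}
module Submission where

-- For s ≥ 0 every real x satisfies (x⁺)³ ≥ (3 x² s − s³) / 4 + x³ / 2, by
-- (s − ∣x∣)² (s + 2 ∣x∣) ≥ 0. Taking s polynomial in x² and summing over the
-- spectrum bounds the energy from below by the traces of the powers of A, where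
-- tr A³ ≥ 0 can be dropped. The constant s = 13 / 10 suffices as soon as there
-- are enough edges: for n ≥ 7 connectedness is enough, for 4 ≤ n ≤ 6 the graph
-- must not be a tree, and for n = 3 it must be K 3. For the trees on 4 to 6
-- vertices s = (1 + x²) / √5 works, by enumeration of the parent functions of
-- the trees rooted at vertex zero.
--
-- The power sums of the eigenvalues are the traces tr Aᵐ: with the
-- factorisation of the characteristic polynomial, det (I + t A) and
-- det (I + t Λ), Λ = diag(λ), agree for all natural numbers t. Both are
-- polynomial in t, their derivatives are tr (A adj (I + t A)) and
-- tr (Λ adj (I + t Λ)), and adj (I + t A) + t A adj (I + t A) = det (I + t A) I
-- gives the traces of all powers one after the other.

open import Algebra.Bundles using (CommutativeRing; Semiring)
open import Algebra.Core using (Op₁; Op₂)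
import Algebra.Properties.Semiring.Sum as SemiringSum
open import Algebra.Structures using (IsCommutativeRing)
open import Data.Bool.Base as Bool using (Bool; true; false; if_then_else_; _∧_; _∨_)
open import Data.Fin.Base as Fin using (Fin; zero; suc; toℕ; inject₁; punchIn)
import Data.Fin.Properties as Fin
open import Data.Integer.Base as ℤ using (+_)
import Data.Integer.Properties as ℤ
open import Data.Nat.Base as ℕ using (ℕ; zero; suc; NonZero)
import Data.Nat.Properties as ℕ
import Data.Nat.Solver as ℕ-Solver
open import Data.Product.Base using (_×_; _,_; ∃; proj₁; proj₂)
open import Data.Rational.Base as ℚ using (ℚ; 0ℚ; 1ℚ; ½)
import Data.Rational.Properties as ℚ
import Data.Rational.Solver as ℚ
import Data.Rational.Unnormalised.Base as ℚᵘ
import Data.Rational.Unnormalised.Properties as ℚᵘ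
open import Data.Sum.Base using (_⊎_; inj₁; inj₂)
open import Data.Unit.Base using (tt)
import Data.Vec.Base as Vec
import Data.Vec.Properties as Vec
open import Data.Vec.Functional using (Vector; []; _∷_; removeAt; updateAt)
open import Function.Base using (_∘_; _$_; const; id)
open import Function.Bundles using (mk↔ₛ′; mk⇔)
open import Relation.Binary.Construct.Closure.ReflexiveTransitive using (Star; _◅_) renaming (ε to stop)
open import Relation.Binary.Core using (Rel)
open import Relation.Binary.Definitions using (Tri; tri<; tri≈; tri>)
open import Relation.Binary.PropositionalEquality as ≡ using (_≡_; _≢_)
open import Relation.Nullary using (¬_; Dec; yes; no; does; contradiction)
open import Relation.Nullary.Decidable using (_×-dec_; dec-true; dec-false)
open import Relation.Unary using (Decidable)

-- The constant √5 / 2 comes from `P 4`: its eigenvalues are ± φ and ± 1 / φ with φ the golden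
-- ratio, and φ³ + φ⁻³ = 2 √5, so equality holds there. Without slack, s has to equal ∣x∣ at all
-- four eigenvalues; s = (1 + x²) / √5 does, since x² - √5 ∣x∣ + 1 = 0 at each of them. A constant s
-- is cheaper, as only tr A² enters, which is twice the number of edges. The best constant is √(tr
-- A² / n), about 1.31 for a tree on 7 vertices, the tightest case; hence 13 / 10.
--
-- The spectrum is known only through an equation between functions of a real variable: neither
-- eigenvectors nor coefficients of polynomials are at hand. The power sums are therefore extracted
-- by evaluating determinants at natural numbers, and limits are replaced by extrapolating
-- polynomial functions from positive arguments to 0. This works in every commutative ring whose
-- positive integers are invertible.
--
-- The sign of a real is undecidable, so the inequality for (x⁺)³ is proved for the rational
-- approximations of the eigenvalues, where the case distinction is available.

module ℕΣ = SemiringSum ℕ.+-*-semiring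

-- Walk counts over the natural numbers

unitℕ : ∀ {n} → Fin n → Vector ℕ n
unitℕ i j = if does (i Fin.≟ j) then 1 else 0

extendWalks : ∀ {n} → (Fin n → Fin n → ℕ) → Vector ℕ n → Vector ℕ n
extendWalks a v i = ℕΣ.sum λ j → a i j ℕ.* v j

-- The matrix power aᵐ applied to v. Powers only ever act on vectors, which avoids products of
-- matrices.
walks : ∀ {n} → (Fin n → Fin n → ℕ) → ℕ → Vector ℕ n → Vector ℕ n
walks a zero    v = v
walks a (suc m) v = walks a m (extendWalks a v)

-- The trace of the m-th power of a.
closedWalks : ∀ {n} → (Fin n → Fin n → ℕ) → ℕ → ℕ
closedWalks a m = ℕΣ.sum λ k → walks a m (unitℕ k) k

-- Determinants and traces over a commutative ring

module TraceIdentity {c ℓ} (R : CommutativeRing c ℓ) where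

  open CommutativeRing R hiding (zero)
  open import Algebra.Definitions.RawSemiring (Semiring.rawSemiring semiring) using (_^_; product) renaming (_×_ to _·_)
  open import Algebra.Properties.Semiring.Sum semiring
  open import Algebra.Properties.Semiring.Mult semiring using (×-homo-+; ×1-homo-*)
  open import Algebra.Properties.Ring ring using (-1*x≈-x; -‿distribˡ-*; -‿distribʳ-*; -‿involutive)
  open import Algebra.Solver.Ring.NaturalCoefficients.Default commutativeSemiring
    using (solve; _:=_; _:+_; _:*_; con)
  open import Relation.Binary.Reasoning.Setoid setoid

  Matrix : ℕ → Set c
  Matrix n = Fin n → Fin n → Carrier

  opaque
    ∑ : ∀ {n} → Vector Carrier n → Carrier
    ∑ = sum

    ∑-nil : (f : Vector Carrier 0) → ∑ f ≈ 0#
    ∑-nil f = refl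

    ∑-cons : ∀ {n} (f : Vector Carrier (suc n)) → ∑ f ≈ f zero + ∑ (f ∘ suc)
    ∑-cons f = refl

    ∑-cong : ∀ {n} {f g : Vector Carrier n} → (∀ i → f i ≈ g i) → ∑ f ≈ ∑ g
    ∑-cong = sum-cong-≋

    ∑-+ : ∀ {n} (f g : Vector Carrier n) → ∑ (λ i → f i + g i) ≈ ∑ f + ∑ g
    ∑-+ = ∑-distrib-+

    ∑-swap : ∀ {m n} (f : Fin m → Fin n → Carrier) → ∑ (λ i → ∑ (f i)) ≈ ∑ (λ j → ∑ λ i → f i j)
    ∑-swap = ∑-comm

    *-∑ : ∀ {n} x (f : Vector Carrier n) → x * ∑ f ≈ ∑ (λ i → x * f i)
    *-∑ = *-distribˡ-sum

    ∑-* : ∀ {n} x (f : Vector Carrier n) → ∑ f * x ≈ ∑ (λ i → f i * x)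
    ∑-* = *-distribʳ-sum

    ∑-zero : ∀ {n} {f : Vector Carrier n} → (∀ i → f i ≈ 0#) → ∑ f ≈ 0#
    ∑-zero {n} f≈0 = trans (sum-cong-≋ f≈0) (sum-replicate-zero n)

  sign : ∀ {n} → Fin n → Carrier
  sign j = (- 1#) ^ toℕ j

  minor : ∀ {n} → Matrix (suc n) → Fin (suc n) → Matrix n
  minor M j i = removeAt (M (suc i)) j

  opaque
    det : ∀ {n} → Matrix n → Carrier
    det {zero}  M = 1#
    det {suc n} M = ∑ λ j → sign j * M zero j * det (minor M j)

    det-nil : (M : Matrix 0) → det M ≈ 1#
    det-nil M = refl

    det-expand : ∀ {n} (M : Matrix (suc n)) → det M ≈ ∑ λ j → sign j * M zero j * det (minor M j)
    det-expand M = refl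

    det-cong : ∀ {n} {M N : Matrix n} → (∀ i j → M i j ≈ N i j) → det M ≈ det N
    det-cong {zero}  M≈N = refl
    det-cong {suc n} M≈N = ∑-cong λ j →
      *-cong (*-congˡ (M≈N zero j)) (det-cong λ i l → M≈N (suc i) (punchIn j l))

  unit : ∀ {n} → Fin n → Vector Carrier n
  unit i j = if does (i Fin.≟ j) then 1# else 0#

  setRow : ∀ {m n} → (Fin m → Vector Carrier n) → Fin m → Vector Carrier n → Fin m → Vector Carrier n
  setRow M k u = updateAt M k (const u)

  -- Subtraction is written as adding a multiple of `- 1#`: the semiring solver has no negation and
  -- takes `- 1#` as a variable.
  x≈y⇒x+-1y≈0 : ∀ {x y} → x ≈ y → x + - 1# * y ≈ 0#
  x≈y⇒x+-1y≈0 {x} {y} x≈y = trans (+-cong x≈y (-1*x≈-x y)) (-‿inverseʳ y)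

  x+-1y≈0⇒x≈y : ∀ {x y} → x + - 1# * y ≈ 0# → x ≈ y
  x+-1y≈0⇒x≈y {x} {y} eq = begin
    x                       ≈⟨ +-identityʳ x ⟨
    x + 0#                  ≈⟨ +-congˡ (-‿inverseˡ y) ⟨
    x + (- y + y)           ≈⟨ +-assoc x (- y) y ⟨
    x + - y + y             ≈⟨ +-congʳ (+-congˡ (-1*x≈-x y)) ⟨
    x + - 1# * y + y        ≈⟨ +-congʳ eq ⟩
    0# + y                  ≈⟨ +-identityˡ y ⟩
    y                       ∎

  ∑-unit : ∀ {n} (a : Vector Carrier n) j → ∑ (λ i → a i * unit i j) ≈ a j
  ∑-unit {suc n} a zero = begin
    ∑ (λ i → a i * unit i zero)               ≈⟨ ∑-cons (λ i → a i * unit i zero) ⟩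
    a zero * 1# + ∑ (λ i → a (suc i) * 0#)  ≈⟨ +-cong (*-identityʳ _) (∑-zero λ i → zeroʳ _) ⟩
    a zero + 0#                               ≈⟨ +-identityʳ _ ⟩
    a zero                                    ∎
  ∑-unit {suc n} a (suc j) = begin
    ∑ (λ i → a i * unit i (suc j))            ≈⟨ ∑-cons (λ i → a i * unit i (suc j)) ⟩
    a zero * 0# + ∑ (λ i → a (suc i) * unit i j)  ≈⟨ +-cong (zeroʳ _) (∑-unit (a ∘ suc) j) ⟩
    0# + a (suc j)                                  ≈⟨ +-identityˡ _ ⟩
    a (suc j)                                       ∎

  unit-sym : ∀ {n} (i j : Fin n) → unit i j ≡ unit j i
  unit-sym zero    zero    = ≡.refl
  unit-sym zero    (suc j) = ≡.refl
  unit-sym (suc i) zero    = ≡.refl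
  unit-sym (suc i) (suc j) = unit-sym i j

  -- Multilinearity of the determinant.

  setRow-removeAt : ∀ {m n} (M : Fin m → Vector Carrier (suc n)) k u j i l →
    removeAt (setRow M k u i) j l ≡ setRow (λ i → removeAt (M i) j) k (removeAt u j) i l
  setRow-removeAt M zero    u j zero    l = ≡.refl
  setRow-removeAt M zero    u j (suc i) l = ≡.refl
  setRow-removeAt M (suc k) u j zero    l = ≡.refl
  setRow-removeAt M (suc k) u j (suc i) l = setRow-removeAt (M ∘ suc) k u j i l

  minor-setRow : ∀ {n} (M : Matrix (suc n)) k u j →
    det (minor (setRow M (suc k) u) j) ≈ det (setRow (minor M j) k (removeAt u j))
  minor-setRow M k u j = det-cong λ i l → reflexive (setRow-removeAt (M ∘ suc) k u j i l)

  -- Stated for a whole linear combination because its use is to expand a row in the unit vectors.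
  -- For row zero the two sums are exchanged; any other row persists in every minor, where induction
  -- applies.
  det-linear : ∀ {n m} (M : Matrix n) k (a : Vector Carrier m) (V : Fin m → Vector Carrier n) →
    det (setRow M k λ c → ∑ λ l → a l * V l c) ≈ ∑ λ l → a l * det (setRow M k (V l))
  det-linear {suc n} {m} M zero a V = begin
    det (setRow M zero λ c → ∑ λ l → a l * V l c)
      ≈⟨ det-expand _ ⟩
    ∑ (λ j → sign j * ∑ (λ l → a l * V l j) * det (minor M j))
      ≈⟨ ∑-cong (λ j → trans (*-congʳ (*-∑ (sign j) _)) (∑-* (det (minor M j)) _)) ⟩
    ∑ (λ j → ∑ λ l → sign j * (a l * V l j) * det (minor M j))
      ≈⟨ ∑-swap (λ j l → sign j * (a l * V l j) * det (minor M j)) ⟩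
    ∑ (λ l → ∑ λ j → sign j * (a l * V l j) * det (minor M j))
      ≈⟨ ∑-cong (λ l → trans (∑-cong λ j → move (sign j) (a l) (V l j) (det (minor M j)))
                                 (sym (*-∑ (a l) _))) ⟩
    ∑ (λ l → a l * ∑ λ j → sign j * V l j * det (minor M j))
      ≈⟨ ∑-cong (λ l → *-congˡ (sym (det-expand (setRow M zero (V l))))) ⟩
    ∑ (λ l → a l * det (setRow M zero (V l))) ∎
    where
    move : ∀ s a v d → s * (a * v) * d ≈ a * (s * v * d)
    move = solve 4 (λ s a v d → s :* (a :* v) :* d := a :* (s :* v :* d)) refl
  det-linear {suc n} {m} M (suc k) a V = begin
    det (setRow M (suc k) comb)
      ≈⟨ det-expand (setRow M (suc k) comb) ⟩
    ∑ (λ j → sign j * M zero j * det (minor (setRow M (suc k) comb) j))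
      ≈⟨ ∑-cong (λ j → *-congˡ (trans (minor-setRow M k comb j)
           (det-linear (minor M j) k a λ l → removeAt (V l) j))) ⟩
    ∑ (λ j → sign j * M zero j * ∑ (λ l → a l * det (setRow (minor M j) k (removeAt (V l) j))))
      ≈⟨ ∑-cong (λ j → *-∑ (sign j * M zero j) _) ⟩
    ∑ (λ j → ∑ λ l → sign j * M zero j * (a l * det (setRow (minor M j) k (removeAt (V l) j))))
      ≈⟨ ∑-swap (λ j l → sign j * M zero j * (a l * det (setRow (minor M j) k (removeAt (V l) j)))) ⟩
    ∑ (λ l → ∑ λ j → sign j * M zero j * (a l * det (setRow (minor M j) k (removeAt (V l) j))))
      ≈⟨ ∑-cong (λ l → trans
           (∑-cong λ j → trans (*-congˡ (*-congˡ (sym (minor-setRow M k (V l) j)))) (move _ _ _))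
           (sym (*-∑ (a l) _))) ⟩
    ∑ (λ l → a l * ∑ λ j → sign j * M zero j * det (minor (setRow M (suc k) (V l)) j))
      ≈⟨ ∑-cong (λ l → *-congˡ (sym (det-expand (setRow M (suc k) (V l))))) ⟩
    ∑ (λ l → a l * det (setRow M (suc k) (V l))) ∎
    where
    comb = λ c → ∑ λ l → a l * V l c
    move : ∀ s a d → s * (a * d) ≈ a * (s * d)
    move = solve 3 (λ s a d → s :* (a :* d) := a :* (s :* d)) refl

  det-minors-zero : ∀ {n} (M : Matrix (suc n)) → (∀ j → det (minor M j) ≈ 0#) → det M ≈ 0#
  det-minors-zero M eq = trans (det-expand M) $ ∑-zero λ j → trans (*-congˡ (eq j)) (zeroʳ _)

  -- The pairs (j , k) index the ordered pairs (j , punchIn j k) of distinct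
  -- columns; the hypothesis pairs each of them with its transpose.
  ∑-antisym : ∀ n (S : Fin (suc n) → Fin n → Carrier) →
    (∀ j k → k Fin.≤ j → S (inject₁ k) j + S (suc j) k ≈ 0#) → ∑ (λ j → ∑ (S j)) ≈ 0#
  ∑-antisym zero    S eq = ∑-zero λ j → ∑-nil (S j)
  ∑-antisym (suc n) S eq = begin
    ∑ (λ j → ∑ (S j))
      ≈⟨ ∑-cons (λ j → ∑ (S j)) ⟩
    ∑ (S zero) + ∑ (λ j → ∑ (S (suc j)))
      ≈⟨ +-congˡ (∑-cong λ j → ∑-cons (S (suc j))) ⟩
    ∑ (S zero) + ∑ (λ j → S (suc j) zero + ∑ λ k → S (suc j) (suc k))
      ≈⟨ +-congˡ (∑-+ (λ j → S (suc j) zero) _) ⟩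
    ∑ (S zero) + (∑ (λ j → S (suc j) zero) + ∑ (λ j → ∑ λ k → S (suc j) (suc k)))
      ≈⟨ +-assoc _ _ _ ⟨
    ∑ (S zero) + ∑ (λ j → S (suc j) zero) + ∑ (λ j → ∑ λ k → S (suc j) (suc k))
      -- The pairs that involve column zero cancel among themselves; the others form the same array,
      -- one size smaller.
      ≈⟨ +-cong (trans (sym (∑-+ (S zero) _)) (∑-zero λ j → eq j zero ℕ.z≤n))
                (∑-antisym n (λ j k → S (suc j) (suc k)) λ j k k≤j → eq (suc j) (suc k) (ℕ.s≤s k≤j)) ⟩
    0# + 0#
      ≈⟨ +-identityˡ 0# ⟩
    0# ∎

  punchIn-inject₁ : ∀ {n} (j k : Fin n) → k Fin.≤ j → punchIn (inject₁ k) j ≡ suc j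
  punchIn-inject₁ j       zero    _            = ≡.refl
  punchIn-inject₁ (suc j) (suc k) (ℕ.s≤s k≤j) = ≡.cong suc (punchIn-inject₁ j k k≤j)

  punchIn-suc : ∀ {n} (j k : Fin n) → k Fin.≤ j → punchIn (suc j) k ≡ inject₁ k
  punchIn-suc j       zero    _            = ≡.refl
  punchIn-suc (suc j) (suc k) (ℕ.s≤s k≤j) = ≡.cong suc (punchIn-suc j k k≤j)

  -- Deleting the columns k and j + 1 in either order leaves the same columns.
  punchIn-punchIn : ∀ {n} (j k : Fin (suc n)) (x : Fin n) → k Fin.≤ j →
    punchIn (inject₁ k) (punchIn j x) ≡ punchIn (suc j) (punchIn k x)
  punchIn-punchIn j       zero    x       _            = ≡.refl
  punchIn-punchIn (suc j) (suc k) zero    _            = ≡.refl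
  punchIn-punchIn (suc j) (suc k) (suc x) (ℕ.s≤s k≤j) = ≡.cong suc (punchIn-punchIn j k x k≤j)

  swap₀₁ : ∀ {n} → Matrix (suc (suc n)) → Matrix (suc (suc n))
  swap₀₁ M zero          = M (suc zero)
  swap₀₁ M (suc zero)    = M zero
  swap₀₁ M (suc (suc i)) = M (suc (suc i))

  -- Expanded along two rows, each determinant is a sum over ordered pairs of columns. The term of
  -- `M` at a pair and the term of `swap₀₁ M` at the transposed pair share their minor and have
  -- opposite signs.
  det-swap₀₁ : ∀ {n} (M : Matrix (suc (suc n))) → det M + det (swap₀₁ M) ≈ 0#
  det-swap₀₁ {n} M = begin
    det M + det (swap₀₁ M)
      ≈⟨ +-cong (expand₂ M) (expand₂ (swap₀₁ M)) ⟩
    ∑ (λ j → ∑ (T M j)) + ∑ (λ j → ∑ (T (swap₀₁ M) j))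
      ≈⟨ ∑-+ (λ j → ∑ (T M j)) _ ⟨
    ∑ (λ j → ∑ (T M j) + ∑ (T (swap₀₁ M) j))
      ≈⟨ ∑-cong (λ j → sym (∑-+ (T M j) _)) ⟩
    ∑ (λ j → ∑ λ k → T M j k + T (swap₀₁ M) j k)
      ≈⟨ ∑-antisym (suc n) (λ j k → T M j k + T (swap₀₁ M) j k) pair ⟩
    0# ∎
    where
    T : Matrix (suc (suc n)) → Fin (suc (suc n)) → Fin (suc n) → Carrier
    T M j k = sign j * M zero j * (sign k * M (suc zero) (punchIn j k) * det (minor (minor M j) k))

    expand₂ : ∀ N → det N ≈ ∑ λ j → ∑ (T N j)
    expand₂ N = trans (det-expand N) (∑-cong λ j →
      trans (*-congˡ (det-expand (minor N j))) (*-∑ (sign j * N zero j) _))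

    minors : ∀ j k → k Fin.≤ j →
      det (minor (minor M (inject₁ k)) j) ≈ det (minor (minor M (suc j)) k)
    minors j k k≤j = det-cong λ i l →
      reflexive (≡.cong (M (suc (suc i))) (punchIn-punchIn j k l k≤j))

    cancel : ∀ (N : Matrix (suc (suc n))) j k → k Fin.≤ j →
      det (minor (minor N (inject₁ k)) j) ≈ det (minor (minor (swap₀₁ N) (suc j)) k) →
      T N (inject₁ k) j + T (swap₀₁ N) (suc j) k ≈ 0#
    cancel N j k k≤j eq
      rewrite punchIn-inject₁ j k k≤j | punchIn-suc j k k≤j | Fin.toℕ-inject₁ k = begin
      sk * a * (sj * b * d) + - 1# * sj * b * (sk * a * d′)
        ≈⟨ +-congˡ (*-congˡ (*-congˡ (sym eq))) ⟩
      sk * a * (sj * b * d) + - 1# * sj * b * (sk * a * d)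
        ≈⟨ solve 6 (λ e sj sk a b d → sk :* a :* (sj :* b :* d) :+ e :* sj :* b :* (sk :* a :* d) :=
                     sk :* a :* (sj :* b :* d) :+ e :* (sk :* a :* (sj :* b :* d))) refl (- 1#) sj sk a b d ⟩
      sk * a * (sj * b * d) + - 1# * (sk * a * (sj * b * d))
        ≈⟨ x≈y⇒x+-1y≈0 refl ⟩
      0# ∎
      where
      sj = sign j
      sk = sign k
      a = N zero (inject₁ k)
      b = N (suc zero) (suc j)
      d = det (minor (minor N (inject₁ k)) j)
      d′ = det (minor (minor (swap₀₁ N) (suc j)) k)

    interchange : ∀ a b c d → (a + b) + (c + d) ≈ (a + d) + (b + c)
    interchange = solve 4 (λ a b c d → (a :+ b) :+ (c :+ d) := (a :+ d) :+ (b :+ c)) refl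

    swap² : ∀ j k → T (swap₀₁ (swap₀₁ M)) j k ≈ T M j k
    swap² j k = *-congˡ (*-congˡ {sign k * M (suc zero) (punchIn j k)}
      (det-cong {N = minor (minor M j) k} λ i l → refl))

    pair : ∀ j k → k Fin.≤ j → (T M (inject₁ k) j + T (swap₀₁ M) (inject₁ k) j)
                             + (T M (suc j) k + T (swap₀₁ M) (suc j) k) ≈ 0#
    pair j k k≤j = begin
      (T M (inject₁ k) j + T (swap₀₁ M) (inject₁ k) j) + (T M (suc j) k + T (swap₀₁ M) (suc j) k)
        ≈⟨ interchange _ _ _ _ ⟩
      (T M (inject₁ k) j + T (swap₀₁ M) (suc j) k) + (T (swap₀₁ M) (inject₁ k) j + T M (suc j) k)
        ≈⟨ +-cong (cancel M j k k≤j (trans (minors j k k≤j) (det-cong λ i l → refl)))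
             -- `cancel` at `swap₀₁ M` produces the double swap, which agrees with `M` only entry by
             -- entry.
             (trans (+-congˡ (sym (swap² (suc j) k)))
                    (cancel (swap₀₁ M) j k k≤j (trans (det-cong λ i l → refl) (trans (minors j k k≤j) (det-cong λ i l → refl))))) ⟩
      0# + 0#
        ≈⟨ +-identityˡ 0# ⟩
      0# ∎

  product-cong : ∀ {n} {f g : Vector Carrier n} → (∀ i → f i ≈ g i) → product f ≈ product g
  product-cong {zero}  f≈g = refl
  product-cong {suc n} f≈g = *-cong (f≈g zero) (product-cong (f≈g ∘ suc))

  ι : ℕ → Carrier
  ι k = k · 1#

  -- Functions ℕ → R whose d-th difference vanishes, that is, polynomials of
  -- degree below d.

  Δ : (ℕ → Carrier) → ℕ → Carrier
  Δ f k = f (suc k) + - 1# * f k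

  Deg : ℕ → (ℕ → Carrier) → Set ℓ
  Deg zero    f = ∀ k → f k ≈ 0#
  Deg (suc d) f = Deg d (Δ f)

  Deg-cong : ∀ d {f g} → (∀ k → f k ≈ g k) → Deg d f → Deg d g
  Deg-cong zero    f≈g p = λ k → trans (sym (f≈g k)) (p k)
  Deg-cong (suc d) f≈g p = Deg-cong d (λ k → +-cong (f≈g (suc k)) (*-congˡ (f≈g k))) p

  Deg-zero : ∀ d {f} → (∀ k → f k ≈ 0#) → Deg d f
  Deg-zero zero    f≈0 = f≈0
  Deg-zero (suc d) f≈0 = Deg-zero d λ k → x≈y⇒x+-1y≈0 (trans (f≈0 (suc k)) (sym (f≈0 k)))

  Deg-suc : ∀ d {f} → Deg d f → Deg (suc d) f
  Deg-suc zero    p = Deg-zero 1 p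
  Deg-suc (suc d) p = Deg-suc d p

  Deg-≤ : ∀ {d e f} → d ℕ.≤′ e → Deg d f → Deg e f
  Deg-≤ (ℕ.≤′-reflexive ≡.refl) p = p
  Deg-≤ {e = suc e} (ℕ.≤′-step d≤e) p = Deg-suc e (Deg-≤ d≤e p)

  Deg-shift : ∀ d {f} → Deg d f → Deg d (f ∘ suc)
  Deg-shift zero    p = p ∘ suc
  Deg-shift (suc d) p = Deg-shift d p

  Deg-+ : ∀ d {f g} → Deg d f → Deg d g → Deg d λ k → f k + g k
  Deg-+ zero    p q k = trans (+-cong (p k) (q k)) (+-identityˡ 0#)
  Deg-+ (suc d) {f} {g} p q = Deg-cong d
    (λ k → solve 5 (λ e a b c d → (a :+ e :* b) :+ (c :+ e :* d) := (a :+ c) :+ e :* (b :+ d)) refl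
             (- 1#) (f (suc k)) (f k) (g (suc k)) (g k))
    (Deg-+ d p q)

  -- By the discrete Leibniz rule, whose first term takes `g` at the shifted argument. The bound is
  -- not sharp, but `Poly` asks only for some degree.
  Deg-* : ∀ d e {f g} → Deg d f → Deg e g → Deg (d ℕ.+ e) λ k → f k * g k
  Deg-* zero    e p q = Deg-zero e λ k → trans (*-congʳ (p k)) (zeroˡ _)
  Deg-* (suc d) zero p q = Deg-zero (suc d ℕ.+ zero) λ k → trans (*-congˡ (q k)) (zeroʳ _)
  Deg-* (suc d) (suc e) {f} {g} p q = Deg-cong (d ℕ.+ suc e) leibniz
    (Deg-+ (d ℕ.+ suc e)
      (Deg-* d (suc e) p (Deg-shift (suc e) {g} q))
      (≡.subst (λ n → Deg n λ k → f k * Δ g k) (≡.sym (ℕ.+-suc d e)) (Deg-* (suc d) e {f} p q)))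
    where
    leibniz : ∀ k → Δ f k * g (suc k) + f k * Δ g k ≈ Δ (λ k → f k * g k) k
    leibniz k = begin
      Δ f k * g (suc k) + f k * Δ g k
        ≈⟨ solve 5 (λ e a b c d → (a :+ e :* b) :* c :+ b :* (c :+ e :* d) :=
                     (a :* c :+ e :* (b :* d)) :+ (b :* c :+ e :* (b :* c))) refl
             (- 1#) (f (suc k)) (f k) (g (suc k)) (g k) ⟩
      Δ (λ k → f k * g k) k + (f k * g (suc k) + - 1# * (f k * g (suc k)))
        ≈⟨ +-congˡ (x≈y⇒x+-1y≈0 refl) ⟩
      Δ (λ k → f k * g k) k + 0#
        ≈⟨ +-identityʳ _ ⟩
      Δ (λ k → f k * g k) k ∎

  -- A closure property rather than a list of coefficients: what is drawn from it is that the values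
  -- at positive arguments determine the value at 0.
  Poly : (ℕ → Carrier) → Set ℓ
  Poly f = ∃ λ d → Deg d f

  Poly-const : ∀ x → Poly λ _ → x
  Poly-const x = 1 , λ k → x≈y⇒x+-1y≈0 refl

  Poly-ι : Poly ι
  Poly-ι = 2 , λ k → x≈y⇒x+-1y≈0 (trans (step (suc k)) (sym (step k)))
    where
    step : ∀ k → Δ ι k ≈ 1#
    step k = begin
      1# + ι k + - 1# * ι k    ≈⟨ +-assoc _ _ _ ⟩
      1# + (ι k + - 1# * ι k)  ≈⟨ +-congˡ (x≈y⇒x+-1y≈0 refl) ⟩
      1# + 0#                  ≈⟨ +-identityʳ 1# ⟩
      1#                       ∎

  Poly-+ : ∀ {f g} → Poly f → Poly g → Poly λ k → f k + g k
  Poly-+ (d , p) (e , q) = d ℕ.⊔ e ,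
    Deg-+ (d ℕ.⊔ e) (Deg-≤ (ℕ.≤⇒≤′ (ℕ.m≤m⊔n d e)) p) (Deg-≤ (ℕ.≤⇒≤′ (ℕ.m≤n⊔m d e)) q)

  Poly-* : ∀ {f g} → Poly f → Poly g → Poly λ k → f k * g k
  Poly-* (d , p) (e , q) = d ℕ.+ e , Deg-* d e p q

  Poly-cong : ∀ {f g} → (∀ k → f k ≈ g k) → Poly f → Poly g
  Poly-cong f≈g (d , p) = d , Deg-cong d f≈g p

  Poly-∑ : ∀ {n} {f : ℕ → Vector Carrier n} → (∀ i → Poly λ k → f k i) → Poly λ k → ∑ (f k)
  Poly-∑ {zero}  {f} p = Poly-cong (λ k → sym (∑-nil (f k))) (Poly-const 0#)
  Poly-∑ {suc n} {f} p = Poly-cong (λ k → sym (∑-cons (f k))) (Poly-+ (p zero) (Poly-∑ (p ∘ suc)))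

  Poly-det : ∀ {n} {M : ℕ → Matrix n} → (∀ i j → Poly λ k → M k i j) → Poly λ k → det (M k)
  Poly-det {zero}  {M} p = Poly-cong (λ k → sym (det-nil (M k))) (Poly-const 1#)
  Poly-det {suc n} {M} p = Poly-cong (λ k → sym (det-expand (M k)))
    (Poly-∑ λ j → Poly-* (Poly-* (Poly-const (sign j)) (p zero j))
                         (Poly-det λ i l → p (suc i) (punchIn j l)))

  Poly-setRow : ∀ {m n} {M : ℕ → Fin m → Vector Carrier n} {u : ℕ → Vector Carrier n} k →
    (∀ i j → Poly λ t → M t i j) → (∀ j → Poly λ t → u t j) → ∀ i j → Poly λ t → setRow (M t) k (u t) i j
  Poly-setRow zero    p q zero    = q
  Poly-setRow zero    p q (suc i) = p (suc i)
  Poly-setRow (suc k) p q zero    = p zero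
  Poly-setRow (suc k) p q (suc i) = Poly-setRow k (p ∘ suc) q i

  -- `Δ f` also vanishes at positive arguments and has smaller degree. By induction it vanishes at
  -- 0, so f 0 equals f 1.
  Deg-extrapolate : ∀ d {f} → Deg d f → (∀ k → f (suc k) ≈ 0#) → f 0 ≈ 0#
  Deg-extrapolate zero    p _ = p 0
  Deg-extrapolate (suc d) {f} p f≈0 = sym (trans (sym (f≈0 0)) (x+-1y≈0⇒x≈y
    (Deg-extrapolate d {Δ f} p λ k → x≈y⇒x+-1y≈0 (trans (f≈0 (suc k)) (sym (f≈0 k))))))

  Poly-extrapolate : ∀ {f g} → Poly f → Poly g → (∀ k → f (suc k) ≈ g (suc k)) → ∀ k → f k ≈ g k
  Poly-extrapolate p q f≈g (suc k) = f≈g k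
  Poly-extrapolate {f} {g} p q f≈g zero with Poly-+ p (Poly-* (Poly-const (- 1#)) q)
  ... | d , r = x+-1y≈0⇒x≈y (Deg-extrapolate d r λ k → x≈y⇒x+-1y≈0 (f≈g k))

  -- slope M N h is the difference quotient of det at M in the direction N; being
  -- polynomial in h, it is determined at h = 0 by its values at h ≥ 1.

  infixl 6 _⊞_∙_
  _⊞_∙_ : ∀ {n} → Matrix n → Carrier → Matrix n → Matrix n
  (M ⊞ h ∙ N) i j = M i j + h * N i j

  slope : ∀ {n} → Matrix n → Matrix n → Carrier → Carrier
  slope {zero}  M N h = 0#
  slope {suc n} M N h = ∑ λ j → sign j * N zero j * det (minor (M ⊞ h ∙ N) j)
                               + sign j * M zero j * slope (minor M j) (minor N j) h

  det-slope : ∀ {n} (M N : Matrix n) h → det (M ⊞ h ∙ N) ≈ det M + h * slope M N h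
  det-slope {zero}  M N h = begin
    det (M ⊞ h ∙ N)     ≈⟨ trans (det-nil _) (sym (det-nil _)) ⟩
    det M               ≈⟨ +-identityʳ _ ⟨
    det M + 0#          ≈⟨ +-congˡ (zeroʳ h) ⟨
    det M + h * 0#      ∎
  det-slope {suc n} M N h = begin
    det (M ⊞ h ∙ N)
      ≈⟨ det-expand _ ⟩
    ∑ (λ j → sign j * (M zero j + h * N zero j) * D j)
      ≈⟨ ∑-cong (λ j → split j (det-slope (minor M j) (minor N j) h)) ⟩
    ∑ (λ j → sign j * M zero j * det (minor M j) + h * E j)
      ≈⟨ ∑-+ (λ j → sign j * M zero j * det (minor M j)) _ ⟩
    ∑ (λ j → sign j * M zero j * det (minor M j)) + ∑ (λ j → h * E j)
      ≈⟨ +-cong (sym (det-expand M)) (sym (*-∑ h E)) ⟩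
    det M + h * slope M N h ∎
    where
    D E : Fin (suc n) → Carrier
    D j = det (minor (M ⊞ h ∙ N) j)
    E j = sign j * N zero j * D j + sign j * M zero j * slope (minor M j) (minor N j) h
    split : ∀ j → D j ≈ det (minor M j) + h * slope (minor M j) (minor N j) h →
      sign j * (M zero j + h * N zero j) * D j ≈ sign j * M zero j * det (minor M j) + h * E j
    split j eq = begin
      sign j * (M zero j + h * N zero j) * D j
        ≈⟨ solve 5 (λ s m h n d → s :* (m :+ h :* n) :* d := s :* m :* d :+ h :* (s :* n :* d)) refl
             (sign j) (M zero j) h (N zero j) (D j) ⟩
      sign j * M zero j * D j + h * (sign j * N zero j * D j)
        ≈⟨ +-congʳ (*-congˡ eq) ⟩
      sign j * M zero j * (det (minor M j) + h * e) + h * (sign j * N zero j * D j)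
        ≈⟨ solve 5 (λ sm d h e r → sm :* (d :+ h :* e) :+ h :* r := sm :* d :+ h :* (r :+ sm :* e)) refl
             (sign j * M zero j) (det (minor M j)) h e (sign j * N zero j * D j) ⟩
      sign j * M zero j * det (minor M j) + h * E j ∎
      where e = slope (minor M j) (minor N j) h

  -- The product rule for a multilinear function: its derivative replaces one row at a time. With
  -- cofactors this becomes Jacobi's formula, in `slope-pencil`.
  slope-0 : ∀ {n} (M N : Matrix n) → slope M N 0# ≈ ∑ λ k → det (setRow M k (N k))
  slope-0 {zero}  M N = sym (∑-nil _)
  slope-0 {suc n} M N = begin
    ∑ (λ j → sign j * N zero j * det (minor (M ⊞ 0# ∙ N) j) + sign j * M zero j * slope (minor M j) (minor N j) 0#)
      ≈⟨ ∑-+ (λ j → sign j * N zero j * det (minor (M ⊞ 0# ∙ N) j)) _ ⟩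
    ∑ (λ j → sign j * N zero j * det (minor (M ⊞ 0# ∙ N) j)) +
    ∑ (λ j → sign j * M zero j * slope (minor M j) (minor N j) 0#)
      ≈⟨ +-cong
           (trans (∑-cong λ j → *-congˡ (det-cong λ i l → trans (+-congˡ (zeroˡ _)) (+-identityʳ _)))
                  (sym (det-expand (setRow M zero (N zero)))))
           (∑-cong λ j → *-congˡ (slope-0 (minor M j) (minor N j))) ⟩
    det (setRow M zero (N zero)) +
    ∑ (λ j → sign j * M zero j * ∑ λ k → det (setRow (minor M j) k (minor N j k)))
      ≈⟨ +-congˡ (begin
        ∑ (λ j → sign j * M zero j * ∑ λ k → det (setRow (minor M j) k (minor N j k)))
          ≈⟨ ∑-cong (λ j → *-∑ (sign j * M zero j) _) ⟩
        ∑ (λ j → ∑ λ k → sign j * M zero j * det (setRow (minor M j) k (minor N j k)))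
          ≈⟨ ∑-swap (λ j k → sign j * M zero j * det (setRow (minor M j) k (minor N j k))) ⟩
        ∑ (λ k → ∑ λ j → sign j * M zero j * det (setRow (minor M j) k (minor N j k)))
          ≈⟨ ∑-cong (λ k → ∑-cong λ j → *-congˡ (sym (minor-setRow M k (N (suc k)) j))) ⟩
        ∑ (λ k → ∑ λ j → sign j * M zero j * det (minor (setRow M (suc k) (N (suc k))) j))
          ≈⟨ ∑-cong (λ k → sym (det-expand (setRow M (suc k) (N (suc k))))) ⟩
        ∑ (λ k → det (setRow M (suc k) (N (suc k)))) ∎) ⟩
    det (setRow M zero (N zero)) + ∑ (λ k → det (setRow M (suc k) (N (suc k))))
      ≈⟨ ∑-cons (λ k → det (setRow M k (N k))) ⟨
    ∑ (λ k → det (setRow M k (N k))) ∎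

  Poly-slope : ∀ {n} (M N : Matrix n) → Poly λ h → slope M N (ι h)
  Poly-slope {zero}  M N = Poly-const 0#
  Poly-slope {suc n} M N = Poly-∑ λ j → Poly-+
    (Poly-* (Poly-const _) (Poly-det λ i l →
      Poly-+ (Poly-const _) (Poly-* Poly-ι (Poly-const _))))
    (Poly-* (Poly-const _) (Poly-slope (minor M j) (minor N j)))

  -- Powers of a matrix and their traces

  infixr 7 _⊡_
  _⊡_ : ∀ {n} → Matrix n → Vector Carrier n → Vector Carrier n
  (A ⊡ v) i = ∑ λ j → A i j * v j

  pow : ∀ {n} → Matrix n → ℕ → Vector Carrier n → Vector Carrier n
  pow A zero    v = v
  pow A (suc m) v = pow A m (A ⊡ v)

  tracePow : ∀ {n} → Matrix n → ℕ → Carrier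
  tracePow A m = ∑ λ k → pow A m (unit k) k

  ⊡-linear : ∀ {n} (A : Matrix n) s u v i →
    (A ⊡ (λ j → u j + s * v j)) i ≈ (A ⊡ u) i + s * (A ⊡ v) i
  ⊡-linear A s u v i = begin
    ∑ (λ j → A i j * (u j + s * v j))
      ≈⟨ ∑-cong (λ j → solve 4 (λ a u s v → a :* (u :+ s :* v) := a :* u :+ s :* (a :* v)) refl
                          (A i j) (u j) s (v j)) ⟩
    ∑ (λ j → A i j * u j + s * (A i j * v j))
      ≈⟨ ∑-+ (λ j → A i j * u j) _ ⟩
    ∑ (λ j → A i j * u j) + ∑ (λ j → s * (A i j * v j))
      ≈⟨ +-congˡ (*-∑ s _) ⟨
    (A ⊡ u) i + s * (A ⊡ v) i ∎

  pow-cong : ∀ {n} (A : Matrix n) m {u v} → (∀ i → u i ≈ v i) → ∀ i → pow A m u i ≈ pow A m v i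
  pow-cong A zero    u≈v = u≈v
  pow-cong A (suc m) u≈v = pow-cong A m λ i → ∑-cong λ j → *-congˡ (u≈v j)

  pow-linear : ∀ {n} (A : Matrix n) m s u v i →
    pow A m (λ j → u j + s * v j) i ≈ pow A m u i + s * pow A m v i
  pow-linear A zero    s u v i = refl
  pow-linear A (suc m) s u v i =
    trans (pow-cong A m (⊡-linear A s u v) i) (pow-linear A m s (A ⊡ u) (A ⊡ v) i)

  pow-scale : ∀ {n} (A : Matrix n) m s u i → pow A m (λ j → s * u j) i ≈ s * pow A m u i
  pow-scale A zero    s u i = refl
  pow-scale A (suc m) s u i = trans
    (pow-cong A m (λ i → trans
      (∑-cong λ j → solve 3 (λ a s u → a :* (s :* u) := s :* (a :* u)) refl (A i j) s (u j))
      (sym (*-∑ s _))) i)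
    (pow-scale A m s (A ⊡ u) i)

  ι-∑ : ∀ {n} (f : Vector ℕ n) → ι (ℕΣ.sum f) ≈ ∑ (ι ∘ f)
  ι-∑ {zero}  f = sym (∑-nil _)
  ι-∑ {suc n} f = trans (×-homo-+ 1# (f zero) _) (trans (+-congˡ (ι-∑ (f ∘ suc))) (sym (∑-cons (ι ∘ f))))

  module _ {n} (a : Fin n → Fin n → ℕ) (A : Matrix n) (A≈a : ∀ i j → A i j ≈ ι (a i j)) where

    ι-walks : ∀ m {v u} → (∀ i → u i ≈ ι (v i)) → ∀ i → ι (walks a m v i) ≈ pow A m u i
    ι-walks zero    u≈v i = sym (u≈v i)
    ι-walks (suc m) {v} {u} u≈v = ι-walks m λ i → sym (trans (ι-∑ (λ j → a i j ℕ.* v j))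
      (∑-cong λ j → trans (×1-homo-* (a i j) (v j)) (*-cong (sym (A≈a i j)) (sym (u≈v j)))))

    ι-closedWalks : ∀ m → ι (closedWalks a m) ≈ tracePow A m
    ι-closedWalks m = trans (ι-∑ (λ k → walks a m (unitℕ k) k))
      (∑-cong λ k → ι-walks m (λ j → ι-if (does (k Fin.≟ j))) k)
      where
      ι-if : ∀ b → (if b then 1# else 0#) ≈ ι (if b then 1 else 0)
      ι-if true  = sym (+-identityʳ 1#)
      ι-if false = refl

  Poly-pow : ∀ {n} (A : Matrix n) m {v : ℕ → Vector Carrier n} →
    (∀ i → Poly λ t → v t i) → ∀ i → Poly λ t → pow A m (v t) i
  Poly-pow A zero    p = p
  Poly-pow A (suc m) p = Poly-pow A m λ i → Poly-∑ λ j → Poly-* (Poly-const _) (p j)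

  -- Cramer's rule when positive integers are invertible

  module _ (recip : ∀ k → ∃ λ c → c * ι (suc k) ≈ 1#) where

    torsionFree : ∀ k {x y} → ι (suc k) * x ≈ ι (suc k) * y → x ≈ y
    torsionFree k {x} {y} eq = begin
      x                    ≈⟨ cancel x ⟨
      r * (ι (suc k) * x)  ≈⟨ *-congˡ eq ⟩
      r * (ι (suc k) * y)  ≈⟨ cancel y ⟩
      y                    ∎
      where
      r : Carrier
      r = proj₁ (recip k)
      cancel : ∀ z → r * (ι (suc k) * z) ≈ z
      cancel z = begin
        r * (ι (suc k) * z)  ≈⟨ *-assoc _ _ _ ⟨
        r * ι (suc k) * z    ≈⟨ *-congʳ (proj₂ (recip k)) ⟩
        1# * z               ≈⟨ *-identityˡ z ⟩
        z                    ∎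

    x+x≈0⇒x≈0 : ∀ {x} → x + x ≈ 0# → x ≈ 0#
    x+x≈0⇒x≈0 {x} eq = torsionFree 1 (begin
      (1# + (1# + 0#)) * x  ≈⟨ solve 1 (λ x → (con 1 :+ (con 1 :+ con 0)) :* x := x :+ x) refl x ⟩
      x + x                 ≈⟨ eq ⟩
      0#                    ≈⟨ zeroʳ _ ⟨
      ι 2 * 0#              ∎)

    -- If rows 0 and 1 agree, swapping them gives det M + det M = 0, and 2 can be cancelled. If row
    -- 0 agrees with a later row, the swap moves it to position 1, so that both equal rows survive
    -- in all minors.
    det-equalRows : ∀ {n} (M : Matrix n) {i j} → i Fin.< j → (∀ c → M i c ≈ M j c) → det M ≈ 0#
    det-equalRows {suc n} M {suc i} {suc j} (ℕ.s≤s i<j) eq =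
      det-minors-zero M λ l → det-equalRows (minor M l) i<j λ c → eq (punchIn l c)
    det-equalRows {suc (suc n)} M {zero} {suc zero} _ eq = x+x≈0⇒x≈0 (trans
      (+-congˡ (det-cong λ { zero c → eq c ; (suc zero) c → sym (eq c) ; (suc (suc i)) c → refl }))
      (det-swap₀₁ M))
    det-equalRows {suc (suc n)} M {zero} {suc (suc j)} _ eq = begin
      det M                     ≈⟨ +-identityʳ _ ⟨
      det M + 0#                ≈⟨ +-congˡ (det-minors-zero (swap₀₁ M) λ l →
                                     det-equalRows (minor (swap₀₁ M) l) {zero} {suc j} (ℕ.s≤s ℕ.z≤n)
                                       λ c → eq (punchIn l c)) ⟨
      det M + det (swap₀₁ M)    ≈⟨ det-swap₀₁ M ⟩
      0#                        ∎

    setRow-same : ∀ {m n} (M : Fin m → Vector Carrier n) k u → setRow M k u k ≡ u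
    setRow-same M zero    u = ≡.refl
    setRow-same M (suc k) u = setRow-same (M ∘ suc) k u

    setRow-other : ∀ {m n} (M : Fin m → Vector Carrier n) {k l} u → l ≢ k → setRow M k u l ≡ M l
    setRow-other M {zero}  {zero}  u l≢k = contradiction ≡.refl l≢k
    setRow-other M {zero}  {suc l} u l≢k = ≡.refl
    setRow-other M {suc k} {zero}  u l≢k = ≡.refl
    setRow-other M {suc k} {suc l} u l≢k = setRow-other (M ∘ suc) u (l≢k ∘ ≡.cong suc)

    setRow-self : ∀ {m n} (M : Fin m → Vector Carrier n) k i → setRow M k (M k) i ≡ M i
    setRow-self M zero    zero    = ≡.refl
    setRow-self M zero    (suc i) = ≡.refl
    setRow-self M (suc k) zero    = ≡.refl
    setRow-self M (suc k) (suc i) = setRow-self (M ∘ suc) k i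

    det-setRow : ∀ {n} (M : Matrix n) k l → det (setRow M k (M l)) ≈ det M * unit k l
    det-setRow M k l with k Fin.≟ l
    ... | yes ≡.refl = trans (det-cong λ i c → reflexive (≡.cong (_$ c) (setRow-self M k i))) (sym (*-identityʳ _))
    ... | no k≢l = trans (vanish (Fin.<-cmp k l)) (sym (zeroʳ _))
      where
      rows : ∀ c → setRow M k (M l) k c ≈ setRow M k (M l) l c
      rows c = reflexive (≡.trans (≡.cong (_$ c) (setRow-same M k (M l)))
                                  (≡.cong (_$ c) (≡.sym (setRow-other M (M l) (k≢l ∘ ≡.sym)))))
      vanish : Tri (k Fin.< l) (k ≡ l) (l Fin.< k) → det (setRow M k (M l)) ≈ 0#
      vanish (tri< k<l _ _) = det-equalRows _ k<l rows
      vanish (tri≈ _ k≡l _) = contradiction k≡l k≢l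
      vanish (tri> _ _ l<k) = det-equalRows _ l<k λ c → sym (rows c)

    -- Column k of the adjugate. Row replacement in place of signed minors makes Cramer's rule a
    -- consequence of linearity and `det-equalRows`.
    cofactor : ∀ {n} → Matrix n → Fin n → Vector Carrier n
    cofactor M k j = det (setRow M k (unit j))

    det-setRow-cofactor : ∀ {n} (M : Matrix n) k u → det (setRow M k u) ≈ ∑ λ j → u j * cofactor M k j
    det-setRow-cofactor M k u = trans
      (det-cong λ i c → pointwise c i k M)
      (det-linear M k u unit)
      where
      pointwise : ∀ {m} c i k (M : Fin m → Vector Carrier _) →
        setRow M k u i c ≈ setRow M k (λ c → ∑ λ j → u j * unit j c) i c
      pointwise c zero    zero    M = sym (∑-unit u c)
      pointwise c (suc i) zero    M = refl
      pointwise c zero    (suc k) M = refl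
      pointwise c (suc i) (suc k) M = pointwise c i k (M ∘ suc)

    cramer : ∀ {n} (M : Matrix n) k l → (M ⊡ cofactor M k) l ≈ det M * unit k l
    cramer M k l = trans (sym (det-setRow-cofactor M k (M l))) (det-setRow M k l)

    -- The pencil I + t A

    module Pencil {n} (A : Matrix n) where

      pencil : ℕ → Matrix n
      pencil t = unit ⊞ ι t ∙ A

      D : ℕ → Carrier
      D t = det (pencil t)

      cof : ℕ → Fin n → Vector Carrier n
      cof t = cofactor (pencil t)

      -- The trace of Aᵐ adj (I + t A).
      τ : ℕ → ℕ → Carrier
      τ m t = ∑ λ k → pow A m (cof t k) k

      Poly-τ : ∀ m → Poly (τ m)
      Poly-τ m = Poly-∑ λ k → Poly-pow A m (λ j → Poly-det
        (Poly-setRow k (λ i j → Poly-+ (Poly-const _) (Poly-* Poly-ι (Poly-const _))) λ c → Poly-const _)) k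

      cof-split : ∀ t k l → cof t k l + ι t * (A ⊡ cof t k) l ≈ D t * unit k l
      cof-split t k l = begin
        cof t k l + ι t * ∑ (λ j → A l j * cof t k j)
          ≈⟨ +-cong (trans (∑-cong λ j → *-congˡ (reflexive (unit-sym l j))) (∑-unit (cof t k) l))
                    (sym (*-∑ (ι t) _)) ⟨
        ∑ (λ j → cof t k j * unit l j) + ∑ (λ j → ι t * (A l j * cof t k j))
          ≈⟨ ∑-+ (λ j → cof t k j * unit l j) _ ⟨
        ∑ (λ j → cof t k j * unit l j + ι t * (A l j * cof t k j))
          ≈⟨ ∑-cong (λ j → solve 4 (λ c e t a → c :* e :+ t :* (a :* c) := (e :+ t :* a) :* c) refl
                             (cof t k j) (unit l j) (ι t) (A l j)) ⟩
        (pencil t ⊡ cof t k) l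
          ≈⟨ cramer (pencil t) k l ⟩
        D t * unit k l ∎

      recurrence : ∀ m t → τ m t + ι t * τ (suc m) t ≈ D t * tracePow A m
      recurrence m t = begin
        ∑ (λ k → pow A m (cof t k) k) + ι t * ∑ (λ k → pow A m (A ⊡ cof t k) k)
          ≈⟨ +-congˡ (*-∑ (ι t) _) ⟩
        ∑ (λ k → pow A m (cof t k) k) + ∑ (λ k → ι t * pow A m (A ⊡ cof t k) k)
          ≈⟨ ∑-+ (λ k → pow A m (cof t k) k) _ ⟨
        ∑ (λ k → pow A m (cof t k) k + ι t * pow A m (A ⊡ cof t k) k)
          ≈⟨ ∑-cong (λ k → trans (sym (pow-linear A m (ι t) (cof t k) (A ⊡ cof t k) k))
                          (trans (pow-cong A m (cof-split t k) k)
                                 (pow-scale A m (D t) (unit k) k))) ⟩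
        ∑ (λ k → D t * pow A m (unit k) k)
          ≈⟨ *-∑ (D t) _ ⟨
        D t * tracePow A m ∎

      slope-pencil : ∀ t → slope (pencil t) A 0# ≈ τ 1 t
      slope-pencil t = trans (slope-0 (pencil t) A) (∑-cong λ k → det-setRow-cofactor (pencil t) k (A k))

      D-+ : ∀ t h → D (t ℕ.+ h) ≈ D t + ι h * slope (pencil t) A (ι h)
      D-+ t h = trans
        (det-cong λ i j → trans (+-congˡ (*-congʳ (×-homo-+ 1# t h)))
          (solve 4 (λ u s r a → u :+ (s :+ r) :* a := u :+ s :* a :+ r :* a) refl (unit i j) (ι t) (ι h) (A i j)))
        (det-slope (pencil t) A (ι h))

    module _ {n} (A B : Matrix n)
             (same : ∀ t → Pencil.D A t ≈ Pencil.D B t) (D₀ : Pencil.D A 0 ≈ 1#) where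
      private
        module A = Pencil A
        module B = Pencil B

      +-cancel : ∀ {x y x′ y′} → x ≈ x′ → x + y ≈ x′ + y′ → y ≈ y′
      +-cancel {x} {y} {x′} {y′} x≈x′ eq = begin
        y                  ≈⟨ +-identityˡ y ⟨
        0# + y             ≈⟨ +-congʳ (-‿inverseˡ x) ⟨
        - x + x + y        ≈⟨ +-assoc _ _ _ ⟩
        - x + (x + y)      ≈⟨ +-cong (-‿cong x≈x′) eq ⟩
        - x′ + (x′ + y′)   ≈⟨ +-assoc _ _ _ ⟨
        - x′ + x′ + y′     ≈⟨ +-congʳ (-‿inverseˡ x′) ⟩
        0# + y′            ≈⟨ +-identityˡ y′ ⟩
        y′                 ∎

      -- For h ≥ 1 the slope is (D (t + h) - D t) / h, hence the same for both matrices.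
      -- Extrapolation to h = 0 takes the place of the limit.
      τ₁-same : ∀ t → A.τ 1 t ≈ B.τ 1 t
      τ₁-same t = begin
        A.τ 1 t                     ≈⟨ A.slope-pencil t ⟨
        slope (A.pencil t) A (ι 0)  ≈⟨ Poly-extrapolate (Poly-slope _ A) (Poly-slope _ B) positive 0 ⟩
        slope (B.pencil t) B (ι 0)  ≈⟨ B.slope-pencil t ⟩
        B.τ 1 t                     ∎
        where
        positive : ∀ h → slope (A.pencil t) A (ι (suc h)) ≈ slope (B.pencil t) B (ι (suc h))
        positive h = torsionFree h (+-cancel (same t)
          (trans (sym (A.D-+ t (suc h))) (trans (same (t ℕ.+ suc h)) (B.D-+ t (suc h)))))

      -- At t = 0 the second term of `recurrence` vanishes and D 0 = 1, so `τ m 0` is the trace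
      -- itself.
      trace-from-τ : ∀ m → (∀ t → A.τ m t ≈ B.τ m t) → tracePow A m ≈ tracePow B m
      trace-from-τ m eq = begin
        tracePow A m                  ≈⟨ at-0 A D₀ m ⟩
        A.τ m 0                       ≈⟨ eq 0 ⟩
        B.τ m 0                       ≈⟨ at-0 B (trans (sym (same 0)) D₀) m ⟨
        tracePow B m                  ∎
        where
        at-0 : ∀ (C : Matrix n) → Pencil.D C 0 ≈ 1# → ∀ m → tracePow C m ≈ Pencil.τ C m 0
        at-0 C D≈1 m = begin
          tracePow C m                                      ≈⟨ *-identityˡ _ ⟨
          1# * tracePow C m                                 ≈⟨ *-congʳ D≈1 ⟨
          Pencil.D C 0 * tracePow C m                       ≈⟨ Pencil.recurrence C m 0 ⟨
          Pencil.τ C m 0 + 0# * Pencil.τ C (suc m) 0        ≈⟨ +-congˡ (zeroˡ _) ⟩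
          Pencil.τ C m 0 + 0#                               ≈⟨ +-identityʳ _ ⟩
          Pencil.τ C m 0                                    ∎

      -- `recurrence` determines t τ (m + 2) t from τ (m + 1) t and the trace of the power m + 1,
      -- both already known to agree. For t ≥ 1 the factor t is cancelled; t = 0 is reached by
      -- extrapolation.
      τ-same : ∀ m t → A.τ (suc m) t ≈ B.τ (suc m) t
      τ-same zero    = τ₁-same
      τ-same (suc m) = Poly-extrapolate (A.Poly-τ (suc (suc m))) (B.Poly-τ (suc (suc m))) λ t →
        torsionFree t (+-cancel (τ-same m (suc t)) (begin
          A.τ (suc m) (suc t) + ι (suc t) * A.τ (suc (suc m)) (suc t)  ≈⟨ A.recurrence (suc m) (suc t) ⟩
          A.D (suc t) * tracePow A (suc m)  ≈⟨ *-cong (same (suc t)) (trace-from-τ (suc m) (τ-same m)) ⟩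
          B.D (suc t) * tracePow B (suc m)  ≈⟨ B.recurrence (suc m) (suc t) ⟨
          B.τ (suc m) (suc t) + ι (suc t) * B.τ (suc (suc m)) (suc t)  ∎))

      tracePow-same : ∀ m → tracePow A (suc m) ≈ tracePow B (suc m)
      tracePow-same m = trace-from-τ (suc m) (τ-same m)

    -- Diagonal matrices and the spectrum

    unit-diag : ∀ {n} (k : Fin n) → unit k k ≡ 1#
    unit-diag zero    = ≡.refl
    unit-diag (suc k) = unit-diag k

    diag : ∀ {n} → Vector Carrier n → Matrix n
    diag d i j = d i * unit i j

    product-scale : ∀ {n} s (f : Vector Carrier n) → product (λ i → s * f i) ≈ s ^ n * product f
    product-scale {zero}  s f = sym (*-identityˡ _)
    product-scale {suc n} s f = trans (*-congˡ (product-scale s (f ∘ suc)))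
      (solve 4 (λ s f p q → s :* f :* (p :* q) := s :* p :* (f :* q)) refl s (f zero) (s ^ n) (product (f ∘ suc)))

    det-scale : ∀ {n} s (M : Matrix n) → det (λ i j → s * M i j) ≈ s ^ n * det M
    det-scale {zero}  s M = trans (det-nil _) (sym (trans (*-identityˡ _) (det-nil M)))
    det-scale {suc n} s M = begin
      det (λ i j → s * M i j)
        ≈⟨ det-expand _ ⟩
      ∑ (λ j → sign j * (s * M zero j) * det (λ i l → s * minor M j i l))
        ≈⟨ ∑-cong (λ j → trans (*-congˡ (det-scale s (minor M j)))
             (solve 5 (λ g s m p d → g :* (s :* m) :* (p :* d) := s :* p :* (g :* m :* d)) refl
               (sign j) s (M zero j) (s ^ n) (det (minor M j)))) ⟩
      ∑ (λ j → s ^ suc n * (sign j * M zero j * det (minor M j)))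
        ≈⟨ *-∑ (s ^ suc n) _ ⟨
      s ^ suc n * ∑ (λ j → sign j * M zero j * det (minor M j))
        ≈⟨ *-congˡ (det-expand M) ⟨
      s ^ suc n * det M ∎

    det-diag : ∀ {n} (d : Vector Carrier n) → det (diag d) ≈ product d
    det-diag {zero}  d = det-nil _
    det-diag {suc n} d = begin
      det (diag d)
        ≈⟨ det-expand _ ⟩
      ∑ (λ j → sign j * (d zero * unit zero j) * det (minor (diag d) j))
        ≈⟨ ∑-cons (λ j → sign j * (d zero * unit zero j) * det (minor (diag d) j)) ⟩
      1# * (d zero * 1#) * det (minor (diag d) zero)
        + ∑ (λ j → sign (suc j) * (d zero * 0#) * det (minor (diag d) (suc j)))
        ≈⟨ +-cong (*-congʳ (trans (*-identityˡ _) (*-identityʳ _)))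
                  (∑-zero λ j → trans (*-congʳ (trans (*-congˡ (zeroʳ _)) (zeroʳ _))) (zeroˡ _)) ⟩
      d zero * det (minor (diag d) zero) + 0#
        ≈⟨ +-identityʳ _ ⟩
      d zero * det (minor (diag d) zero)
        ≈⟨ *-congˡ (trans (det-cong λ i j → refl) (det-diag (d ∘ suc))) ⟩
      product d ∎

    tracePow-diag : ∀ {n} (d : Vector Carrier n) m → tracePow (diag d) m ≈ ∑ λ i → d i ^ m
    tracePow-diag {n} d m = ∑-cong λ k →
      trans (pow-diag m (unit k) k) (trans (*-congˡ (reflexive (unit-diag k))) (*-identityʳ _))
      where
      pow-diag : ∀ m v i → pow (diag d) m v i ≈ d i ^ m * v i
      pow-diag zero    v i = sym (*-identityˡ _)
      pow-diag (suc m) v i = trans (pow-diag m (diag d ⊡ v) i) (trans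
        (*-congˡ (trans
          (∑-cong λ j → trans
            (solve 3 (λ d e v → d :* e :* v := d :* v :* e) refl (d i) (unit i j) (v j))
            (*-congˡ (reflexive (unit-sym i j))))
          (∑-unit (λ j → d i * v j) i)))
        (solve 3 (λ p d v → p :* (d :* v) := d :* p :* v) refl (d i ^ m) (d i) (v i)))

    module _ {n} (A : Matrix n) (λs : Vector Carrier n)
             (factors : ∀ x → det (λ i j → x * unit i j - A i j) ≈ product (λ i → x - λs i)) where

      D₀≈1 : ∀ B → Pencil.D B 0 ≈ 1#
      D₀≈1 B = trans
        (det-cong {N = diag (λ _ → 1#)} λ i j → trans (+-congˡ (zeroˡ _)) (trans (+-identityʳ _) (sym (*-identityˡ _))))
        (trans (det-diag {n} λ _ → 1#) (ones n))
        where
        ones : ∀ n → product {n} (λ _ → 1#) ≈ 1#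
        ones zero    = refl
        ones (suc n) = trans (*-identityˡ _) (ones n)

      -- For t ≥ 1 this is the factorisation of det (x I − A) at x = − 1 / t,
      -- multiplied by (− t)ⁿ.
      pencil-same : ∀ t → Pencil.D A t ≈ Pencil.D (diag λs) t
      pencil-same zero    = trans (D₀≈1 A) (sym (D₀≈1 (diag λs)))
      pencil-same (suc t) = begin
        Pencil.D A (suc t)
          ≈⟨ det-cong (λ i j → sym (entry (unit i j) (A i j))) ⟩
        det (λ i j → s * (x * unit i j - A i j))
          ≈⟨ det-scale s _ ⟩
        s ^ n * det (λ i j → x * unit i j - A i j)
          ≈⟨ *-congˡ (factors x) ⟩
        s ^ n * product (λ i → x - λs i)
          ≈⟨ product-scale s (λ i → x - λs i) ⟨
        product (λ i → s * (x - λs i))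
          ≈⟨ product-cong (λ i → trans (*-congˡ (+-congʳ (sym (*-identityʳ _)))) (entry 1# (λs i))) ⟩
        product (λ i → 1# + ι (suc t) * λs i)
          ≈⟨ det-diag (λ i → 1# + ι (suc t) * λs i) ⟨
        det (diag λ i → 1# + ι (suc t) * λs i)
          ≈⟨ det-cong (λ i j → solve 3 (λ t l e → (con 1 :+ t :* l) :* e := e :+ t :* (l :* e)) refl
                                (ι (suc t)) (λs i) (unit i j)) ⟩
        Pencil.D (diag λs) (suc t) ∎
        where
        s x : Carrier
        s = - ι (suc t)
        x = - proj₁ (recip t)
        sx≈1 : s * x ≈ 1#
        sx≈1 = begin
          - ι (suc t) * - proj₁ (recip t)      ≈⟨ -‿distribˡ-* _ _ ⟨
          - (ι (suc t) * - proj₁ (recip t))    ≈⟨ -‿cong (-‿distribʳ-* _ _) ⟨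
          - - (ι (suc t) * proj₁ (recip t))    ≈⟨ -‿involutive _ ⟩
          ι (suc t) * proj₁ (recip t)          ≈⟨ *-comm _ _ ⟩
          proj₁ (recip t) * ι (suc t)          ≈⟨ proj₂ (recip t) ⟩
          1#                                   ∎
        entry : ∀ e a → s * (x * e - a) ≈ e + ι (suc t) * a
        entry e a = begin
          s * (x * e - a)         ≈⟨ distribˡ _ _ _ ⟩
          s * (x * e) + s * - a   ≈⟨ +-cong (trans (sym (*-assoc _ _ _)) (trans (*-congʳ sx≈1) (*-identityˡ e)))
                                            (trans (sym (-‿distribʳ-* s a)) (-‿distribˡ-* s a)) ⟩
          e + - s * a             ≈⟨ +-congˡ (*-congʳ (-‿involutive (ι (suc t)))) ⟩
          e + ι (suc t) * a       ∎

      tracePow-spectrum : ∀ m → tracePow A (suc m) ≈ ∑ λ i → λs i ^ suc m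
      tracePow-spectrum m = trans (tracePow-same A (diag λs) pencil-same (D₀≈1 A) m) (tracePow-diag λs (suc m))

-- The functions derived from the ring operations are parameters, so that no
-- comparison of unfolded operations on Cauchy reals arises on instantiation.
module ClosedWalks {c ℓ} {C : Set c} {_≈_ : Rel C ℓ} {_+_ _*_ : Op₂ C} { -_ : Op₁ C} {0# 1# : C}
  (isCommutativeRing : IsCommutativeRing _≈_ _+_ _*_ -_ 0# 1#)
  (nat : ℕ → C) (nat-zero : nat 0 ≈ 0#) (nat-suc : ∀ k → nat (suc k) ≈ (1# + nat k))
  (recip : ∀ k → ∃ λ x → (x * nat (suc k)) ≈ 1#)
  (_-_ : Op₂ C) (sub-def : ∀ x y → (x - y) ≈ (x + (- y)))
  (_^_ : C → ℕ → C) (^-zero : ∀ x → (x ^ 0) ≈ 1#) (^-suc : ∀ x k → (x ^ suc k) ≈ (x * (x ^ k)))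
  (sum : ∀ {n} → Vector C n → C) (sum-nil : ∀ f → sum {0} f ≈ 0#)
  (sum-cons : ∀ {n} (f : Vector C (suc n)) → sum f ≈ (f zero + sum (f ∘ suc)))
  (product : ∀ {n} → Vector C n → C) (product-nil : ∀ f → product {0} f ≈ 1#)
  (product-cons : ∀ {n} (f : Vector C (suc n)) → product f ≈ (f zero * product (f ∘ suc)))
  (det : ∀ {n} → (Fin n → Fin n → C) → C) (det-nil : ∀ M → det {0} M ≈ 1#)
  (det-expand : ∀ {n} (M : Fin (suc n) → Fin (suc n) → C) →
    det M ≈ sum λ j → (((- 1#) ^ toℕ j) * M zero j) * det λ i → removeAt (M (suc i)) j)
  where

  private
    R : CommutativeRing c ℓ
    R = record { isCommutativeRing = isCommutativeRing }
    module R = CommutativeRing R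
    module T = TraceIdentity R
    open T using (∑)
    open import Algebra.Definitions.RawSemiring (Semiring.rawSemiring R.semiring)
      using () renaming (_^_ to _^ᴿ_; product to productᴿ)
    open import Relation.Binary.Reasoning.Setoid R.setoid

    ι≈nat : ∀ k → T.ι k ≈ nat k
    ι≈nat zero    = R.sym nat-zero
    ι≈nat (suc k) = R.trans (R.+-congˡ (ι≈nat k)) (R.sym (nat-suc k))

    ^≈^ : ∀ x k → (x ^ᴿ k) ≈ (x ^ k)
    ^≈^ x zero    = R.sym (^-zero x)
    ^≈^ x (suc k) = R.trans (R.*-congˡ (^≈^ x k)) (R.sym (^-suc x k))

    ∑≈sum : ∀ {n} (f : Vector C n) → ∑ f ≈ sum f
    ∑≈sum {zero}  f = R.trans (T.∑-nil f) (R.sym (sum-nil f))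
    ∑≈sum {suc n} f = R.trans (T.∑-cons f) (R.trans (R.+-congˡ (∑≈sum (f ∘ suc))) (R.sym (sum-cons f)))

    product≈product : ∀ {n} (f : Vector C n) → product f ≈ productᴿ f
    product≈product {zero}  f = product-nil f
    product≈product {suc n} f = R.trans (product-cons f) (R.*-congˡ (product≈product (f ∘ suc)))

    det≈det : ∀ {n} (M : Fin n → Fin n → C) → det M ≈ T.det M
    det≈det {zero}  M = R.trans (det-nil M) (R.sym (T.det-nil M))
    det≈det {suc n} M = begin
      det M                                                 ≈⟨ det-expand M ⟩
      sum (λ j → ((((- 1#) ^ toℕ j) * M zero j) * det (T.minor M j)))
                                                            ≈⟨ ∑≈sum _ ⟨
      ∑ (λ j → ((((- 1#) ^ toℕ j) * M zero j) * det (T.minor M j)))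
                                                            ≈⟨ T.∑-cong (λ j → R.*-cong (R.*-congʳ (R.sym (^≈^ (- 1#) (toℕ j))))
                                                                                          (det≈det (T.minor M j))) ⟩
      ∑ (λ j → ((T.sign j * M zero j) * T.det (T.minor M j)))
                                                            ≈⟨ T.det-expand M ⟨
      T.det M                                               ∎

  closedWalks≈powerSum : ∀ {n} (a : Fin n → Fin n → ℕ) (A : Fin n → Fin n → C) →
    (∀ i j → A i j ≈ nat (a i j)) → (λs : Vector C n) →
    (xI-A : C → Fin n → Fin n → C) → (∀ x i j → xI-A x i j ≈ ((if does (i Fin.≟ j) then x else 0#) - A i j)) →
    (∀ x → det (xI-A x) ≈ product (λ i → x - λs i)) →
    ∀ m → nat (closedWalks a (suc m)) ≈ sum λ i → λs i ^ suc m
  closedWalks≈powerSum a A A≈a λs xI-A xI-A-def factors m = begin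
    nat (closedWalks a (suc m))
      ≈⟨ ι≈nat (closedWalks a (suc m)) ⟨
    T.ι (closedWalks a (suc m))
      ≈⟨ T.ι-closedWalks a A (λ i j → R.trans (A≈a i j) (R.sym (ι≈nat (a i j)))) (suc m) ⟩
    T.tracePow A (suc m)
      ≈⟨ T.tracePow-spectrum (λ k → proj₁ (recip k) , R.trans (R.*-congˡ (ι≈nat (suc k))) (proj₂ (recip k)))
           A λs charPoly m ⟩
    ∑ (λ i → λs i ^ᴿ suc m)
      ≈⟨ T.∑-cong (λ i → ^≈^ (λs i) (suc m)) ⟩
    ∑ (λ i → λs i ^ suc m)
      ≈⟨ ∑≈sum (λ i → λs i ^ suc m) ⟩
    sum (λ i → λs i ^ suc m) ∎
    where
    scalar : ∀ x b → (x * (if b then 1# else 0#)) ≈ (if b then x else 0#)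
    scalar x true  = R.*-identityʳ x
    scalar x false = R.zeroʳ x
    charPoly : ∀ x → T.det (λ i j → (x * T.unit i j) + (- A i j)) ≈ productᴿ (λ i → x + (- λs i))
    charPoly x = begin
      T.det (λ i j → (x * T.unit i j) + (- A i j))
        ≈⟨ T.det-cong (λ i j → R.trans (R.+-congʳ (scalar x (does (i Fin.≟ j)))) (R.sym (R.trans (xI-A-def x i j) (sub-def _ _)))) ⟩
      T.det (xI-A x)
        ≈⟨ det≈det (xI-A x) ⟨
      det (xI-A x)
        ≈⟨ factors x ⟩
      product (λ i → x - λs i)
        ≈⟨ product≈product _ ⟩
      productᴿ (λ i → x - λs i)
        ≈⟨ T.product-cong (λ i → sub-def x (λs i)) ⟩
      productᴿ (λ i → x + (- λs i)) ∎

open import Defs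

-- The ordered ring of Cauchy reals.

half : ∀ ε → ½ ℚ.* ε ℚ.+ ½ ℚ.* ε ≡ ε
half ε = ≡.trans (≡.sym (ℚ.*-distribʳ-+ ε ½ ½)) (ℚ.*-identityˡ ε)

0<* : ∀ {p q} → 0ℚ ℚ.< p → 0ℚ ℚ.< q → 0ℚ ℚ.< p ℚ.* q
0<* {p} {q} 0<p 0<q = ℚ.positive⁻¹ (p ℚ.* q) {{ℚ.pos*pos⇒pos p {{ℚ.positive 0<p}} q {{ℚ.positive 0<q}}}}

0<half : ∀ {ε} → 0ℚ ℚ.< ε → 0ℚ ℚ.< ½ ℚ.* ε
0<half = 0<* (ℚ.positive⁻¹ ½)

∣p-p∣≡0 : ∀ p → ℚ.∣ p ℚ.- p ∣ ≡ 0ℚ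
∣p-p∣≡0 p = ≡.cong ℚ.∣_∣ (ℚ.+-inverseʳ p)

∣p-q∣-sym : ∀ p q → ℚ.∣ p ℚ.- q ∣ ≡ ℚ.∣ q ℚ.- p ∣
∣p-q∣-sym p q = ≡.trans (≡.sym (ℚ.∣-p∣≡∣p∣ (p ℚ.- q))) (≡.cong ℚ.∣_∣
  (solve 2 (λ p q → :- (p :- q) := q :- p) ≡.refl p q))
  where open ℚ.+-*-Solver

p≤∣p∣ : ∀ p → p ℚ.≤ ℚ.∣ p ∣
p≤∣p∣ p with ℚ.≤-total 0ℚ p
... | inj₁ h = ℚ.≤-reflexive (≡.sym (ℚ.0≤p⇒∣p∣≡p h))
... | inj₂ h = ℚ.≤-trans h (ℚ.0≤∣p∣ p)

∣p-q∣≤ε⇒p≤ε+q : ∀ {p q ε} → ℚ.∣ p ℚ.- q ∣ ℚ.≤ ε → p ℚ.≤ ε ℚ.+ q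
∣p-q∣≤ε⇒p≤ε+q {p} {q} {ε} h = ≡.subst (ℚ._≤ ε ℚ.+ q)
  (solve 2 (λ p q → p :- q :+ q := p) ≡.refl p q)
  (ℚ.+-monoˡ-≤ q (ℚ.≤-trans (p≤∣p∣ (p ℚ.- q)) h))
  where open ℚ.+-*-Solver

-- Through this the ring laws of ℚ pass to ℝ term by term; ε arguments remain for symmetry,
-- transitivity and the congruence laws.
pointwise-≃ : ∀ {x y} → (∀ n → seq x n ≡ seq y n) → x ≃ y
pointwise-≃ {x} {y} eq ε 0<ε = 0 , λ n _ → ≡.subst (λ z → ℚ.∣ seq x n ℚ.- z ∣ ℚ.≤ ε) (eq n)
  (ℚ.≤-trans (ℚ.≤-reflexive (∣p-p∣≡0 (seq x n))) (ℚ.<⇒≤ 0<ε))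

pointwise-≤ : ∀ {x y} → (∀ n → seq x n ℚ.≤ seq y n) → x ≤ y
pointwise-≤ {x} {y} le ε 0<ε = 0 , λ n _ → ℚ.≤-trans (le n)
  (≡.subst (ℚ._≤ ε ℚ.+ seq y n) (ℚ.+-identityˡ (seq y n)) (ℚ.+-monoˡ-≤ (seq y n) (ℚ.<⇒≤ 0<ε)))

≃-refl : ∀ {x} → x ≃ x
≃-refl {x} = pointwise-≃ {x} {x} λ _ → ≡.refl

≃-sym : ∀ {x y} → x ≃ y → y ≃ x
≃-sym {x} {y} x≃y ε 0<ε with x≃y ε 0<ε
... | N , h = N , λ n N≤n → ≡.subst (ℚ._≤ ε) (∣p-q∣-sym (seq x n) (seq y n)) (h n N≤n)

≃-trans : ∀ {x y z} → x ≃ y → y ≃ z → x ≃ z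
≃-trans {x} {y} {z} x≃y y≃z ε 0<ε with x≃y _ (0<half 0<ε) | y≃z _ (0<half 0<ε)
... | M , f | N , g = M ℕ.⊔ N , λ n M⊔N≤n → begin
  ℚ.∣ seq x n ℚ.- seq z n ∣
    ≡⟨ ≡.cong ℚ.∣_∣ (solve 3 (λ x y z → x :- z := (x :- y) :+ (y :- z)) ≡.refl (seq x n) (seq y n) (seq z n)) ⟩
  ℚ.∣ (seq x n ℚ.- seq y n) ℚ.+ (seq y n ℚ.- seq z n) ∣
    ≤⟨ ℚ.∣p+q∣≤∣p∣+∣q∣ (seq x n ℚ.- seq y n) (seq y n ℚ.- seq z n) ⟩
  ℚ.∣ seq x n ℚ.- seq y n ∣ ℚ.+ ℚ.∣ seq y n ℚ.- seq z n ∣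
    ≤⟨ ℚ.+-mono-≤ (f n (ℕ.m⊔n≤o⇒m≤o M N M⊔N≤n)) (g n (ℕ.m⊔n≤o⇒n≤o M N M⊔N≤n)) ⟩
  ½ ℚ.* ε ℚ.+ ½ ℚ.* ε
    ≡⟨ half ε ⟩
  ε ∎
  where
  open ℚ.≤-Reasoning
  open ℚ.+-*-Solver

+-cong : ∀ {x y u v} → x ≃ y → u ≃ v → x + u ≃ y + v
+-cong {x} {y} {u} {v} x≃y u≃v ε 0<ε with x≃y _ (0<half 0<ε) | u≃v _ (0<half 0<ε)
... | M , f | N , g = M ℕ.⊔ N , λ n M⊔N≤n → begin
  ℚ.∣ seq x n ℚ.+ seq u n ℚ.- (seq y n ℚ.+ seq v n) ∣
    ≡⟨ ≡.cong ℚ.∣_∣ (solve 4 (λ x u y v → x :+ u :- (y :+ v) := (x :- y) :+ (u :- v)) ≡.refl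
                       (seq x n) (seq u n) (seq y n) (seq v n)) ⟩
  ℚ.∣ (seq x n ℚ.- seq y n) ℚ.+ (seq u n ℚ.- seq v n) ∣
    ≤⟨ ℚ.∣p+q∣≤∣p∣+∣q∣ (seq x n ℚ.- seq y n) (seq u n ℚ.- seq v n) ⟩
  ℚ.∣ seq x n ℚ.- seq y n ∣ ℚ.+ ℚ.∣ seq u n ℚ.- seq v n ∣
    ≤⟨ ℚ.+-mono-≤ (f n (ℕ.m⊔n≤o⇒m≤o M N M⊔N≤n)) (g n (ℕ.m⊔n≤o⇒n≤o M N M⊔N≤n)) ⟩
  ½ ℚ.* ε ℚ.+ ½ ℚ.* ε
    ≡⟨ half ε ⟩
  ε ∎
  where
  open ℚ.≤-Reasoning
  open ℚ.+-*-Solver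

-‿cong : ∀ {x y} → x ≃ y → - x ≃ - y
-‿cong {x} {y} x≃y ε 0<ε with x≃y ε 0<ε
... | N , h = N , λ n N≤n → ≡.subst (ℚ._≤ ε)
  (≡.trans (∣p-q∣-sym (seq x n) (seq y n)) (≡.cong ℚ.∣_∣
    (solve 2 (λ x y → y :- x := :- x :- :- y) ≡.refl (seq x n) (seq y n))))
  (h n N≤n)
  where open ℚ.+-*-Solver

eventually-bounded : ∀ x → ∃ λ K → 0ℚ ℚ.< K × ∃ λ N → ∀ n → N ℕ.≤ n → ℚ.∣ seq x n ∣ ℚ.≤ K
eventually-bounded x with cauchy x 1ℚ (ℚ.positive⁻¹ 1ℚ)
... | N , h = 1ℚ ℚ.+ ℚ.∣ seq x N ∣ , ℚ.+-mono-<-≤ (ℚ.positive⁻¹ 1ℚ) (ℚ.0≤∣p∣ (seq x N)) , N , λ n N≤n → begin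
  ℚ.∣ seq x n ∣
    ≡⟨ ≡.cong ℚ.∣_∣ (solve 2 (λ x y → x := (x :- y) :+ y) ≡.refl (seq x n) (seq x N)) ⟩
  ℚ.∣ (seq x n ℚ.- seq x N) ℚ.+ seq x N ∣
    ≤⟨ ℚ.∣p+q∣≤∣p∣+∣q∣ (seq x n ℚ.- seq x N) (seq x N) ⟩
  ℚ.∣ seq x n ℚ.- seq x N ∣ ℚ.+ ℚ.∣ seq x N ∣
    ≤⟨ ℚ.+-monoˡ-≤ ℚ.∣ seq x N ∣ (h n N N≤n ℕ.≤-refl) ⟩
  1ℚ ℚ.+ ℚ.∣ seq x N ∣ ∎
  where
  open ℚ.≤-Reasoning
  open ℚ.+-*-Solver

inverse-pos : ∀ {K} → 0ℚ ℚ.< K → ∃ λ i → 0ℚ ℚ.< i × K ℚ.* i ≡ 1ℚ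
inverse-pos {K} 0<K = (ℚ.1/ K) {{nonZero}} , ℚ.positive⁻¹ ((ℚ.1/ K) {{nonZero}}) {{ℚ.1/pos⇒pos K {{ℚ.positive 0<K}}}} , ℚ.*-inverseʳ K {{nonZero}}
  where
  nonZero : ℚ.NonZero K
  nonZero = ℚ.pos⇒nonZero K {{ℚ.positive 0<K}}

*-bound : ∀ {p q r K i ε} → K ℚ.* i ≡ 1ℚ → 0ℚ ℚ.< K → ℚ.∣ r ∣ ℚ.≤ K → ℚ.∣ p ℚ.- q ∣ ℚ.≤ i ℚ.* ε →
          ℚ.∣ p ℚ.* r ℚ.- q ℚ.* r ∣ ℚ.≤ ε
*-bound {p} {q} {r} {K} {i} {ε} K*i≡1 0<K ∣r∣≤K p≈q = begin
  ℚ.∣ p ℚ.* r ℚ.- q ℚ.* r ∣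
    ≡⟨ ≡.cong ℚ.∣_∣ (solve 3 (λ p q r → p :* r :- q :* r := (p :- q) :* r) ≡.refl p q r) ⟩
  ℚ.∣ (p ℚ.- q) ℚ.* r ∣
    ≡⟨ ℚ.∣p*q∣≡∣p∣*∣q∣ (p ℚ.- q) r ⟩
  ℚ.∣ p ℚ.- q ∣ ℚ.* ℚ.∣ r ∣
    ≤⟨ ℚ.*-monoˡ-≤-nonNeg ℚ.∣ p ℚ.- q ∣ {{ℚ.∣-∣-nonNeg (p ℚ.- q)}} ∣r∣≤K ⟩
  ℚ.∣ p ℚ.- q ∣ ℚ.* K
    ≤⟨ ℚ.*-monoʳ-≤-nonNeg K {{ℚ.nonNegative (ℚ.<⇒≤ 0<K)}} p≈q ⟩
  i ℚ.* ε ℚ.* K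
    ≡⟨ ≡.trans (ℚ.*-comm (i ℚ.* ε) K) (≡.sym (ℚ.*-assoc K i ε)) ⟩
  K ℚ.* i ℚ.* ε
    ≡⟨ ≡.cong (ℚ._* ε) K*i≡1 ⟩
  1ℚ ℚ.* ε
    ≡⟨ ℚ.*-identityˡ ε ⟩
  ε ∎
  where
  open ℚ.≤-Reasoning
  open ℚ.+-*-Solver

*-congʳ : ∀ {x y z} → x ≃ y → x * z ≃ y * z
*-congʳ {x} {y} {z} x≃y ε 0<ε =
  let K , 0<K , M , bound = eventually-bounded z
      i , 0<i , K*i≡1     = inverse-pos 0<K
      N , h               = x≃y (i ℚ.* ε) (0<* 0<i 0<ε)
  in M ℕ.⊔ N , λ n M⊔N≤n →
     *-bound {seq x n} {seq y n} {seq z n} K*i≡1 0<K (bound n (ℕ.m⊔n≤o⇒m≤o M N M⊔N≤n)) (h n (ℕ.m⊔n≤o⇒n≤o M N M⊔N≤n))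

*-comm : ∀ x y → x * y ≃ y * x
*-comm x y = pointwise-≃ {x * y} {y * x} λ n → ℚ.*-comm (seq x n) (seq y n)

*-cong : ∀ {x y u v} → x ≃ y → u ≃ v → x * u ≃ y * v
*-cong {x} {y} {u} {v} x≃y u≃v = ≃-trans {x * u} {y * u} {y * v} (*-congʳ {x} {y} {u} x≃y)
  (≃-trans {y * u} {u * y} {y * v} (*-comm y u)
  (≃-trans {u * y} {v * y} {y * v} (*-congʳ {u} {v} {y} u≃v) (*-comm v y)))

ℝ-isCommutativeRing : IsCommutativeRing _≃_ _+_ _*_ -_ 0# 1#
ℝ-isCommutativeRing = record
  { isRing = record
    { +-isAbelianGroup = record
      { isGroup = record
        { isMonoid = record
          { isSemigroup = record
            { isMagma = record
              { isEquivalence = record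
                { refl  = λ {x} → ≃-refl {x}
                ; sym   = λ {x} {y} → ≃-sym {x} {y}
                ; trans = λ {x} {y} {z} → ≃-trans {x} {y} {z} }
              ; ∙-cong = λ {x} {y} {u} {v} → +-cong {x} {y} {u} {v} }
            ; assoc = λ x y z → pointwise-≃ {x + y + z} {x + (y + z)} λ n → ℚ.+-assoc (seq x n) (seq y n) (seq z n) }
          ; identity = (λ x → pointwise-≃ {0# + x} {x} λ n → ℚ.+-identityˡ (seq x n))
                     , (λ x → pointwise-≃ {x + 0#} {x} λ n → ℚ.+-identityʳ (seq x n)) }
        ; inverse = (λ x → pointwise-≃ { - x + x} {0#} λ n → ℚ.+-inverseˡ (seq x n))
                  , (λ x → pointwise-≃ {x + - x} {0#} λ n → ℚ.+-inverseʳ (seq x n))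
        ; ⁻¹-cong = λ {x} {y} → -‿cong {x} {y} }
      ; comm = λ x y → pointwise-≃ {x + y} {y + x} λ n → ℚ.+-comm (seq x n) (seq y n) }
    ; *-cong = λ {x} {y} {u} {v} → *-cong {x} {y} {u} {v}
    ; *-assoc = λ x y z → pointwise-≃ {x * y * z} {x * (y * z)} λ n → ℚ.*-assoc (seq x n) (seq y n) (seq z n)
    ; *-identity = (λ x → pointwise-≃ {1# * x} {x} λ n → ℚ.*-identityˡ (seq x n))
                 , (λ x → pointwise-≃ {x * 1#} {x} λ n → ℚ.*-identityʳ (seq x n))
    ; distrib = (λ x y z → pointwise-≃ {x * (y + z)} {x * y + x * z} λ n → ℚ.*-distribˡ-+ (seq x n) (seq y n) (seq z n))
              , (λ x y z → pointwise-≃ {(y + z) * x} {y * x + z * x} λ n → ℚ.*-distribʳ-+ (seq x n) (seq y n) (seq z n))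
    }
  ; *-comm = *-comm }

≤-trans : ∀ {x y z} → x ≤ y → y ≤ z → x ≤ z
≤-trans {x} {y} {z} x≤y y≤z ε 0<ε with x≤y _ (0<half 0<ε) | y≤z _ (0<half 0<ε)
... | M , f | N , g = M ℕ.⊔ N , λ n M⊔N≤n → begin
  seq x n                               ≤⟨ f n (ℕ.m⊔n≤o⇒m≤o M N M⊔N≤n) ⟩
  ½ ℚ.* ε ℚ.+ seq y n                   ≤⟨ ℚ.+-monoʳ-≤ (½ ℚ.* ε) (g n (ℕ.m⊔n≤o⇒n≤o M N M⊔N≤n)) ⟩
  ½ ℚ.* ε ℚ.+ (½ ℚ.* ε ℚ.+ seq z n)     ≡⟨ ≡.sym (ℚ.+-assoc (½ ℚ.* ε) (½ ℚ.* ε) (seq z n)) ⟩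
  ½ ℚ.* ε ℚ.+ ½ ℚ.* ε ℚ.+ seq z n       ≡⟨ ≡.cong (ℚ._+ seq z n) (half ε) ⟩
  ε ℚ.+ seq z n                         ∎
  where open ℚ.≤-Reasoning

≃⇒≤ : ∀ {x y} → x ≃ y → x ≤ y
≃⇒≤ x≃y ε 0<ε with x≃y ε 0<ε
... | N , h = N , λ n N≤n → ∣p-q∣≤ε⇒p≤ε+q (h n N≤n)

+-mono-≤ : ∀ {x y u v} → x ≤ y → u ≤ v → x + u ≤ y + v
+-mono-≤ {x} {y} {u} {v} x≤y u≤v ε 0<ε with x≤y _ (0<half 0<ε) | u≤v _ (0<half 0<ε)
... | M , f | N , g = M ℕ.⊔ N , λ n M⊔N≤n → begin
  seq x n ℚ.+ seq u n
    ≤⟨ ℚ.+-mono-≤ (f n (ℕ.m⊔n≤o⇒m≤o M N M⊔N≤n)) (g n (ℕ.m⊔n≤o⇒n≤o M N M⊔N≤n)) ⟩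
  ½ ℚ.* ε ℚ.+ seq y n ℚ.+ (½ ℚ.* ε ℚ.+ seq v n)
    ≡⟨ solve 3 (λ h y v → h :+ y :+ (h :+ v) := (h :+ h) :+ (y :+ v)) ≡.refl (½ ℚ.* ε) (seq y n) (seq v n) ⟩
  (½ ℚ.* ε ℚ.+ ½ ℚ.* ε) ℚ.+ (seq y n ℚ.+ seq v n)
    ≡⟨ ≡.cong (ℚ._+ (seq y n ℚ.+ seq v n)) (half ε) ⟩
  ε ℚ.+ (seq y n ℚ.+ seq v n) ∎
  where
  open ℚ.≤-Reasoning
  open ℚ.+-*-Solver

nat : ℕ → ℚ
nat n = + n ℚ./ 1

toℚᵘ-nat : ∀ n → ℚ.toℚᵘ (nat n) ℚᵘ.≃ ℚᵘ.mkℚᵘ (+ n) 0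
toℚᵘ-nat n = ℚ.toℚᵘ-fromℚᵘ (ℚᵘ.mkℚᵘ (+ n) 0)

nat-+ : ∀ m n → nat (m ℕ.+ n) ≡ nat m ℚ.+ nat n
nat-+ m n = ℚ.toℚᵘ-injective (begin
  ℚ.toℚᵘ (nat (m ℕ.+ n))                    ≈⟨ toℚᵘ-nat (m ℕ.+ n) ⟩
  ℚᵘ.mkℚᵘ (+ (m ℕ.+ n)) 0                   ≈⟨ ℚᵘ.*≡* (≡.cong (ℤ._* ℤ.1ℤ) (≡.sym
                                                 (≡.cong₂ ℤ._+_ (ℤ.*-identityʳ (+ m)) (ℤ.*-identityʳ (+ n))))) ⟩
  ℚᵘ.mkℚᵘ (+ m) 0 ℚᵘ.+ ℚᵘ.mkℚᵘ (+ n) 0      ≈⟨ ℚᵘ.+-cong (ℚᵘ.≃-sym (toℚᵘ-nat m)) (ℚᵘ.≃-sym (toℚᵘ-nat n)) ⟩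
  ℚ.toℚᵘ (nat m) ℚᵘ.+ ℚ.toℚᵘ (nat n)        ≈⟨ ℚᵘ.≃-sym (ℚ.toℚᵘ-homo-+ (nat m) (nat n)) ⟩
  ℚ.toℚᵘ (nat m ℚ.+ nat n)                  ∎)
  where open import Relation.Binary.Reasoning.Setoid ℚᵘ.≃-setoid

nat-* : ∀ m n → nat (m ℕ.* n) ≡ nat m ℚ.* nat n
nat-* m n = ℚ.toℚᵘ-injective (begin
  ℚ.toℚᵘ (nat (m ℕ.* n))                    ≈⟨ toℚᵘ-nat (m ℕ.* n) ⟩
  ℚᵘ.mkℚᵘ (+ (m ℕ.* n)) 0                   ≈⟨ ℚᵘ.*≡* (≡.cong (ℤ._* ℤ.1ℤ) (ℤ.pos-* m n)) ⟩
  ℚᵘ.mkℚᵘ (+ m) 0 ℚᵘ.* ℚᵘ.mkℚᵘ (+ n) 0      ≈⟨ ℚᵘ.*-cong (ℚᵘ.≃-sym (toℚᵘ-nat m)) (ℚᵘ.≃-sym (toℚᵘ-nat n)) ⟩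
  ℚ.toℚᵘ (nat m) ℚᵘ.* ℚ.toℚᵘ (nat n)        ≈⟨ ℚᵘ.≃-sym (ℚ.toℚᵘ-homo-* (nat m) (nat n)) ⟩
  ℚ.toℚᵘ (nat m ℚ.* nat n)                  ∎)
  where open import Relation.Binary.Reasoning.Setoid ℚᵘ.≃-setoid

/-mono-≤ : ∀ a b k l → a ℕ.* suc l ℕ.≤ b ℕ.* suc k → + a ℚ./ suc k ℚ.≤ + b ℚ./ suc l
/-mono-≤ a b k l h = ℚ.toℚᵘ-cancel-≤ (begin
  ℚ.toℚᵘ (+ a ℚ./ suc k)  ≃⟨ ℚ.toℚᵘ-fromℚᵘ (ℚᵘ.mkℚᵘ (+ a) k) ⟩
  ℚᵘ.mkℚᵘ (+ a) k         ≤⟨ ℚᵘ.*≤* (≡.subst₂ ℤ._≤_ (ℤ.pos-* a (suc l)) (ℤ.pos-* b (suc k)) (ℤ.+≤+ h)) ⟩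
  ℚᵘ.mkℚᵘ (+ b) l         ≃⟨ ℚᵘ.≃-sym (ℚ.toℚᵘ-fromℚᵘ (ℚᵘ.mkℚᵘ (+ b) l)) ⟩
  ℚ.toℚᵘ (+ b ℚ./ suc l)  ∎)
  where open ℚᵘ.≤-Reasoning

nat-mono : ∀ {m n} → m ℕ.≤ n → nat m ℚ.≤ nat n
nat-mono {m} {n} m≤n = /-mono-≤ m n 0 0 (ℕ.*-monoˡ-≤ 1 m≤n)

0≤nat : ∀ n → 0ℚ ℚ.≤ nat n
0≤nat n = nat-mono {0} {n} ℕ.z≤n

0<nat : ∀ n → 0ℚ ℚ.< nat (suc n)
0<nat n = ℚ.positive⁻¹ (nat (suc n)) {{ℚ.normalize-pos (suc n) 1}}

fromℕ-suc : ∀ n → 1# + fromℕ n ≃ fromℕ (suc n)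
fromℕ-suc n = pointwise-≃ {1# + fromℕ n} {fromℕ (suc n)} λ _ → ≡.sym (nat-+ 1 n)

recip : ∀ k → ∃ λ c → c * fromℕ (suc k) ≃ 1#
recip k = let i , _ , eq = inverse-pos (0<nat k) in
  fromℚ i , pointwise-≃ {fromℚ i * fromℕ (suc k)} {1#} λ _ → ≡.trans (ℚ.*-comm i (nat (suc k))) eq

-- Power sums of the eigenvalues as closed walk counts

adjacency : ∀ {n} → Graph n → Fin n → Fin n → ℕ
adjacency G i j = if does (Graph._~?_ G i j) then 1 else 0

private
  module W = ClosedWalks {C = ℝ} {_≃_} {_+_} {_*_} { -_} {0#} {1#} ℝ-isCommutativeRing
    fromℕ (≃-refl {0#}) (λ n → ≃-sym {1# + fromℕ n} {fromℕ (suc n)} (fromℕ-suc n)) recip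
    _-_ (λ x y → pointwise-≃ {x - y} {x + - y} λ _ → ≡.refl)
    _^_ (λ x → ≃-refl {1#}) (λ x k → pointwise-≃ {x ^ suc k} {x * x ^ k} λ _ → ≡.refl)
    sum (λ f → ≃-refl {0#}) (λ f → pointwise-≃ {sum f} {f zero + sum (f ∘ suc)} λ _ → ≡.refl)
    product (λ f → ≃-refl {1#}) (λ f → pointwise-≃ {product f} {f zero * product (f ∘ suc)} λ _ → ≡.refl)
    det (λ M → ≃-refl {1#})
    (λ M → pointwise-≃ {det M} {sum λ j → (- 1#) ^ toℕ j * M zero j * det λ i → removeAt (M (suc i)) j}
             λ _ → ≡.refl)

adjacency≃ : ∀ {n} (G : Graph n) i j → adjacencyMatrix G i j ≃ fromℕ (adjacency G i j)
adjacency≃ G i j = pointwise-≃ {adjacencyMatrix G i j} {fromℕ (adjacency G i j)}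
  λ k → if-nat (does (Graph._~?_ G i j)) k
  where
  if-nat : ∀ b k → seq (if b then 1# else 0#) k ≡ nat (if b then 1 else 0)
  if-nat true  k = ≡.refl
  if-nat false k = ≡.refl

powerSum≃closedWalks : ∀ {n} (G : Graph n) (λs : Vector ℝ n) → IsSpectrum (adjacencyMatrix G) λs →
  ∀ m → sum (λ i → λs i ^ suc m) ≃ fromℕ (closedWalks (adjacency G) (suc m))
powerSum≃closedWalks {n} G λs spectrum m =
    ≃-sym {fromℕ (closedWalks (adjacency G) (suc m))} {sum (λ i → λs i ^ suc m)}
      (W.closedWalks≈powerSum (adjacency G) (adjacencyMatrix G) (adjacency≃ G) λs
        (λ x i j → scalarMatrix x i j - adjacencyMatrix G i j)
        (λ x i j → pointwise-≃ {scalarMatrix x i j - adjacencyMatrix G i j}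
          {(if does (i Fin.≟ j) then x else 0#) - adjacencyMatrix G i j} λ _ → ≡.refl)
        (IsSpectrum.factors {M = adjacencyMatrix G} {λs} spectrum) m)

-- The cubic inequality and its sum over a spectrum

¼ ¾ : ℚ
¼ = + 1 ℚ./ 4
¾ = + 3 ℚ./ 4

0≤* : ∀ {p q} → 0ℚ ℚ.≤ p → 0ℚ ℚ.≤ q → 0ℚ ℚ.≤ p ℚ.* q
0≤* {p} {q} 0≤p 0≤q = ℚ.nonNegative⁻¹ (p ℚ.* q)
  {{ℚ.nonNeg*nonNeg⇒nonNeg p {{ℚ.nonNegative 0≤p}} q {{ℚ.nonNegative 0≤q}}}}

0≤+ : ∀ {p q} → 0ℚ ℚ.≤ p → 0ℚ ℚ.≤ q → 0ℚ ℚ.≤ p ℚ.+ q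
0≤+ {p} {q} 0≤p 0≤q = ≡.subst (ℚ._≤ p ℚ.+ q) (ℚ.+-identityˡ 0ℚ) (ℚ.+-mono-≤ 0≤p 0≤q)

0≤square : ∀ p → 0ℚ ℚ.≤ p ℚ.* p
0≤square p with ℚ.≤-total 0ℚ p
... | inj₁ 0≤p = 0≤* 0≤p 0≤p
... | inj₂ p≤0 = ≡.subst (0ℚ ℚ.≤_) (solve 1 (λ p → :- p :* :- p := p :* p) ≡.refl p)
                   (0≤* (ℚ.neg-antimono-≤ p≤0) (ℚ.neg-antimono-≤ p≤0))
  where open ℚ.+-*-Solver

≤-by-difference : ∀ {p q} d → 0ℚ ℚ.≤ d → q ≡ p ℚ.+ d → p ℚ.≤ q
≤-by-difference {p} d 0≤d ≡.refl = ≡.subst (ℚ._≤ p ℚ.+ d) (ℚ.+-identityʳ p) (ℚ.+-monoʳ-≤ p 0≤d)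

0≤q-p : ∀ {p q} → p ℚ.≤ q → 0ℚ ℚ.≤ q ℚ.- p
0≤q-p {p} {q} p≤q = ≡.subst (ℚ._≤ q ℚ.- p) (ℚ.+-inverseʳ p) (ℚ.+-monoˡ-≤ (ℚ.- p) p≤q)

cube : ℚ → ℚ
cube p = p ℚ.* (p ℚ.* (p ℚ.* 1ℚ))

-- With z = ∣ x ∣ this is 3 z² s ≤ 2 z³ + s³, that is, 0 ≤ (s − z)² (s + 2 z).
young : ∀ x s → 0ℚ ℚ.≤ s →
  ¾ ℚ.* (x ℚ.* x) ℚ.* s ℚ.- ¼ ℚ.* (s ℚ.* s ℚ.* s) ℚ.+ ½ ℚ.* cube x ℚ.≤ cube (x ℚ.⊔ 0ℚ)
young x s 0≤s = case (ℚ.≤-total 0ℚ x)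
  where
  open ℚ.+-*-Solver
  case : (0ℚ ℚ.≤ x) ⊎ (x ℚ.≤ 0ℚ) →
    ¾ ℚ.* (x ℚ.* x) ℚ.* s ℚ.- ¼ ℚ.* (s ℚ.* s ℚ.* s) ℚ.+ ½ ℚ.* cube x ℚ.≤ cube (x ℚ.⊔ 0ℚ)
  case (inj₁ 0≤x) = ≤-by-difference (¼ ℚ.* ((s ℚ.- x) ℚ.* (s ℚ.- x)) ℚ.* (s ℚ.+ (x ℚ.+ x)))
    (0≤* (0≤* (ℚ.nonNegative⁻¹ ¼) (0≤square (s ℚ.- x))) (0≤+ 0≤s (0≤+ 0≤x 0≤x)))
    (≡.trans (≡.cong cube (ℚ.p≥q⇒p⊔q≡p 0≤x))
      (solve 2 (λ x s → x :* (x :* (x :* con 1ℚ)) :=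
        con ¾ :* (x :* x) :* s :- con ¼ :* (s :* s :* s) :+ con ½ :* (x :* (x :* (x :* con 1ℚ)))
        :+ con ¼ :* ((s :- x) :* (s :- x)) :* (s :+ (x :+ x))) ≡.refl x s))
  case (inj₂ x≤0) = ≤-by-difference (¼ ℚ.* ((s ℚ.+ x) ℚ.* (s ℚ.+ x)) ℚ.* (s ℚ.+ (ℚ.- x ℚ.+ ℚ.- x)))
    (0≤* (0≤* (ℚ.nonNegative⁻¹ ¼) (0≤square (s ℚ.+ x)))
         (0≤+ 0≤s (0≤+ (ℚ.neg-antimono-≤ x≤0) (ℚ.neg-antimono-≤ x≤0))))
    (≡.trans (≡.cong cube (ℚ.p≤q⇒p⊔q≡q x≤0))
      (solve 2 (λ x s → con 0ℚ :=
        con ¾ :* (x :* x) :* s :- con ¼ :* (s :* s :* s) :+ con ½ :* (x :* (x :* (x :* con 1ℚ)))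
        :+ con ¼ :* ((s :+ x) :* (s :+ x)) :* (s :+ (:- x :+ :- x))) ≡.refl x s))

-- The sum over λ of (3 λ² s − s³) / 4 + λ³ / 2 at s = r (u + v λ²), where N and
-- the Sₘ are the sums of the powers λᵐ and R = r².
lowerBound : (u v r R N S₂ S₃ S₄ S₆ : ℚ) → ℚ
lowerBound u v r R N S₂ S₃ S₄ S₆ =
  r ℚ.* (¾ ℚ.* (u ℚ.* S₂ ℚ.+ v ℚ.* S₄)
    ℚ.- R ℚ.* (¼ ℚ.* (u ℚ.* u ℚ.* u) ℚ.* N ℚ.+ ¾ ℚ.* (u ℚ.* u ℚ.* v) ℚ.* S₂
               ℚ.+ ¾ ℚ.* (u ℚ.* v ℚ.* v) ℚ.* S₄ ℚ.+ ¼ ℚ.* (v ℚ.* v ℚ.* v) ℚ.* S₆))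
  ℚ.+ ½ ℚ.* S₃

infixr 8 _^ℚ_
_^ℚ_ : ℚ → ℕ → ℚ
p ^ℚ zero  = 1ℚ
p ^ℚ suc k = p ℚ.* p ^ℚ k

sumℚ : ∀ {n} → Vector ℚ n → ℚ
sumℚ {zero}  f = 0ℚ
sumℚ {suc n} f = f zero ℚ.+ sumℚ (f ∘ suc)

-- `lowerBound` is linear in the count and the power sums together, so one summand splits off at a
-- time; its share is the left side of `young` at s = r (u + v x²).
cubes-lowerBound : ∀ {n} (u v r : ℚ) → 0ℚ ℚ.≤ u → 0ℚ ℚ.≤ v → 0ℚ ℚ.≤ r → (x : Vector ℚ n) →
  let S = λ m → sumℚ λ i → x i ^ℚ m in
  lowerBound u v r (r ℚ.* r) (nat n) (S 2) (S 3) (S 4) (S 6) ℚ.≤ sumℚ λ i → cube (x i ℚ.⊔ 0ℚ)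
cubes-lowerBound {zero} u v r 0≤u 0≤v 0≤r x = ℚ.≤-reflexive
  (solve 3 (λ u v r → r :* (con ¾ :* (u :* con 0ℚ :+ v :* con 0ℚ)
      :- r :* r :* (con ¼ :* (u :* u :* u) :* con 0ℚ :+ con ¾ :* (u :* u :* v) :* con 0ℚ
                    :+ con ¾ :* (u :* v :* v) :* con 0ℚ :+ con ¼ :* (v :* v :* v) :* con 0ℚ))
    :+ con ½ :* con 0ℚ := con 0ℚ) ≡.refl u v r)
  where open ℚ.+-*-Solver
cubes-lowerBound {suc n} u v r 0≤u 0≤v 0≤r x = begin
  lowerBound u v r R (nat (suc n)) (p 2 ℚ.+ S 2) (p 3 ℚ.+ S 3) (p 4 ℚ.+ S 4) (p 6 ℚ.+ S 6)
    ≡⟨ ≡.cong (λ N → lowerBound u v r R N (p 2 ℚ.+ S 2) (p 3 ℚ.+ S 3) (p 4 ℚ.+ S 4) (p 6 ℚ.+ S 6)) (nat-+ 1 n) ⟩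
  lowerBound u v r R (1ℚ ℚ.+ nat n) (p 2 ℚ.+ S 2) (p 3 ℚ.+ S 3) (p 4 ℚ.+ S 4) (p 6 ℚ.+ S 6)
    ≡⟨ additive 1ℚ (nat n) (p 2) (S 2) (p 3) (S 3) (p 4) (S 4) (p 6) (S 6) ⟩
  lowerBound u v r R 1ℚ (p 2) (p 3) (p 4) (p 6) ℚ.+ lowerBound u v r R (nat n) (S 2) (S 3) (S 4) (S 6)
    ≤⟨ ℚ.+-mono-≤ (ℚ.≤-trans (ℚ.≤-reflexive (single (x zero))) (young (x zero) s 0≤s))
                  (cubes-lowerBound u v r 0≤u 0≤v 0≤r (x ∘ suc)) ⟩
  cube (x zero ℚ.⊔ 0ℚ) ℚ.+ sumℚ (λ i → cube (x (suc i) ℚ.⊔ 0ℚ)) ∎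
  where
  open ℚ.≤-Reasoning
  open ℚ.+-*-Solver
  R : ℚ
  R = r ℚ.* r
  p S : ℕ → ℚ
  p m = x zero ^ℚ m
  S m = sumℚ λ i → x (suc i) ^ℚ m
  s : ℚ
  s = r ℚ.* (u ℚ.+ v ℚ.* (x zero ℚ.* x zero))
  0≤s : 0ℚ ℚ.≤ s
  0≤s = 0≤* 0≤r (0≤+ 0≤u (0≤* 0≤v (0≤square (x zero))))
  additive : ∀ N N′ a a′ b b′ c c′ d d′ →
    lowerBound u v r R (N ℚ.+ N′) (a ℚ.+ a′) (b ℚ.+ b′) (c ℚ.+ c′) (d ℚ.+ d′) ≡
    lowerBound u v r R N a b c d ℚ.+ lowerBound u v r R N′ a′ b′ c′ d′
  additive N N′ a a′ b b′ c c′ d d′ = solve 14 (λ u v r R N N′ a a′ b b′ c c′ d d′ →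
    let k₀ = con ¼ :* (u :* u :* u)
        k₂ = con ¾ :* (u :* u :* v)
        k₄ = con ¾ :* (u :* v :* v)
        k₆ = con ¼ :* (v :* v :* v)
        bound = λ N a b c d → r :* (con ¾ :* (u :* a :+ v :* c)
                  :- R :* (k₀ :* N :+ k₂ :* a :+ k₄ :* c :+ k₆ :* d)) :+ con ½ :* b
    in bound (N :+ N′) (a :+ a′) (b :+ b′) (c :+ c′) (d :+ d′) := bound N a b c d :+ bound N′ a′ b′ c′ d′)
    ≡.refl u v r R N N′ a a′ b b′ c c′ d d′
  single : ∀ x → let s = r ℚ.* (u ℚ.+ v ℚ.* (x ℚ.* x)) in
    lowerBound u v r R 1ℚ (x ^ℚ 2) (x ^ℚ 3) (x ^ℚ 4) (x ^ℚ 6) ≡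
    ¾ ℚ.* (x ℚ.* x) ℚ.* s ℚ.- ¼ ℚ.* (s ℚ.* s ℚ.* s) ℚ.+ ½ ℚ.* cube x
  single x = solve 4 (λ u v r x →
      r :* (con ¾ :* (u :* (x :* (x :* con 1ℚ)) :+ v :* (x :* (x :* (x :* (x :* con 1ℚ)))))
      :- r :* r :* (con ¼ :* (u :* u :* u) :* con 1ℚ :+ con ¾ :* (u :* u :* v) :* (x :* (x :* con 1ℚ))
                    :+ con ¾ :* (u :* v :* v) :* (x :* (x :* (x :* (x :* con 1ℚ))))
                    :+ con ¼ :* (v :* v :* v) :* (x :* (x :* (x :* (x :* (x :* (x :* con 1ℚ))))))))
      :+ con ½ :* (x :* (x :* (x :* con 1ℚ)))
      := con ¾ :* (x :* x) :* (r :* (u :+ v :* (x :* x)))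
         :- con ¼ :* (r :* (u :+ v :* (x :* x)) :* (r :* (u :+ v :* (x :* x))) :* (r :* (u :+ v :* (x :* x))))
         :+ con ½ :* (x :* (x :* (x :* con 1ℚ)))) ≡.refl u v r x

-- `R` is separate from `r` so that r² can be replaced by an exact integer while one factor `r`,
-- such as √5, remains.
lowerBoundℝ : (u v : ℚ) (r R : ℝ) (n : ℕ) (S₂ S₃ S₄ S₆ : ℝ) → ℝ
lowerBoundℝ u v r R n S₂ S₃ S₄ S₆ =
  r * (fromℚ ¾ * (fromℚ u * S₂ + fromℚ v * S₄)
    - R * (fromℚ (¼ ℚ.* (u ℚ.* u ℚ.* u)) * fromℕ n + fromℚ (¾ ℚ.* (u ℚ.* u ℚ.* v)) * S₂
           + fromℚ (¾ ℚ.* (u ℚ.* v ℚ.* v)) * S₄ + fromℚ (¼ ℚ.* (v ℚ.* v ℚ.* v)) * S₆))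
  + fromℚ ½ * S₃

module _ {c ℓ} {C : Set c} {_≈_ : Rel C ℓ} {_+_ _*_ : Op₂ C} { -_ : Op₁ C} {0# 1# : C}
  (isCommutativeRing : IsCommutativeRing _≈_ _+_ _*_ -_ 0# 1#) where
  private module R = IsCommutativeRing isCommutativeRing

  -- Over an abstract ring, so that the congruence is checked without unfolding Cauchy sequences.
  lowerBound-congruent : ∀ (_-_ : Op₂ C) → (∀ {x x′ y y′} → x ≈ x′ → y ≈ y′ → (x - y) ≈ (x′ - y′)) →
    ∀ r k u v l₀ n l₂ l₄ l₆ h {R R′ S₂ S₂′ S₃ S₃′ S₄ S₄′ S₆ S₆′} →
    R ≈ R′ → S₂ ≈ S₂′ → S₃ ≈ S₃′ → S₄ ≈ S₄′ → S₆ ≈ S₆′ →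
    ((r * ((k * ((u * S₂) + (v * S₄))) - (R * ((((l₀ * n) + (l₂ * S₂)) + (l₄ * S₄)) + (l₆ * S₆))))) + (h * S₃)) ≈
    ((r * ((k * ((u * S₂′) + (v * S₄′))) - (R′ * ((((l₀ * n) + (l₂ * S₂′)) + (l₄ * S₄′)) + (l₆ * S₆′))))) + (h * S₃′))
  lowerBound-congruent _-_ sub-cong r k u v l₀ n l₂ l₄ l₆ h R≈ S₂≈ S₃≈ S₄≈ S₆≈ = R.+-cong
    (R.*-congˡ (sub-cong
      (R.*-congˡ (R.+-cong (R.*-congˡ S₂≈) (R.*-congˡ S₄≈)))
      (R.*-cong R≈ (R.+-cong (R.+-cong (R.+-congˡ (R.*-congˡ S₂≈)) (R.*-congˡ S₄≈)) (R.*-congˡ S₆≈)))))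
    (R.*-congˡ S₃≈)

sub-cong : ∀ {x x′ y y′} → x ≃ x′ → y ≃ y′ → x - y ≃ x′ - y′
sub-cong {x} {x′} {y} {y′} x≃x′ y≃y′ = +-cong {x} {x′} { - y} { - y′} x≃x′ (-‿cong {y} {y′} y≃y′)

seq-sum : ∀ {n} (f : Vector ℝ n) k → seq (sum f) k ≡ sumℚ λ i → seq (f i) k
seq-sum {zero}  f k = ≡.refl
seq-sum {suc n} f k = ≡.cong (seq (f zero) k ℚ.+_) (seq-sum (f ∘ suc) k)

sumℚ-cong : ∀ {n} {f g : Vector ℚ n} → (∀ i → f i ≡ g i) → sumℚ f ≡ sumℚ g
sumℚ-cong {zero}  f≡g = ≡.refl
sumℚ-cong {suc n} f≡g = ≡.cong₂ ℚ._+_ (f≡g zero) (sumℚ-cong (f≡g ∘ suc))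

seq-^ : ∀ x m k → seq (x ^ m) k ≡ seq x k ^ℚ m
seq-^ x zero    k = ≡.refl
seq-^ x (suc m) k = ≡.cong (seq x k ℚ.*_) (seq-^ x m k)

powerSum : ∀ {n} → Vector ℝ n → ℕ → ℝ
powerSum λs m = sum λ i → λs i ^ m

seq-powerSum : ∀ {n} (λs : Vector ℝ n) m k → seq (powerSum λs m) k ≡ sumℚ λ i → seq (λs i) k ^ℚ m
seq-powerSum λs m k = ≡.trans (seq-sum (λ i → λs i ^ m) k) (sumℚ-cong λ i → seq-^ (λs i) m k)

seq-energy : ∀ {n} (λs : Vector ℝ n) k → seq (positive3Energy λs) k ≡ sumℚ λ i → cube (seq (λs i) k ℚ.⊔ 0ℚ)
seq-energy λs k = ≡.trans (seq-sum (λ i → (λs i ⁺) ^ 3) k) (sumℚ-cong λ i → seq-^ (λs i ⁺) 3 k)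

lowerBoundℝ≤energy : ∀ {n} (u v : ℚ) (r : ℝ) → 0ℚ ℚ.≤ u → 0ℚ ℚ.≤ v → (∀ k → 0ℚ ℚ.≤ seq r k) →
  (λs : Vector ℝ n) → let S = powerSum λs in
  lowerBoundℝ u v r (r * r) n (S 2) (S 3) (S 4) (S 6) ≤ positive3Energy λs
lowerBoundℝ≤energy {n} u v r 0≤u 0≤v 0≤r λs =
  pointwise-≤ {lowerBoundℝ u v r (r * r) n (S 2) (S 3) (S 4) (S 6)} {positive3Energy λs} λ k →
    ≡.subst₂ ℚ._≤_ (≡.sym (lhs k)) (≡.sym (seq-energy λs k))
      (cubes-lowerBound u v (seq r k) 0≤u 0≤v (0≤r k) λ i → seq (λs i) k)
  where
  S : ℕ → ℝ
  S = powerSum λs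
  Q : ℕ → ℕ → ℚ
  Q k m = sumℚ λ i → seq (λs i) k ^ℚ m
  lhs : ∀ k → seq (lowerBoundℝ u v r (r * r) n (S 2) (S 3) (S 4) (S 6)) k ≡
              lowerBound u v (seq r k) (seq r k ℚ.* seq r k) (nat n) (Q k 2) (Q k 3) (Q k 4) (Q k 6)
  lhs k = ≡.trans
    (≡.cong₂ (λ a b → lowerBound u v (seq r k) (seq r k ℚ.* seq r k) (nat n) a b (seq (S 4) k) (seq (S 6) k))
      (seq-powerSum λs 2 k) (seq-powerSum λs 3 k))
    (≡.cong₂ (λ a b → lowerBound u v (seq r k) (seq r k ℚ.* seq r k) (nat n) (Q k 2) (Q k 3) a b)
      (seq-powerSum λs 4 k) (seq-powerSum λs 6 k))

-- Energy bounds from closed walk counts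

module _ {n} (G : Graph n) (λs : Vector ℝ n) (spectrum : IsSpectrum (adjacencyMatrix G) λs) where

  private
    W : ℕ → ℕ
    W = closedWalks (adjacency G)

  -- The power sums equal walk counts only as reals, not approximation by approximation. Once they
  -- and r² are replaced, only `x` and `r` still depend on k, and a rational inequality for each k
  -- is left.
  ≤-energy : ∀ (x : ℝ) (u v : ℚ) (r : ℝ) (ρ : ℕ) → 0ℚ ℚ.≤ u → 0ℚ ℚ.≤ v → (∀ k → 0ℚ ℚ.≤ seq r k) →
    r * r ≃ fromℕ ρ →
    (∀ k → seq x k ℚ.≤ lowerBound u v (seq r k) (nat ρ) (nat n) (nat (W 2)) (nat (W 3)) (nat (W 4)) (nat (W 6))) →
    x ≤ positive3Energy λs
  ≤-energy x u v r ρ 0≤u 0≤v 0≤r r²≃ρ bound =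
    ≤-trans {x} {walkBound} {positive3Energy λs} (pointwise-≤ {x} {walkBound} bound)
      (≤-trans {walkBound} {eigenBound} {positive3Energy λs}
        (≃⇒≤ {walkBound} {eigenBound} (≃-sym {eigenBound} {walkBound}
          (lowerBound-congruent ℝ-isCommutativeRing _-_ (λ {x} {x′} {y} {y′} → sub-cong {x} {x′} {y} {y′})
            r (fromℚ ¾) (fromℚ u) (fromℚ v) (fromℚ (¼ ℚ.* (u ℚ.* u ℚ.* u))) (fromℕ n) (fromℚ (¾ ℚ.* (u ℚ.* u ℚ.* v)))
            (fromℚ (¾ ℚ.* (u ℚ.* v ℚ.* v))) (fromℚ (¼ ℚ.* (v ℚ.* v ℚ.* v))) (fromℚ ½)
            {r * r} {fromℕ ρ} {S 2} {fromℕ (W 2)} {S 3} {fromℕ (W 3)} {S 4} {fromℕ (W 4)} {S 6} {fromℕ (W 6)}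
            r²≃ρ (walk 1) (walk 2) (walk 3) (walk 5))))
        (lowerBoundℝ≤energy u v r 0≤u 0≤v 0≤r λs))
    where
    S : ℕ → ℝ
    S = powerSum λs
    walkBound eigenBound : ℝ
    walkBound  = lowerBoundℝ u v r (fromℕ ρ) n (fromℕ (W 2)) (fromℕ (W 3)) (fromℕ (W 4)) (fromℕ (W 6))
    eigenBound = lowerBoundℝ u v r (r * r) n (S 2) (S 3) (S 4) (S 6)
    walk : ∀ m → S (suc m) ≃ fromℕ (W (suc m))
    walk = powerSum≃closedWalks G λs spectrum

  0≤√ : ∀ m k → 0ℚ ℚ.≤ seq (√ m) k
  0≤√ m k = /-mono-≤ 0 (isqrt (m ℕ.* (suc k ℕ.* suc k))) 0 k ℕ.z≤n

  √5≤56/25 : ∀ k → seq (√ 5) k ℚ.≤ + 56 ℚ./ 25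
  √5≤56/25 k = /-mono-≤ a 56 k 24 (ℕ.≮⇒≥ λ lt → ℕ.<-irrefl ≡.refl (begin-strict
    56 ℕ.* suc k ℕ.* (56 ℕ.* suc k)     <⟨ ℕ.*-mono-< lt lt ⟩
    a ℕ.* 25 ℕ.* (a ℕ.* 25)             ≡⟨ solve 1 (λ a → a :* con 25 :* (a :* con 25) := con 625 :* (a :* a)) ≡.refl a ⟩
    625 ℕ.* (a ℕ.* a)                   ≤⟨ ℕ.*-monoʳ-≤ 625 (proj₁ (isqrt-spec (5 ℕ.* (suc k ℕ.* suc k)))) ⟩
    -- (56 / 25)² exceeds 5 by 11 / 625.
    625 ℕ.* (5 ℕ.* (suc k ℕ.* suc k))   ≤⟨ ℕ.m≤m+n _ (11 ℕ.* (suc k ℕ.* suc k)) ⟩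
    625 ℕ.* (5 ℕ.* (suc k ℕ.* suc k)) ℕ.+ 11 ℕ.* (suc k ℕ.* suc k)
                                        ≡⟨ solve 1 (λ k → con 625 :* (con 5 :* (k :* k)) :+ con 11 :* (k :* k)
                                             := con 56 :* k :* (con 56 :* k)) ≡.refl (suc k) ⟩
    56 ℕ.* suc k ℕ.* (56 ℕ.* suc k)     ∎))
    where
    open ℕ.≤-Reasoning
    open ℕ-Solver.+-*-Solver
    a : ℕ
    a = isqrt (5 ℕ.* (suc k ℕ.* suc k))

  nat-difference : ∀ {a b} → a ℕ.≤ b → 0ℚ ℚ.≤ nat b ℚ.- nat a
  nat-difference a≤b = 0≤q-p (nat-mono a≤b)

  -- With s = 13 / 10 the bound without its `W 3` term is (39 / 40) W 2 - (2197 / 4000) n, and by √5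
  -- ≤ 56 / 25 it is enough to reach (28 / 25) n. Multiplied by 4000 this is the hypothesis, with
  -- 6677 = 2197 + 4480.
  energy-manyEdges : 6677 ℕ.* n ℕ.≤ 3900 ℕ.* W 2 → √ 5 * fromℚ ½ * fromℕ n ≤ positive3Energy λs
  energy-manyEdges le = ≤-energy (√ 5 * fromℚ ½ * fromℕ n) (+ 13 ℚ./ 10) 0ℚ 1# 1 (ℚ.nonNegative⁻¹ (+ 13 ℚ./ 10)) (ℚ.≤-refl {0ℚ})
    (λ _ → ℚ.nonNegative⁻¹ 1ℚ) (pointwise-≃ {1# * 1#} {fromℕ 1} λ _ → ≡.refl)
    (λ k → ≤-by-difference
      (+ 1 ℚ./ 4000 ℚ.* (nat (3900 ℕ.* W 2) ℚ.- nat (6677 ℕ.* n)) ℚ.+ ½ ℚ.* (+ 56 ℚ./ 25 ℚ.- seq (√ 5) k) ℚ.* nat n ℚ.+ ½ ℚ.* nat (W 3))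
      (0≤+ (0≤+ (0≤* (ℚ.nonNegative⁻¹ (+ 1 ℚ./ 4000)) (nat-difference le))
                (0≤* (0≤* (ℚ.nonNegative⁻¹ ½) (0≤q-p (√5≤56/25 k))) (0≤nat n)))
           (0≤* (ℚ.nonNegative⁻¹ ½) (0≤nat (W 3))))
      (≡.trans
        (solve 6 (λ w N P₂ P₃ P₄ P₆ →
          let u = con (+ 13 ℚ./ 10)
              v = con 0ℚ
          in con 1ℚ :* (con ¾ :* (u :* P₂ :+ v :* P₄)
               :- con 1ℚ :* (con ¼ :* (u :* u :* u) :* N :+ con ¾ :* (u :* u :* v) :* P₂
                   :+ con ¾ :* (u :* v :* v) :* P₄ :+ con ¼ :* (v :* v :* v) :* P₆)) :+ con ½ :* P₃
          := w :* con ½ :* N :+ (con (+ 1 ℚ./ 4000) :* (con (nat 3900) :* P₂ :- con (nat 6677) :* N)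
               :+ con ½ :* (con (+ 56 ℚ./ 25) :- w) :* N :+ con ½ :* P₃))
          ≡.refl (seq (√ 5) k) (nat n) (nat (W 2)) (nat (W 3)) (nat (W 4)) (nat (W 6)))
        (≡.cong₂ (λ a b → seq (√ 5) k ℚ.* ½ ℚ.* nat n ℚ.+ (+ 1 ℚ./ 4000 ℚ.* (a ℚ.- b)
                    ℚ.+ ½ ℚ.* (+ 56 ℚ./ 25 ℚ.- seq (√ 5) k) ℚ.* nat n ℚ.+ ½ ℚ.* nat (W 3)))
          (≡.sym (nat-* 3900 (W 2))) (≡.sym (nat-* 6677 n)))))
    where open ℚ.+-*-Solver

  -- The choice s = (1 + λ²) / √5, which is exact on the eigenvalues of P 4.
  energy-fewEdges : 51 ℕ.* n ℕ.+ W 6 ℕ.≤ 12 ℕ.* (W 2 ℕ.+ W 4) → √ 5 * fromℚ ½ * fromℕ n ≤ positive3Energy λs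
  energy-fewEdges le = ≤-energy (√ 5 * fromℚ ½ * fromℕ n) (+ 1 ℚ./ 5) (+ 1 ℚ./ 5) (√ 5) 5
    (ℚ.nonNegative⁻¹ (+ 1 ℚ./ 5)) (ℚ.nonNegative⁻¹ (+ 1 ℚ./ 5)) (0≤√ 5) (√-square 5)
    (λ k → ≤-by-difference
      -- In units of √5 / 100, the bound without its `W 3` term is 12 (W 2 + W 4) - n - W 6, and the
      -- target is 50 n.
      (+ 1 ℚ./ 100 ℚ.* (seq (√ 5) k ℚ.* (nat (12 ℕ.* (W 2 ℕ.+ W 4)) ℚ.- nat (51 ℕ.* n ℕ.+ W 6))) ℚ.+ ½ ℚ.* nat (W 3))
      (0≤+ (0≤* (ℚ.nonNegative⁻¹ (+ 1 ℚ./ 100)) (0≤* (0≤√ 5 k) (nat-difference le)))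
           (0≤* (ℚ.nonNegative⁻¹ ½) (0≤nat (W 3))))
      (≡.trans
        (solve 6 (λ w N P₂ P₃ P₄ P₆ →
          let u = con (+ 1 ℚ./ 5)
          in w :* (con ¾ :* (u :* P₂ :+ u :* P₄)
               :- con (nat 5) :* (con ¼ :* (u :* u :* u) :* N :+ con ¾ :* (u :* u :* u) :* P₂
                   :+ con ¾ :* (u :* u :* u) :* P₄ :+ con ¼ :* (u :* u :* u) :* P₆)) :+ con ½ :* P₃
          := w :* con ½ :* N :+ (con (+ 1 ℚ./ 100) :* (w :* (con (nat 12) :* (P₂ :+ P₄) :- (con (nat 51) :* N :+ P₆)))
               :+ con ½ :* P₃))
          ≡.refl (seq (√ 5) k) (nat n) (nat (W 2)) (nat (W 3)) (nat (W 4)) (nat (W 6)))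
        (≡.cong₂ (λ a b → seq (√ 5) k ℚ.* ½ ℚ.* nat n ℚ.+ (+ 1 ℚ./ 100 ℚ.* (seq (√ 5) k ℚ.* (a ℚ.- b)) ℚ.+ ½ ℚ.* nat (W 3)))
          (≡.sym (≡.trans (nat-* 12 (W 2 ℕ.+ W 4)) (≡.cong (nat 12 ℚ.*_) (nat-+ (W 2) (W 4)))))
          (≡.sym (≡.trans (nat-+ (51 ℕ.* n) (W 6)) (≡.cong (ℚ._+ nat (W 6)) (nat-* 51 n)))))))
    where open ℚ.+-*-Solver

-- Rooted trees and their enumeration

closedWalks-cong : ∀ {n} {a b : Fin n → Fin n → ℕ} → (∀ i j → a i j ≡ b i j) → ∀ m → closedWalks a m ≡ closedWalks b m
closedWalks-cong {n} {a} {b} a≡b m = ℕΣ.sum-cong-≗ λ k → walks-cong m (λ _ → ≡.refl) k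
  where
  walks-cong : ∀ m {v u : Vector ℕ n} → (∀ i → v i ≡ u i) → ∀ i → walks a m v i ≡ walks b m u i
  walks-cong zero    v≡u = v≡u
  walks-cong (suc m) v≡u = walks-cong m λ i → ℕΣ.sum-cong-≗ λ j → ≡.cong₂ ℕ._*_ (a≡b i j) (v≡u j)

-- A tree on Fin (suc k) rooted at zero, given by the parents of the other vertices.

parentArcs : ∀ {k} → (Fin k → Fin (suc k)) → Fin (suc k) → Fin (suc k) → ℕ
parentArcs p zero    j = 0
parentArcs p (suc u) j = if does (p u Fin.≟ j) then 1 else 0

parentMatrix : ∀ {k} → (Fin k → Fin (suc k)) → Fin (suc k) → Fin (suc k) → ℕ
parentMatrix p i j = parentArcs p i j ℕ.+ parentArcs p j i

ascend : ∀ {k} → (Fin k → Fin (suc k)) → Fin (suc k) → Fin (suc k)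
ascend p zero    = zero
ascend p (suc u) = p u

ascend^ : ∀ {k} → (Fin k → Fin (suc k)) → ℕ → Fin (suc k) → Fin (suc k)
ascend^ p zero    v = v
ascend^ p (suc m) v = ascend^ p m (ascend p v)

-- Tabulation keeps the evaluation of the checks below from recomputing
-- intermediate vectors.
memo : ∀ {a} {A : Set a} {n} → Vector A n → Vector A n
memo f = Vec.lookup (Vec.tabulate f)

memo≗ : ∀ {a} {A : Set a} {n} (f : Vector A n) i → memo f i ≡ f i
memo≗ = Vec.lookup∘tabulate

-- ℕΣ.sum without the cost of projecting the operations out of a semiring.
plainSum : ∀ {n} → Vector ℕ n → ℕ
plainSum {zero}  f = 0
plainSum {suc n} f = f zero ℕ.+ plainSum (f ∘ suc)

plainSum≡sum : ∀ {n} (f : Vector ℕ n) → plainSum f ≡ ℕΣ.sum f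
plainSum≡sum {zero}  f = ≡.refl
plainSum≡sum {suc n} f = ≡.cong (f zero ℕ.+_) (plainSum≡sum (f ∘ suc))

memoWalks : ∀ {n} → (Fin n → Fin n → ℕ) → ℕ → Vector ℕ n → Vector ℕ n
memoWalks a zero    v = v
memoWalks a (suc m) v = memoWalks a m (memo λ i → plainSum λ j → a i j ℕ.* v j)

memoClosedWalks : ∀ {n} → (Fin n → Fin n → ℕ) → ℕ → ℕ
memoClosedWalks a m = plainSum λ k → memoWalks a m (unitℕ k) k

anyᵇ allᵇ : ∀ {n} → (Fin n → Bool) → Bool
anyᵇ {zero}  f = false
anyᵇ {suc n} f = f zero ∨ anyᵇ (f ∘ suc)
allᵇ {zero}  f = true
allᵇ {suc n} f = f zero ∧ allᵇ (f ∘ suc)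

-- Some vertex other than the root returns to itself within k steps of ascent. Such parent functions
-- describe no tree and are exempt from the check.
cyclic : ∀ {k} → (Fin k → Fin (suc k)) → Bool
cyclic {k} p = anyᵇ λ u → anyᵇ {k} λ m → does (ascend^ p (toℕ m) (p u) Fin.≟ suc u)

fewEdgesᵇ : ∀ {n} → (Fin n → Fin n → ℕ) → Bool
fewEdgesᵇ {n} a = 51 ℕ.* n ℕ.+ memoClosedWalks a 6 ℕ.≤ᵇ 12 ℕ.* (memoClosedWalks a 2 ℕ.+ memoClosedWalks a 4)

checkTree : ∀ {k} → (Fin k → Fin (suc k)) → Bool
checkTree p = cyclic p ∨ fewEdgesᵇ (memo λ i → memo (parentMatrix p i))

allFunctions : ∀ k m → ((Fin k → Fin m) → Bool) → Bool
allFunctions zero    m P = P []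
allFunctions (suc k) m P = allᵇ λ x → allFunctions k m λ f → P (x ∷ f)

Checked : ℕ → Set
Checked k = allFunctions k (suc k) checkTree ≡ true

-- By evaluation on all 4³ = 64 parent functions; the next two run through 5⁴ = 625 and 6⁵ = 7776.
trees₄ : Checked 3
trees₄ = ≡.refl

trees₅ : Checked 4
trees₅ = ≡.refl

trees₆ : Checked 5
trees₆ = ≡.refl

memoClosedWalks≡ : ∀ {n} (a : Fin n → Fin n → ℕ) m → memoClosedWalks a m ≡ closedWalks a m
memoClosedWalks≡ {n} a m = ≡.trans (plainSum≡sum λ k → memoWalks a m (unitℕ k) k)
  (ℕΣ.sum-cong-≗ λ k → memoWalks≡ m (λ _ → ≡.refl) k)
  where
  memoWalks≡ : ∀ m {v u : Vector ℕ n} → (∀ i → v i ≡ u i) → ∀ i → memoWalks a m v i ≡ walks a m u i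
  memoWalks≡ zero    v≡u = v≡u
  memoWalks≡ (suc m) {v} v≡u = memoWalks≡ m λ i → ≡.trans
    (memo≗ (λ i → plainSum λ j → a i j ℕ.* v j) i)
    (≡.trans (plainSum≡sum λ j → a i j ℕ.* v j) (ℕΣ.sum-cong-≗ λ j → ≡.cong (a i j ℕ.*_) (v≡u j)))

∧-true : ∀ {a b} → a ∧ b ≡ true → a ≡ true × b ≡ true
∧-true {true} eq = ≡.refl , eq

∨-true : ∀ {a b} → a ∨ b ≡ true → a ≡ true ⊎ b ≡ true
∨-true {true}  eq = inj₁ ≡.refl
∨-true {false} eq = inj₂ eq

anyᵇ-sound : ∀ {n} (f : Fin n → Bool) → anyᵇ f ≡ true → ∃ λ i → f i ≡ true
anyᵇ-sound {suc n} f eq with ∨-true {f zero} eq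
... | inj₁ eq₀ = zero , eq₀
... | inj₂ eq′ = let i , fi = anyᵇ-sound (f ∘ suc) eq′ in suc i , fi

allᵇ-sound : ∀ {n} (f : Fin n → Bool) → allᵇ f ≡ true → ∀ i → f i ≡ true
allᵇ-sound f eq zero    = proj₁ (∧-true eq)
allᵇ-sound f eq (suc i) = allᵇ-sound (f ∘ suc) (proj₂ (∧-true {f zero} eq)) i

-- The enumeration meets `f` only up to pointwise equality. The conclusion about `g` is carried to
-- `f` later, by congruence of the walk counts.
allFunctions-sound : ∀ k m (Q : (Fin k → Fin m) → Bool) → allFunctions k m Q ≡ true →
  (f : Fin k → Fin m) → ∃ λ (g : Fin k → Fin m) → (∀ i → g i ≡ f i) × Q g ≡ true
allFunctions-sound zero    m Q eq f = [] , (λ ()) , eq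
allFunctions-sound (suc k) m Q eq f =
  let g , g≡f , Qg = allFunctions-sound k m (λ h → Q (f zero ∷ h))
                        (allᵇ-sound (λ x → allFunctions k m λ h → Q (x ∷ h)) eq (f zero)) (f ∘ suc)
  in f zero ∷ g , (λ { zero → ≡.refl ; (suc i) → g≡f i }) , Qg

does-true : ∀ {A : Set} (a? : Dec A) → does a? ≡ true → A
does-true (yes a) _ = a

Descends : ∀ {k} → (Fin k → Fin (suc k)) → (Fin (suc k) → ℕ) → Set
Descends p d = ∀ u → d (p u) ℕ.< d (suc u)

record FewEdges {n} (a : Fin n → Fin n → ℕ) : Set where
  constructor few
  field bound : 51 ℕ.* n ℕ.+ closedWalks a 6 ℕ.≤ 12 ℕ.* (closedWalks a 2 ℕ.+ closedWalks a 4)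

record ManyEdges {n} (a : Fin n → Fin n → ℕ) : Set where
  constructor many
  field bound : 6677 ℕ.* n ℕ.≤ 3900 ℕ.* closedWalks a 2

module _ {k} (p : Fin k → Fin (suc k)) (d : Fin (suc k) → ℕ) (descends : Descends p d) where

  ascend^-≤ : ∀ m v → d (ascend^ p m v) ℕ.≤ d v
  ascend^-≤ zero    v       = ℕ.≤-refl
  ascend^-≤ (suc m) zero    = ascend^-≤ m zero
  ascend^-≤ (suc m) (suc u) = ℕ.≤-trans (ascend^-≤ m (p u)) (ℕ.<⇒≤ (descends u))

  -- The step to the parent strictly decreases `d` and further ascent never increases it, so no
  -- vertex returns to itself.
  ¬cyclic : cyclic p ≢ true
  ¬cyclic eq =
    let returns = λ u (m : Fin k) → does (ascend^ p (toℕ m) (p u) Fin.≟ suc u)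
        u , equ = anyᵇ-sound (λ u → anyᵇ (returns u)) eq
        m , eqm = anyᵇ-sound (returns u) equ
    in ℕ.<-irrefl (≡.cong d (does-true (ascend^ p (toℕ m) (p u) Fin.≟ suc u) eqm))
         (ℕ.≤-<-trans (ascend^-≤ (toℕ m) (p u)) (descends u))

  checkTree-sound : checkTree p ≡ true → FewEdges (parentMatrix p)
  checkTree-sound eq with ∨-true {cyclic p} eq
  ... | inj₁ cyc = contradiction cyc ¬cyclic
  ... | inj₂ le = few (≡.subst₂ (λ x y → 51 ℕ.* suc k ℕ.+ x ℕ.≤ 12 ℕ.* y) (walks≡ 6) (≡.cong₂ ℕ._+_ (walks≡ 2) (walks≡ 4))
    (ℕ.≤ᵇ⇒≤ (51 ℕ.* suc k ℕ.+ memoClosedWalks A 6) (12 ℕ.* (memoClosedWalks A 2 ℕ.+ memoClosedWalks A 4))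
      (≡.subst Bool.T (≡.sym le) tt)))
    where
    A : Fin (suc k) → Fin (suc k) → ℕ
    A = memo λ i → memo (parentMatrix p i)
    walks≡ : ∀ m → memoClosedWalks A m ≡ closedWalks (parentMatrix p) m
    walks≡ m = ≡.trans (memoClosedWalks≡ A m) (closedWalks-cong {a = A} {b = parentMatrix p} (λ i j →
      ≡.trans (≡.cong (_$ j) (memo≗ (λ i → memo (parentMatrix p i)) i)) (memo≗ (parentMatrix p i) j)) m)

parentMatrix-cong : ∀ {k} {p q : Fin k → Fin (suc k)} → (∀ u → p u ≡ q u) → ∀ i j → parentMatrix p i j ≡ parentMatrix q i j
parentMatrix-cong {k} {p} {q} p≡q i j = ≡.cong₂ ℕ._+_ (arcs≡ i j) (arcs≡ j i)
  where
  arcs≡ : ∀ i j → parentArcs p i j ≡ parentArcs q i j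
  arcs≡ zero    j = ≡.refl
  arcs≡ (suc u) j = ≡.cong (λ w → if does (w Fin.≟ j) then 1 else 0) (p≡q u)

FewEdges-cong : ∀ {n} {a b : Fin n → Fin n → ℕ} → (∀ i j → a i j ≡ b i j) → FewEdges a → FewEdges b
FewEdges-cong {n} {a} {b} a≡b (few le) = few (≡.subst₂ (λ x y → 51 ℕ.* n ℕ.+ x ℕ.≤ 12 ℕ.* y)
  (closedWalks-cong a≡b 6) (≡.cong₂ ℕ._+_ (closedWalks-cong a≡b 2) (closedWalks-cong a≡b 4)) le)

tree-fewEdges : ∀ k → Checked k →
  ∀ p d → Descends p d → FewEdges (parentMatrix {k} p)
tree-fewEdges k checked p d descends =
  let g , g≡p , check = allFunctions-sound k (suc k) checkTree checked p
  in FewEdges-cong {a = parentMatrix g} {b = parentMatrix p} (parentMatrix-cong {p = g} {q = p} g≡p)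
       (checkTree-sound g d (λ u → ≡.subst (λ v → d v ℕ.< d (suc u)) (≡.sym (g≡p u)) (descends u)) check)

-- Arc counts of trees and graphs

sum-≤-tight : ∀ {n} (f g : Vector ℕ n) → (∀ i → f i ℕ.≤ g i) → ℕΣ.sum g ℕ.≤ ℕΣ.sum f → ∀ i → g i ≡ f i
sum-≤ : ∀ {n} (f g : Vector ℕ n) → (∀ i → f i ℕ.≤ g i) → ℕΣ.sum f ℕ.≤ ℕΣ.sum g
sum-≤ {zero}  f g f≤g = ℕ.z≤n
sum-≤ {suc n} f g f≤g = ℕ.+-mono-≤ (f≤g zero) (sum-≤ (f ∘ suc) (g ∘ suc) (f≤g ∘ suc))
sum-≤-tight {suc n} f g f≤g le zero = ℕ.≤-antisym
  (ℕ.+-cancelʳ-≤ (ℕΣ.sum (f ∘ suc)) _ _ (ℕ.≤-trans (ℕ.+-monoʳ-≤ (g zero) (sum-≤ (f ∘ suc) (g ∘ suc) (f≤g ∘ suc))) le))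
  (f≤g zero)
sum-≤-tight {suc n} f g f≤g le (suc i) = sum-≤-tight (f ∘ suc) (g ∘ suc) (f≤g ∘ suc)
  (ℕ.+-cancelˡ-≤ (f zero) _ _ (ℕ.≤-trans (ℕ.+-monoˡ-≤ _ (f≤g zero)) le)) i

sum-unit : ∀ {n} (f : Vector ℕ n) k → ℕΣ.sum (λ j → f j ℕ.* unitℕ k j) ≡ f k
sum-unit {suc n} f zero = ≡.trans
  (≡.cong₂ ℕ._+_ (ℕ.*-identityʳ (f zero))
    (≡.trans (ℕΣ.sum-cong-≗ λ j → ℕ.*-zeroʳ (f (suc j))) (ℕΣ.sum-replicate-zero n)))
  (ℕ.+-identityʳ (f zero))
sum-unit {suc n} f (suc k) = ≡.cong₂ ℕ._+_ (ℕ.*-zeroʳ (f zero)) (sum-unit (f ∘ suc) k)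

sum-indicator : ∀ {n} (i : Fin n) → ℕΣ.sum (unitℕ i) ≡ 1
sum-indicator i = ≡.trans (ℕΣ.sum-cong-≗ λ j → ≡.sym (ℕ.*-identityˡ (unitℕ i j))) (sum-unit (λ _ → 1) i)

arcs : ∀ {n} → (Fin n → Fin n → ℕ) → ℕ
arcs a = ℕΣ.sum λ i → ℕΣ.sum λ j → a i j

arcs-parentArcs : ∀ {k} (p : Fin k → Fin (suc k)) → arcs (parentArcs p) ≡ k
arcs-parentArcs {k} p = ≡.trans
  (≡.cong₂ ℕ._+_ (ℕΣ.sum-replicate-zero (suc k)) (ℕΣ.sum-cong-≗ λ u → sum-indicator (p u)))
  (ones k)
  where
  ones : ∀ k → ℕΣ.sum {k} (λ _ → 1) ≡ k
  ones zero    = ≡.refl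
  ones (suc k) = ≡.cong suc (ones k)

arcs-parentMatrix : ∀ {k} (p : Fin k → Fin (suc k)) → arcs (parentMatrix p) ≡ k ℕ.+ k
arcs-parentMatrix p = begin
  arcs (parentMatrix p)
    ≡⟨ ℕΣ.sum-cong-≗ (λ i → ℕΣ.∑-distrib-+ (parentArcs p i) (λ j → parentArcs p j i)) ⟩
  ℕΣ.sum (λ i → ℕΣ.sum (parentArcs p i) ℕ.+ ℕΣ.sum (λ j → parentArcs p j i))
    ≡⟨ ℕΣ.∑-distrib-+ (λ i → ℕΣ.sum (parentArcs p i)) (λ i → ℕΣ.sum λ j → parentArcs p j i) ⟩
  arcs (parentArcs p) ℕ.+ ℕΣ.sum (λ i → ℕΣ.sum λ j → parentArcs p j i)
    ≡⟨ ≡.cong (arcs (parentArcs p) ℕ.+_) (ℕΣ.∑-comm (λ i j → parentArcs p j i)) ⟩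
  arcs (parentArcs p) ℕ.+ arcs (parentArcs p)
    ≡⟨ ≡.cong₂ ℕ._+_ (arcs-parentArcs p) (arcs-parentArcs p) ⟩
  _ ∎
  where open ≡.≡-Reasoning

-- Breadth-first search.

least : ∀ {Q : ℕ → Set} → Decidable Q → ∀ n → Q n → ∃ λ m → Q m × (∀ {l} → Q l → m ℕ.≤ l)
least Q? zero    q = zero , q , λ _ → ℕ.z≤n
least {Q} Q? (suc n) q with Q? zero
... | yes q₀ = zero , q₀ , λ _ → ℕ.z≤n
... | no ¬q₀ = let m , qm , min = least (Q? ∘ suc) n q in
  suc m , qm , λ { {zero} q₀ → contradiction q₀ ¬q₀ ; {suc l} ql → ℕ.s≤s (min ql) }

module _ {k} (G : Graph (suc k)) (connected : Connected G) where
  open Graph G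

  Reaches : ℕ → Fin (suc k) → Set
  Reaches zero    v = v ≡ zero
  Reaches (suc m) v = ∃ λ w → v ~ w × Reaches m w

  reaches? : ∀ m → Decidable (Reaches m)
  reaches? zero    v = v Fin.≟ zero
  reaches? (suc m) v = Fin.any? λ w → v ~? w ×-dec reaches? m w

  walkLength : ∀ {v} → Star _~_ v zero → ∃ λ m → Reaches m v
  walkLength stop       = 0 , ≡.refl
  walkLength (e ◅ path) = let m , r = walkLength path in suc m , _ , e , r

  shortest : ∀ v → ∃ λ m → Reaches m v × (∀ {l} → Reaches l v → m ℕ.≤ l)
  shortest v = let m , r = walkLength (connected v zero) in least (λ m → reaches? m v) m r

  dist : Fin (suc k) → ℕ
  dist v = proj₁ (shortest v)

  -- The first step of a shortest walk to zero; the rest of that walk bounds the distance of the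
  -- parent.
  parentOf : ∀ u → ∃ λ w → suc u ~ w × dist w ℕ.< dist (suc u)
  parentOf u with shortest (suc u)
  ... | suc m , (w , e , r) , _ = w , e , ℕ.s≤s (proj₂ (proj₂ (shortest w)) r)

  parent : Fin k → Fin (suc k)
  parent u = proj₁ (parentOf u)

  parent-~ : ∀ u → suc u ~ parent u
  parent-~ u = proj₁ (proj₂ (parentOf u))

  parent-descends : Descends parent dist
  parent-descends u = proj₂ (proj₂ (parentOf u))

  adjacency-1 : ∀ {i j} → i ~ j → adjacency G i j ≡ 1
  adjacency-1 {i} {j} e rewrite dec-true (i ~? j) e = ≡.refl

  parentArcs-cases : ∀ i j → parentArcs parent i j ≡ 0 ⊎
    (parentArcs parent i j ≡ 1 × i ~ j × dist j ℕ.< dist i)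
  parentArcs-cases zero    j = inj₁ ≡.refl
  parentArcs-cases (suc u) j with parent u Fin.≟ j
  ... | yes ≡.refl = inj₂ (≡.refl , parent-~ u , parent-descends u)
  ... | no _       = inj₁ ≡.refl

  -- Two vertices cannot be parents of each other, since each would be nearer to zero than the
  -- other; so the entry never reaches 2.
  parentMatrix≤adjacency : ∀ i j → parentMatrix parent i j ℕ.≤ adjacency G i j
  parentMatrix≤adjacency i j with parentArcs-cases i j | parentArcs-cases j i
  ... | inj₁ p₁           | inj₁ p₂           = ℕ.≤-trans (ℕ.≤-reflexive (≡.cong₂ ℕ._+_ p₁ p₂)) ℕ.z≤n
  ... | inj₁ p₁           | inj₂ (p₂ , e , _) = ℕ.≤-reflexive (≡.trans (≡.cong₂ ℕ._+_ p₁ p₂) (≡.sym (adjacency-1 (~-sym e))))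
  ... | inj₂ (p₁ , e , _) | inj₁ p₂           = ℕ.≤-reflexive (≡.trans (≡.cong₂ ℕ._+_ p₁ p₂) (≡.sym (adjacency-1 e)))
  ... | inj₂ (_ , _ , <₁) | inj₂ (_ , _ , <₂) = contradiction <₂ (ℕ.<-asym <₁)

  adjacency-sym : ∀ i j → adjacency G i j ≡ adjacency G j i
  adjacency-sym i j with i ~? j | j ~? i
  ... | yes _ | yes _ = ≡.refl
  ... | no _  | no _  = ≡.refl
  ... | yes e | no ¬e = contradiction (~-sym e) ¬e
  ... | no ¬e | yes e = contradiction (~-sym e) ¬e

  adjacency-idem : ∀ i j → adjacency G i j ℕ.* adjacency G i j ≡ adjacency G i j
  adjacency-idem i j with does (i ~? j)
  ... | true  = ≡.refl
  ... | false = ≡.refl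

  -- By symmetry tr A² is the sum of the squared entries, and each entry is 0 or 1.
  closedWalks₂ : closedWalks (adjacency G) 2 ≡ arcs (adjacency G)
  closedWalks₂ = ℕΣ.sum-cong-≗ λ i → ℕΣ.sum-cong-≗ λ j → ≡.trans
    (≡.cong (adjacency G i j ℕ.*_) (≡.trans (sum-unit (adjacency G j) i) (adjacency-sym j i)))
    (adjacency-idem i j)

  2k≤arcs : k ℕ.+ k ℕ.≤ arcs (adjacency G)
  2k≤arcs = ≡.subst (ℕ._≤ arcs (adjacency G)) (arcs-parentMatrix parent)
    (sum-≤ _ _ λ i → sum-≤ _ _ (parentMatrix≤adjacency i))

  -- `sum-≤-tight` acts twice: equal totals force equal row sums, and equal row sums force equal
  -- entries.
  tree : arcs (adjacency G) ℕ.≤ k ℕ.+ k → ∀ i j → adjacency G i j ≡ parentMatrix parent i j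
  tree le i = sum-≤-tight _ _ (parentMatrix≤adjacency i) (ℕ.≤-reflexive (sum-≤-tight
    (λ i → ℕΣ.sum (parentMatrix parent i)) (λ i → ℕΣ.sum (adjacency G i))
    (λ i → sum-≤ _ _ (parentMatrix≤adjacency i))
    (≡.subst (arcs (adjacency G) ℕ.≤_) (≡.sym (arcs-parentMatrix parent)) le) i))

-- Graphs with four or more vertices

manyEdges : ∀ {n} (G : Graph (suc n)) → Connected G → ∀ m →
  6677 ℕ.* suc n ℕ.≤ 3900 ℕ.* m → m ℕ.≤ arcs (adjacency G) → ManyEdges (adjacency G)
manyEdges G connected m le m≤arcs = many (ℕ.≤-trans le (ℕ.*-monoʳ-≤ 3900
  (ℕ.≤-trans m≤arcs (ℕ.≤-reflexive (≡.sym (closedWalks₂ G connected))))))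

smallGraph : ∀ k → Checked k →
  6677 ℕ.* suc k ℕ.≤ 3900 ℕ.* suc (k ℕ.+ k) →
  (G : Graph (suc k)) → Connected G → ManyEdges (adjacency G) ⊎ FewEdges (adjacency G)
smallGraph k checked le G connected = case (arcs (adjacency G) ℕ.≤? k ℕ.+ k)
  where
  case : Dec (arcs (adjacency G) ℕ.≤ k ℕ.+ k) → ManyEdges (adjacency G) ⊎ FewEdges (adjacency G)
  case (yes arcs≤) = inj₂ (FewEdges-cong (λ i j → ≡.sym (tree G connected arcs≤ i j))
    (tree-fewEdges k checked (parent G connected) (dist G connected) (parent-descends G connected)))
  -- The number of arcs is even, hence at least 2 k + 2, but 2 k + 1 already suffices for the
  -- numerical condition.
  case (no arcs≰)  = inj₁ (manyEdges G connected (suc (k ℕ.+ k)) le (ℕ.≰⇒> arcs≰))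

-- Both sides are linear in l, so values at l = 0 and slopes are compared.
linear-≤ : ∀ a b l → a ℕ.* 7 ℕ.≤ b ℕ.* 12 → a ℕ.≤ b ℕ.* 2 → a ℕ.* (7 ℕ.+ l) ℕ.≤ b ℕ.* (6 ℕ.+ l ℕ.+ (6 ℕ.+ l))
linear-≤ a b l h₀ h₁ = begin
  a ℕ.* (7 ℕ.+ l)                   ≡⟨ ℕ.*-distribˡ-+ a 7 l ⟩
  a ℕ.* 7 ℕ.+ a ℕ.* l               ≤⟨ ℕ.+-mono-≤ h₀ (ℕ.*-monoˡ-≤ l h₁) ⟩
  b ℕ.* 12 ℕ.+ b ℕ.* 2 ℕ.* l        ≡⟨ solve 2 (λ b l → b :* con 12 :+ b :* con 2 :* l := b :* (con 6 :+ l :+ (con 6 :+ l))) ≡.refl b l ⟩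
  b ℕ.* (6 ℕ.+ l ℕ.+ (6 ℕ.+ l))     ∎
  where
  open ℕ.≤-Reasoning
  open ℕ-Solver.+-*-Solver

largeGraph : ∀ l (G : Graph (7 ℕ.+ l)) → Connected G → ManyEdges (adjacency G)
largeGraph l G connected = manyEdges G connected (6 ℕ.+ l ℕ.+ (6 ℕ.+ l))
  -- At 7 vertices this is 46739 ≤ 46800; at 6 vertices it would read 40062 ≤ 39000, which is why
  -- smaller trees are treated separately.
  (linear-≤ 6677 3900 l (ℕ.≤ᵇ⇒≤ (6677 ℕ.* 7) (3900 ℕ.* 12) tt) (ℕ.≤ᵇ⇒≤ 6677 (3900 ℕ.* 2) tt)) (2k≤arcs G connected)

-- Graphs with at most three vertices

neighbour : ∀ {n} (G : Graph n) → Connected G → ∀ {u v} → u ≢ v → ∃ λ w → Graph._~_ G u w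
neighbour G connected {u} {v} u≢v with connected u v
... | stop  = contradiction ≡.refl u≢v
... | e ◅ _ = _ , e

-- The relabellings in use are the identity and transpositions, so one map serves as its own
-- inverse.
isomorphic-involution : ∀ {n} (G H : Graph n) (σ : Fin n → Fin n) → (∀ i → σ (σ i) ≡ i) →
  (∀ u v → Graph._~_ G u v → Graph._~_ H (σ u) (σ v)) →
  (∀ u v → Graph._~_ H (σ u) (σ v) → Graph._~_ G u v) → Isomorphic G H
isomorphic-involution G H σ σσ to from = mk↔ₛ′ σ σ σσ σσ , λ u v → mk⇔ (to u v) (from u v)

isomorphic-K₁ : (G : Graph 1) → Isomorphic G (K 1)
isomorphic-K₁ G = isomorphic-involution G (K 1) id (λ _ → ≡.refl)
  (λ { zero zero e → contradiction e (Graph.irrefl G ≡.refl) })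
  (λ { zero zero 0≢0 → contradiction ≡.refl 0≢0 })

isomorphic-K₂ : (G : Graph 2) → Connected G → Isomorphic G (K 2)
isomorphic-K₂ G connected = isomorphic-involution G (K 2) id (λ _ → ≡.refl)
  (λ u v e u≡v → Graph.irrefl G u≡v e)
  (λ { zero zero u≢v → contradiction ≡.refl u≢v
     ; zero (suc zero) _ → edge
     ; (suc zero) zero _ → Graph.~-sym G edge
     ; (suc zero) (suc zero) u≢v → contradiction ≡.refl u≢v })
  where
  edge : Graph._~_ G zero (suc zero)
  edge with neighbour G connected {zero} {suc zero} (λ ())
  ... | zero     , e = contradiction e (Graph.irrefl G ≡.refl)
  ... | suc zero , e = e

module _ (G : Graph 3) (connected : Connected G) where
  open Graph G

  private
    0F 1F 2F : Fin 3
    0F = zero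
    1F = suc zero
    2F = suc (suc zero)

  module _ (σ : Fin 3 → Fin 3) (σσ : ∀ i → σ (σ i) ≡ i) where

    -- Symmetry and irreflexivity of both graphs settle the remaining pairs, so three Boolean
    -- comparisons give the isomorphism.
    isomorphic-pairs : (∀ u v → u Fin.< v → does (u ~? v) ≡ does (Graph._~?_ (P 3) (σ u) (σ v))) → Isomorphic G (P 3)
    isomorphic-pairs same = isomorphic-involution G (P 3) σ σσ
      (λ u v e → does-true (Graph._~?_ (P 3) (σ u) (σ v)) (≡.trans (≡.sym (same′ u v)) (dec-true (u ~? v) e)))
      (λ u v e → does-true (u ~? v) (≡.trans (same′ u v) (dec-true (Graph._~?_ (P 3) (σ u) (σ v)) e)))
      where
      does-sym : ∀ {n} (H : Graph n) u v → does (Graph._~?_ H u v) ≡ does (Graph._~?_ H v u)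
      does-sym H u v with Graph._~?_ H u v | Graph._~?_ H v u
      ... | yes _ | yes _ = ≡.refl
      ... | no _  | no _  = ≡.refl
      ... | yes e | no ¬e = contradiction (Graph.~-sym H e) ¬e
      ... | no ¬e | yes e = contradiction (Graph.~-sym H e) ¬e
      same′ : ∀ u v → does (u ~? v) ≡ does (Graph._~?_ (P 3) (σ u) (σ v))
      same′ u v with Fin.<-cmp u v
      ... | tri< u<v _ _    = same u v u<v
      ... | tri> _ _ v<u    = ≡.trans (does-sym G u v) (≡.trans (same v u v<u) (does-sym (P 3) (σ v) (σ u)))
      ... | tri≈ _ ≡.refl _ = ≡.trans (dec-false (u ~? u) (irrefl ≡.refl))
                                (≡.sym (dec-false (Graph._~?_ (P 3) (σ u) (σ u)) (Graph.irrefl (P 3) ≡.refl)))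

  pairs : ∀ {Q : Fin 3 → Fin 3 → Set} → Q 0F 1F → Q 0F 2F → Q 1F 2F → ∀ u v → u Fin.< v → Q u v
  pairs a b c zero             (suc zero)       _                    = a
  pairs a b c zero             (suc (suc zero)) _                    = b
  pairs a b c (suc zero)       (suc (suc zero)) _                    = c
  pairs a b c (suc zero)       (suc zero)       (ℕ.s≤s ())
  pairs a b c (suc (suc zero)) (suc zero)       (ℕ.s≤s ())
  pairs a b c (suc (suc zero)) (suc (suc zero)) (ℕ.s≤s (ℕ.s≤s ()))

  triangle : 0F ~ 1F → 0F ~ 2F → 1F ~ 2F → 6 ℕ.≤ arcs (adjacency G)
  triangle a b c = sum-≤ (λ i → ℕΣ.sum (complete i)) (λ i → ℕΣ.sum (adjacency G i))
    (λ i → sum-≤ (complete i) (adjacency G i) (complete≤ i))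
    where
    complete : Fin 3 → Fin 3 → ℕ
    complete i j = if does (i Fin.≟ j) then 0 else 1
    adjacent : ∀ u v → u ≢ v → u ~ v
    adjacent u v u≢v with Fin.<-cmp u v
    ... | tri< u<v _ _ = pairs {_~_} a b c u v u<v
    ... | tri≈ _ u≡v _ = contradiction u≡v u≢v
    ... | tri> _ _ v<u = ~-sym (pairs {_~_} a b c v u v<u)
    complete≤ : ∀ i j → complete i j ℕ.≤ adjacency G i j
    complete≤ i j with i Fin.≟ j
    ... | yes _  = ℕ.z≤n
    ... | no i≢j = ℕ.≤-reflexive (≡.sym (adjacency-1 G connected (adjacent i j i≢j)))

  swap₀₁ swap₁₂ : Fin 3 → Fin 3
  swap₀₁ zero             = 1F
  swap₀₁ (suc zero)       = 0F
  swap₀₁ (suc (suc zero)) = 2F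
  swap₁₂ zero             = 0F
  swap₁₂ (suc zero)       = 2F
  swap₁₂ (suc (suc zero)) = 1F

  -- If two vertices are not adjacent, the third one is the centre of a path.
  manyEdges-or-P₃ : ManyEdges (adjacency G) ⊎ Isomorphic G (P 3)
  manyEdges-or-P₃ = case (0F ~? 1F) (0F ~? 2F) (1F ~? 2F)
    where
    case : Dec (0F ~ 1F) → Dec (0F ~ 2F) → Dec (1F ~ 2F) → ManyEdges (adjacency G) ⊎ Isomorphic G (P 3)
    case (yes a) (yes b) (yes c) = inj₁ (manyEdges G connected 6 (ℕ.≤ᵇ⇒≤ (6677 ℕ.* 3) (3900 ℕ.* 6) tt) (triangle a b c))
    -- Here the centre is `2F`, and `swap₁₂` moves it to the middle vertex `1F` of `P 3`.
    case (no ¬a) _ _ = inj₂ (isomorphic-pairs swap₁₂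
      (λ { zero → ≡.refl ; (suc zero) → ≡.refl ; (suc (suc zero)) → ≡.refl })
      (pairs (dec-false (0F ~? 1F) ¬a) (dec-true (0F ~? 2F) 0~2) (dec-true (1F ~? 2F) 1~2)))
      where
      0~2 : 0F ~ 2F
      0~2 with neighbour G connected {0F} {1F} (λ ())
      ... | zero           , e = contradiction e (irrefl ≡.refl)
      ... | suc zero       , e = contradiction e ¬a
      ... | suc (suc zero) , e = e
      1~2 : 1F ~ 2F
      1~2 with neighbour G connected {1F} {0F} (λ ())
      ... | zero           , e = contradiction (~-sym e) ¬a
      ... | suc zero       , e = contradiction e (irrefl ≡.refl)
      ... | suc (suc zero) , e = e
    case (yes a) (no ¬b) _ = inj₂ (isomorphic-pairs id (λ _ → ≡.refl)
      (pairs (dec-true (0F ~? 1F) a) (dec-false (0F ~? 2F) ¬b) (dec-true (1F ~? 2F) 1~2)))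
      where
      1~2 : 1F ~ 2F
      1~2 with neighbour G connected {2F} {0F} (λ ())
      ... | zero           , e = contradiction (~-sym e) ¬b
      ... | suc zero       , e = ~-sym e
      ... | suc (suc zero) , e = contradiction e (irrefl ≡.refl)
    case (yes a) (yes b) (no ¬c) = inj₂ (isomorphic-pairs swap₀₁
      (λ { zero → ≡.refl ; (suc zero) → ≡.refl ; (suc (suc zero)) → ≡.refl })
      (pairs (dec-true (0F ~? 1F) a) (dec-true (0F ~? 2F) b) (dec-false (1F ~? 2F) ¬c)))

-- Case distinction on the number of vertices

manyEdges-or-fewEdges : ∀ n .{{_ : ℕ.NonZero n}} (G : Graph n) → Connected G →
  ¬ Isomorphic G (K 1) → ¬ Isomorphic G (K 2) → ¬ Isomorphic G (P 3) →
  ManyEdges (adjacency G) ⊎ FewEdges (adjacency G)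
manyEdges-or-fewEdges 1 G connected ¬K₁ ¬K₂ ¬P₃ = contradiction (isomorphic-K₁ G) ¬K₁
manyEdges-or-fewEdges 2 G connected ¬K₁ ¬K₂ ¬P₃ = contradiction (isomorphic-K₂ G connected) ¬K₂
manyEdges-or-fewEdges 3 G connected ¬K₁ ¬K₂ ¬P₃ = case (manyEdges-or-P₃ G connected)
  where
  case : ManyEdges (adjacency G) ⊎ Isomorphic G (P 3) → ManyEdges (adjacency G) ⊎ FewEdges (adjacency G)
  case (inj₁ h) = inj₁ h
  case (inj₂ p) = contradiction p ¬P₃
manyEdges-or-fewEdges 4 G connected ¬K₁ ¬K₂ ¬P₃ = smallGraph 3 trees₄ (ℕ.≤ᵇ⇒≤ (6677 ℕ.* 4) (3900 ℕ.* 7) tt) G connected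
manyEdges-or-fewEdges 5 G connected ¬K₁ ¬K₂ ¬P₃ = smallGraph 4 trees₅ (ℕ.≤ᵇ⇒≤ (6677 ℕ.* 5) (3900 ℕ.* 9) tt) G connected
manyEdges-or-fewEdges 6 G connected ¬K₁ ¬K₂ ¬P₃ = smallGraph 5 trees₆ (ℕ.≤ᵇ⇒≤ (6677 ℕ.* 6) (3900 ℕ.* 11) tt) G connected
manyEdges-or-fewEdges (suc (suc (suc (suc (suc (suc (suc l))))))) G connected ¬K₁ ¬K₂ ¬P₃ = inj₁ (largeGraph l G connected)

theorem1p8 : (n : ℕ) .{{_ : NonZero n}} (G : Graph n) → Connected G →
    ¬ Isomorphic G (K 1) → ¬ Isomorphic G (K 2) → ¬ Isomorphic G (P 3) →
    (λs : Vector ℝ n) → IsSpectrum (adjacencyMatrix G) λs →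
    √ 5 * fromℚ ½ * fromℕ n ≤ positive3Energy λs
theorem1p8 n G connected ¬K₁ ¬K₂ ¬P₃ λs spectrum = case (manyEdges-or-fewEdges n G connected ¬K₁ ¬K₂ ¬P₃)
  where
  case : ManyEdges (adjacency G) ⊎ FewEdges (adjacency G) → √ 5 * fromℚ ½ * fromℕ n ≤ positive3Energy λs
  case (inj₁ (many bound)) = energy-manyEdges G λs spectrum bound
  case (inj₂ (few bound))  = energy-fewEdges G λs spectrum bound
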